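{- Let $n\ge 3$ and let $G$ be a connected well-covered unicyclic graph of order $2n$. Then $\xi(C_n^{\ast})\le \xi(G)\le \xi(U_n^{\ast})$.
   Context: All graphs are finite, simple and undirected. A graph is well-covered if all of its maximal independent sets have the same size. A connected unicyclic graph is a connected graph containing exactly one cycle. The independence polynomial of a graph $G$ is $I(G,x)=\sum_{k\ge 0} i_kx^k$, where $i_k$ is the number of independent sets of size $k$ in $G$. It is known that the root of $I(G,x)$ of smallest modulus is real and lies in $[-1,0)$; it is denoted $\xi(G)$ (equivalently, the largest real root of $I(G,x)$). For a graph $G$, the graph star $G^{\ast}$ is obtained from $G$ by attaching, for each vertex $v$ of $G$, a new vertex $v^{\ast}$ joined by an edge to $v$ only. $C_n$ is the cycle on $n$ vertices. $U_n$ is the graph on $n$ vertices obtained from a triangle by attaching $n-3$ pendant vertices (leaves) to one fixed vertex of the triangle. -}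

module Defs where

open import Level using (0ℓ)
open import Data.Nat as ℕ using (ℕ; zero; suc)
import Data.Nat.Properties as ℕ
open import Data.Integer.Base using (+_)
open import Data.Rational as ℚ using (ℚ; 0ℚ; 1ℚ; ½; ∣_∣)
import Data.Rational.Properties as ℚ
open import Data.Rational.Solver using (module +-*-Solver)
open import Data.Bool using (true; false)
open import Data.Empty using (⊥)
open import Data.Fin using (Fin; toℕ; splitAt)
import Data.Fin.Properties as Fin
open import Data.Fin.Subset using (Subset; _∈_; _⊆_) renaming (∣_∣ to card)
open import Data.Fin.Subset.Properties using (_∈?_)
open import Data.List using (List; []; _∷_; _++_; map; filter; length; applyUpTo)
import Data.Vec as Vec
open import Data.Product using (∃-syntax; _×_; _,_)
open import Data.Sum using (_⊎_; inj₁; inj₂; swap)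
open import Function using (_∘_; _⇔_)
open import Relation.Nullary using (¬_; Dec; no)
open import Relation.Nullary.Decidable using (_×-dec_; _⊎-dec_; _→-dec_; ¬?)
open import Relation.Binary using (Rel; Decidable; Symmetric; Irreflexive)
open import Relation.Binary.Construct.Closure.ReflexiveTransitive using (Star)
open import Relation.Binary.PropositionalEquality
  using (_≡_; _≢_; refl; sym; cong; cong₂; subst; module ≡-Reasoning)

------------------------------------------------------------------------
-- Graphs

record Graph (n : ℕ) : Set₁ where
  field
    Adj    : Rel (Fin n) 0ℓ
    adj?   : Decidable Adj
    symm   : Symmetric Adj
    irrefl : Irreflexive _≡_ Adj

open Graph public

-- The simple graph generated by a relation: symmetrise, drop loops.
fromRel : ∀ {n} (R : Rel (Fin n) 0ℓ) → Decidable R → Graph n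
fromRel R R? = record
  { Adj    = λ u v → u ≢ v × (R u v ⊎ R v u)
  ; adj?   = λ u v → ¬? (u Fin.≟ v) ×-dec (R? u v ⊎-dec R? v u)
  ; symm   = λ (u≢v , r) → (u≢v ∘ sym) , swap r
  ; irrefl = λ u≡v (u≢v , _) → u≢v u≡v
  }

-- C n is the n-cycle only for n ≥ 3.
C : ∀ n → Graph n
C n = fromRel
  (λ i j → suc (toℕ i) ≡ toℕ j ⊎ (suc (toℕ i) ≡ n × toℕ j ≡ 0))
  (λ i j → (suc (toℕ i) ℕ.≟ toℕ j)
             ⊎-dec ((suc (toℕ i) ℕ.≟ n) ×-dec (toℕ j ℕ.≟ 0)))

-- For n ≥ 3: the triangle is {0, 1, 2}, with pendant vertices 3, …, n-1
-- attached to 0.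
U : ∀ n → Graph n
U n = fromRel
  (λ i j → toℕ i ≡ 0 ⊎ (toℕ i ≡ 1 × toℕ j ≡ 2))
  (λ i j → (toℕ i ℕ.≟ 0) ⊎-dec ((toℕ i ℕ.≟ 1) ×-dec (toℕ j ℕ.≟ 2)))

module _ {n} (G : Graph n) where

  StarAdj : Rel (Fin n ⊎ Fin n) 0ℓ
  StarAdj (inj₁ u) (inj₁ v) = Adj G u v
  StarAdj (inj₁ u) (inj₂ v) = u ≡ v
  StarAdj (inj₂ u) (inj₁ v) = u ≡ v
  StarAdj (inj₂ u) (inj₂ v) = ⊥

  private
    starAdj? : Decidable StarAdj
    starAdj? (inj₁ u) (inj₁ v) = adj? G u v
    starAdj? (inj₁ u) (inj₂ v) = u Fin.≟ v
    starAdj? (inj₂ u) (inj₁ v) = u Fin.≟ v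
    starAdj? (inj₂ u) (inj₂ v) = no λ ()

    starSymm : Symmetric StarAdj
    starSymm {inj₁ u} {inj₁ v} = symm G
    starSymm {inj₁ u} {inj₂ v} = sym
    starSymm {inj₂ u} {inj₁ v} = sym
    starSymm {inj₂ u} {inj₂ v} ()

    starIrrefl : ∀ x → ¬ StarAdj x x
    starIrrefl (inj₁ u) = irrefl G refl
    starIrrefl (inj₂ u) ()

  infix 10 _*
  -- The first n vertices are those of G; vertex n + v is v*.
  _* : Graph (n ℕ.+ n)
  _* = record
    { Adj    = λ x y → StarAdj (splitAt n x) (splitAt n y)
    ; adj?   = λ x y → starAdj? (splitAt n x) (splitAt n y)
    ; symm   = λ {x} {y} → starSymm {splitAt n x} {splitAt n y}
    ; irrefl = λ { {x} refl → starIrrefl (splitAt n x) }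
    }

  Connected : Set
  Connected = ∀ u v → Star (Adj G) u v

  Independent : Subset n → Set
  Independent S = ∀ u v → u ∈ S → v ∈ S → ¬ Adj G u v

  independent? : ∀ S → Dec (Independent S)
  independent? S = Fin.all? λ u → Fin.all? λ v →
    (u ∈? S) →-dec ((v ∈? S) →-dec ¬? (adj? G u v))

  MaximalIndependent : Subset n → Set
  MaximalIndependent S =
    Independent S × (∀ T → Independent T → S ⊆ T → T ⊆ S)

  WellCovered : Set
  WellCovered = ∀ S T → MaximalIndependent S → MaximalIndependent T →
                card S ≡ card T

  -- A cycle of G is a subgraph isomorphic to some C k, presented here by an
  -- embedding of C k; distinct embeddings may present the same subgraph.
  record Cycle : Set where
    field
      len     : ℕ
      3≤len   : 3 ℕ.≤ len
      vertex  : Fin len → Fin n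
      inj     : ∀ {i j} → vertex i ≡ vertex j → i ≡ j
      edge    : ∀ {i j} → Adj (C len) i j → Adj G (vertex i) (vertex j)

    Edge : Rel (Fin n) 0ℓ
    Edge u v = ∃[ i ] ∃[ j ] Adj (C len) i j × vertex i ≡ u × vertex j ≡ v

  -- A cycle has no isolated vertices, so as a subgraph it is determined by its
  -- edges.
  SameCycle : Cycle → Cycle → Set
  SameCycle c d = ∀ u v → Cycle.Edge c u v ⇔ Cycle.Edge d u v

  Unicyclic : Set
  Unicyclic = ∃[ c ] (∀ d → SameCycle c d)

subsets : ∀ n → List (Subset n)
subsets zero    = Vec.[] ∷ []
subsets (suc n) = map (true Vec.∷_) (subsets n) ++ map (false Vec.∷_) (subsets n)

-- The number i_k of independent sets of size k.
indepCount : ∀ {n} → Graph n → ℕ → ℕ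
indepCount {n} G k =
  length (filter (λ S → independent? G S ×-dec (card S ℕ.≟ k)) (subsets n))

-- Polynomials over ℕ as coefficient lists, constant term first.
Poly : Set
Poly = List ℕ

-- Coefficients i_0, …, i_n; those of higher degree vanish.
indepPoly : ∀ {n} → Graph n → Poly
indepPoly {n} G = applyUpTo (indepCount G) (suc n)

------------------------------------------------------------------------
-- Real numbers, as Cauchy sequences of rationals

record ℝ : Set where
  constructor mkℝ
  field
    seq    : ℕ → ℚ
    cauchy : ∀ ε → 0ℚ ℚ.< ε →
             ∃[ N ] (∀ m n → N ℕ.≤ m → N ℕ.≤ n → ∣ seq m ℚ.- seq n ∣ ℚ.< ε)

open ℝ public

infix 4 _≃_ _≤_

_≃_ : Rel ℝ 0ℓ
x ≃ y = ∀ ε → 0ℚ ℚ.< ε →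
        ∃[ N ] (∀ n → N ℕ.≤ n → ∣ seq x n ℚ.- seq y n ∣ ℚ.< ε)

_≤_ : Rel ℝ 0ℓ
x ≤ y = ∀ ε → 0ℚ ℚ.< ε → ∃[ N ] (∀ n → N ℕ.≤ n → seq x n ℚ.< seq y n ℚ.+ ε)

fromℕ : ℕ → ℝ
fromℕ k = mkℝ (λ _ → + k ℚ./ 1) λ ε 0<ε → 0 , λ _ _ _ _ →
  subst (ℚ._< ε) (sym (cong ∣_∣ (ℚ.+-inverseʳ (+ k ℚ./ 1)))) 0<ε

private
  half+half : ∀ p → ½ ℚ.* p ℚ.+ ½ ℚ.* p ≡ p
  half+half = solve 1 (λ p → con ½ :* p :+ con ½ :* p := p) refl
    where open +-*-Solver

  half-pos : ∀ {ε} → 0ℚ ℚ.< ε → 0ℚ ℚ.< ½ ℚ.* ε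
  half-pos {ε} 0<ε = subst (ℚ._< ½ ℚ.* ε) (ℚ.*-zeroʳ ½) (ℚ.*-monoʳ-<-pos ½ 0<ε)

  +-cauchy-split : ∀ a b c d → (a ℚ.+ b) ℚ.- (c ℚ.+ d) ≡ (a ℚ.- c) ℚ.+ (b ℚ.- d)
  +-cauchy-split =
    solve 4 (λ a b c d → (a :+ b) :- (c :+ d) := (a :- c) :+ (b :- d)) refl
    where open +-*-Solver

  *-cauchy-split : ∀ a b c d →
    a ℚ.* b ℚ.- c ℚ.* d ≡ a ℚ.* (b ℚ.- d) ℚ.+ d ℚ.* (a ℚ.- c)
  *-cauchy-split =
    solve 4 (λ a b c d → a :* b :- c :* d := a :* (b :- d) :+ d :* (a :- c)) refl
    where open +-*-Solver

  cancel : ∀ a b → (a ℚ.- b) ℚ.+ b ≡ a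
  cancel = solve 2 (λ a b → (a :- b) :+ b := a) refl
    where open +-*-Solver

  eventuallyBounded : (x : ℝ) →
    ∃[ B ] 0ℚ ℚ.< B × ∃[ N ] (∀ n → N ℕ.≤ n → ∣ seq x n ∣ ℚ.≤ B)
  eventuallyBounded x with cauchy x 1ℚ (ℚ.positive⁻¹ 1ℚ)
  ... | N , close =
    1ℚ ℚ.+ ∣ seq x N ∣
    , ℚ.+-mono-<-≤ (ℚ.positive⁻¹ 1ℚ) (ℚ.0≤∣p∣ (seq x N))
    , N , λ n N≤n → begin
      ∣ seq x n ∣                            ≡⟨ cong ∣_∣ (cancel (seq x n) (seq x N)) ⟨
      ∣ (seq x n ℚ.- seq x N) ℚ.+ seq x N ∣  ≤⟨ ℚ.∣p+q∣≤∣p∣+∣q∣ (seq x n ℚ.- seq x N) (seq x N) ⟩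
      ∣ seq x n ℚ.- seq x N ∣ ℚ.+ ∣ seq x N ∣
        ≤⟨ ℚ.+-monoˡ-≤ ∣ seq x N ∣ (ℚ.<⇒≤ (close n N N≤n ℕ.≤-refl)) ⟩
      1ℚ ℚ.+ ∣ seq x N ∣                     ∎
    where open ℚ.≤-Reasoning

infixl 6 _+_
infixl 7 _·_

_+_ : ℝ → ℝ → ℝ
x + y = mkℝ (λ n → seq x n ℚ.+ seq y n) isCauchy
  where
  open ℚ.≤-Reasoning
  isCauchy : ∀ ε → 0ℚ ℚ.< ε → ∃[ N ] (∀ m n → N ℕ.≤ m → N ℕ.≤ n →
    ∣ (seq x m ℚ.+ seq y m) ℚ.- (seq x n ℚ.+ seq y n) ∣ ℚ.< ε)
  isCauchy ε 0<ε with cauchy x _ (half-pos 0<ε) | cauchy y _ (half-pos 0<ε)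
  ... | M , p | N , q = M ℕ.⊔ N , λ m n m≥ n≥ → begin-strict
    ∣ (seq x m ℚ.+ seq y m) ℚ.- (seq x n ℚ.+ seq y n) ∣
      ≡⟨ cong ∣_∣ (+-cauchy-split (seq x m) (seq y m) (seq x n) (seq y n)) ⟩
    ∣ (seq x m ℚ.- seq x n) ℚ.+ (seq y m ℚ.- seq y n) ∣
      ≤⟨ ℚ.∣p+q∣≤∣p∣+∣q∣ (seq x m ℚ.- seq x n) (seq y m ℚ.- seq y n) ⟩
    ∣ seq x m ℚ.- seq x n ∣ ℚ.+ ∣ seq y m ℚ.- seq y n ∣
      <⟨ ℚ.+-mono-< (p m n (ℕ.m⊔n≤o⇒m≤o M N m≥) (ℕ.m⊔n≤o⇒m≤o M N n≥))
                    (q m n (ℕ.m⊔n≤o⇒n≤o M N m≥) (ℕ.m⊔n≤o⇒n≤o M N n≥)) ⟩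
    ½ ℚ.* ε ℚ.+ ½ ℚ.* ε  ≡⟨ half+half ε ⟩
    ε                    ∎

private
  shrink : ∀ {B ε} → 0ℚ ℚ.< B → 0ℚ ℚ.< ε → ∃[ δ ] 0ℚ ℚ.< δ × B ℚ.* δ ≡ ε
  shrink {B} {ε} 0<B 0<ε = ℚ.1/ B ℚ.* ε
    , subst (ℚ._< ℚ.1/ B ℚ.* ε) (ℚ.*-zeroʳ (ℚ.1/ B)) (ℚ.*-monoʳ-<-pos (ℚ.1/ B) 0<ε)
    , (begin
        B ℚ.* (ℚ.1/ B ℚ.* ε)  ≡⟨ ℚ.*-assoc B (ℚ.1/ B) ε ⟨
        B ℚ.* ℚ.1/ B ℚ.* ε    ≡⟨ cong (ℚ._* ε) (ℚ.*-inverseʳ B) ⟩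
        1ℚ ℚ.* ε              ≡⟨ ℚ.*-identityˡ ε ⟩
        ε                     ∎)
    where
    open ≡-Reasoning
    instance
      posB = ℚ.positive 0<B
      nzB  = ℚ.pos⇒nonZero B
      pos1/B = ℚ.1/pos⇒pos B

  *-bound : ∀ {B δ} → 0ℚ ℚ.< B → ∀ a b → ∣ a ∣ ℚ.≤ B → ∣ b ∣ ℚ.< δ →
            ∣ a ℚ.* b ∣ ℚ.< B ℚ.* δ
  *-bound {B} {δ} 0<B a b a≤B b<δ = begin-strict
    ∣ a ℚ.* b ∣      ≡⟨ ℚ.∣p*q∣≡∣p∣*∣q∣ a b ⟩
    ∣ a ∣ ℚ.* ∣ b ∣  ≤⟨ ℚ.*-monoʳ-≤-nonNeg ∣ b ∣ {{ℚ.nonNegative (ℚ.0≤∣p∣ b)}} a≤B ⟩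
    B ℚ.* ∣ b ∣      <⟨ ℚ.*-monoʳ-<-pos B {{ℚ.positive 0<B}} b<δ ⟩
    B ℚ.* δ          ∎
    where open ℚ.≤-Reasoning

private
  *-close : ∀ {A α B β} ε → 0ℚ ℚ.< A → 0ℚ ℚ.< B →
    A ℚ.* α ≡ ½ ℚ.* ε → B ℚ.* β ≡ ½ ℚ.* ε → ∀ a b c d →
    ∣ a ∣ ℚ.≤ A → ∣ b ℚ.- d ∣ ℚ.< α → ∣ d ∣ ℚ.≤ B → ∣ a ℚ.- c ∣ ℚ.< β →
    ∣ a ℚ.* b ℚ.- c ℚ.* d ∣ ℚ.< ε
  *-close {A} {α} {B} {β} ε 0<A 0<B Aα Bβ a b c d a≤A bd<α d≤B ac<β =
    begin-strict
    ∣ a ℚ.* b ℚ.- c ℚ.* d ∣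
      ≡⟨ cong ∣_∣ (*-cauchy-split a b c d) ⟩
    ∣ a ℚ.* (b ℚ.- d) ℚ.+ d ℚ.* (a ℚ.- c) ∣
      ≤⟨ ℚ.∣p+q∣≤∣p∣+∣q∣ (a ℚ.* (b ℚ.- d)) (d ℚ.* (a ℚ.- c)) ⟩
    ∣ a ℚ.* (b ℚ.- d) ∣ ℚ.+ ∣ d ℚ.* (a ℚ.- c) ∣
      <⟨ ℚ.+-mono-< (*-bound 0<A a (b ℚ.- d) a≤A bd<α)
                    (*-bound 0<B d (a ℚ.- c) d≤B ac<β) ⟩
    A ℚ.* α ℚ.+ B ℚ.* β  ≡⟨ cong₂ ℚ._+_ Aα Bβ ⟩
    ½ ℚ.* ε ℚ.+ ½ ℚ.* ε  ≡⟨ half+half ε ⟩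
    ε                    ∎
    where open ℚ.≤-Reasoning

_·_ : ℝ → ℝ → ℝ
x · y = mkℝ (λ n → seq x n ℚ.* seq y n) isCauchy
  where
  isCauchy : ∀ ε → 0ℚ ℚ.< ε → ∃[ N ] (∀ m n → N ℕ.≤ m → N ℕ.≤ n →
    ∣ seq x m ℚ.* seq y m ℚ.- seq x n ℚ.* seq y n ∣ ℚ.< ε)
  isCauchy ε 0<ε =
    let
      A , 0<A , K , x≤A = eventuallyBounded x
      B , 0<B , L , y≤B = eventuallyBounded y
      α , 0<α , Aα = shrink 0<A (half-pos 0<ε)
      β , 0<β , Bβ = shrink 0<B (half-pos 0<ε)
      M , y-close = cauchy y α 0<α
      N , x-close = cauchy x β 0<β
    in (K ℕ.⊔ L) ℕ.⊔ (M ℕ.⊔ N) , λ m n m≥ n≥ →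
    let
      m≥KL = ℕ.m⊔n≤o⇒m≤o (K ℕ.⊔ L) (M ℕ.⊔ N) m≥
      n≥KL = ℕ.m⊔n≤o⇒m≤o (K ℕ.⊔ L) (M ℕ.⊔ N) n≥
      m≥MN = ℕ.m⊔n≤o⇒n≤o (K ℕ.⊔ L) (M ℕ.⊔ N) m≥
      n≥MN = ℕ.m⊔n≤o⇒n≤o (K ℕ.⊔ L) (M ℕ.⊔ N) n≥
    in *-close {A} {α} {B} {β} ε 0<A 0<B Aα Bβ
         (seq x m) (seq y m) (seq x n) (seq y n)
         (x≤A m (ℕ.m⊔n≤o⇒m≤o K L m≥KL))
         (y-close m n (ℕ.m⊔n≤o⇒m≤o M N m≥MN) (ℕ.m⊔n≤o⇒m≤o M N n≥MN))
         (y≤B n (ℕ.m⊔n≤o⇒n≤o K L n≥KL))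
         (x-close m n (ℕ.m⊔n≤o⇒n≤o M N m≥MN) (ℕ.m⊔n≤o⇒n≤o M N n≥MN))

------------------------------------------------------------------------
-- Roots

eval : Poly → ℝ → ℝ
eval []      x = fromℕ 0
eval (a ∷ p) x = fromℕ a + x · eval p x

IsRoot : Poly → ℝ → Set
IsRoot p x = eval p x ≃ fromℕ 0

-- ξ(G) as a relation: "x is the largest real root of I(G, x)". Such an x is
-- unique up to _≃_, and it exists by the classical fact that the root of smallest
-- modulus is real.
Isξ : ∀ {n} → Graph n → ℝ → Set
Isξ G x = IsRoot (indepPoly G) x × (∀ y → IsRoot (indepPoly G) y → y ≤ x)

{-# OPTIONS --safe #-}

-- Deleting a leaf together with its neighbour keeps G well-covered, and since longer
-- even cycles are not well-covered this ends with nothing or with a 4-cycle. So G has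
-- a perfect matching every edge of which meets every maximal independent set.
-- Consequently G is K* for a unicyclic graph K, or it has a 4-cycle with two adjacent
-- vertices without leaves; contracting their edge then leads to a K* with the same
-- independence polynomial. Up to a power of 1 + x, the polynomial of K* is that of K
-- at - z = x / (1 + x), and K is a ring of rooted trees with n vertices.
--
-- Let x in (-1 , 0] be such that all induced subgraphs of G have positive polynomials
-- at x. Then unrolling the trees of the ring, one after the other, into paths of the
-- ring increases the polynomial (Sturm comparison), and this ends with C n; shrinking
-- the ring to a triangle and hanging all other vertices on one of its vertices
-- decreases it, and this ends with U n. When positivity fails at x, the polynomial of
-- G, being the smallest one as long as all are positive, has a root in [x , 0], which
-- bisection finds; hence these inequalities order the largest roots.

module Submission where

import Defs

-- A ring of trees is the trace of a product of transfer matrices, one for each tree. Lengthening a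
-- path multiplies by a fixed matrix, so unrolling compares solutions of s (k + 2) = s (k + 1) - z s
-- k, and the quotient of two solutions is monotone as long as the denominator is positive. In the
-- reduction to a ring no smaller graphs are constructed. Every vertex carries two factors, for
-- being outside and inside the independent set; deleting a vertex or merging a leaf into its
-- neighbour only changes these factors, while the adjacency matrix stays fixed. The order of reals
-- given as Cauchy sequences is undecidable. Positivity of all induced subgraphs is a statement
-- about finitely many rationals, hence decidable at rational points; so everything is decided at a
-- rational supposed to lie between two roots. The structure of G yields both inequalities only
-- where G is positive. In the comparison with the star of U n, positivity is first known for the
-- other graph. It carries over to G because it could fail only after the polynomial of G had become
-- small, against the inequality.

module Order where

  open import Data.Rational
  import Data.Rational.Properties as ℚ
  open import Data.Rational.Solver using (module +-*-Solver)
  open import Relation.Binary.PropositionalEquality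
  open +-*-Solver using (solve; _:+_; _:-_; _:=_)

  private variable
    p q r d : ℚ

  +≥0 : 0ℚ ≤ p → 0ℚ ≤ q → 0ℚ ≤ p + q
  +≥0 {p} {q} 0≤p 0≤q = ℚ.nonNegative⁻¹ (p + q)
    {{ℚ.nonNeg+nonNeg⇒nonNeg p {{nonNegative 0≤p}} q {{nonNegative 0≤q}}}}

  *≥0 : 0ℚ ≤ p → 0ℚ ≤ q → 0ℚ ≤ p * q
  *≥0 {p} {q} 0≤p 0≤q = ℚ.nonNegative⁻¹ (p * q)
    {{ℚ.nonNeg*nonNeg⇒nonNeg p {{nonNegative 0≤p}} q {{nonNegative 0≤q}}}}

  *>0 : 0ℚ < p → 0ℚ < q → 0ℚ < p * q
  *>0 {p} {q} 0<p 0<q = ℚ.positive⁻¹ (p * q)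
    {{ℚ.pos*pos⇒pos p {{positive 0<p}} q {{positive 0<q}}}}

  +>0 : 0ℚ < p → 0ℚ ≤ q → 0ℚ < p + q
  +>0 0<p 0≤q = ℚ.+-mono-<-≤ 0<p 0≤q

  0<1 : 0ℚ < 1ℚ
  0<1 = ℚ.positive⁻¹ 1ℚ

  0≤1 : 0ℚ ≤ 1ℚ
  0≤1 = ℚ.<⇒≤ 0<1

  private
    sub-add : ∀ p q → p + (q - p) ≡ q
    sub-add = solve 2 (λ p q → p :+ (q :- p) := q) refl

    add-zero : ∀ p → p + 0ℚ ≡ p
    add-zero = ℚ.+-identityʳ

  sub≥0 : p ≤ q → 0ℚ ≤ q - p
  sub≥0 {p} {q} p≤q =
    subst (_≤ q - p) (ℚ.+-inverseʳ p) (ℚ.+-monoˡ-≤ (- p) p≤q)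

  sub>0 : p < q → 0ℚ < q - p
  sub>0 {p} {q} p<q =
    subst (_< q - p) (ℚ.+-inverseʳ p) (ℚ.+-monoˡ-< (- p) p<q)

  -- Nearly every inequality below is proved in this form: the difference is written as a polynomial
  -- whose terms are visibly nonnegative, and the ring solver checks the identity.
  ≤-from : 0ℚ ≤ d → d ≡ q - p → p ≤ q
  ≤-from {_} {q} {p} 0≤d refl =
    subst₂ _≤_ (add-zero p) (sub-add p q) (ℚ.+-monoʳ-≤ p 0≤d)

  <-from : 0ℚ < d → d ≡ q - p → p < q
  <-from {_} {q} {p} 0<d refl =
    subst₂ _<_ (add-zero p) (sub-add p q) (ℚ.+-monoʳ-< p 0<d)

  *-cancel≥0 : 0ℚ < r → 0ℚ ≤ r * p → 0ℚ ≤ p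
  *-cancel≥0 {r} {p} 0<r 0≤rp = ℚ.*-cancelˡ-≤-pos r {{positive 0<r}}
    (subst (_≤ r * p) (sym (ℚ.*-zeroʳ r)) 0≤rp)

  *-cancel>0 : 0ℚ < r → 0ℚ < r * p → 0ℚ < p
  *-cancel>0 {r} {p} 0<r 0<rp = ℚ.*-cancelˡ-<-nonNeg r {{nonNegative (ℚ.<⇒≤ 0<r)}}
    (subst (_< r * p) (sym (ℚ.*-zeroʳ r)) 0<rp)

-- Values of rooted trees and of rings of rooted trees

module Trees where

  open import Data.Nat as ℕ using (ℕ; zero; suc)
  import Data.Nat.Properties as ℕ
  open import Data.List using (List; []; _∷_; replicate)
  open import Data.Product using (_×_; _,_; proj₁; proj₂)
  open import Data.Unit using (⊤; tt)
  open import Data.Sum using (inj₁; inj₂)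
  open import Data.Rational
  import Data.Rational.Properties as ℚ
  open import Data.Rational.Solver using (module +-*-Solver)
  open import Relation.Binary.PropositionalEquality
  open +-*-Solver using (solve; con; _:+_; _:*_; _:-_; :-_; _:=_)
  open Order

  -- A rooted tree: join s t makes the root of t a further child of the root of s.
  data Tree : Set where
    single : Tree
    join   : Tree → Tree → Tree

  size : Tree → ℕ
  size single     = 1
  size (join s t) = size t ℕ.+ size s

  sizes : List Tree → ℕ
  sizes []       = 0
  sizes (t ∷ ts) = size t ℕ.+ sizes ts

  edges : Tree → ℕ
  edges single     = 0
  edges (join s t) = suc (edges t ℕ.+ edges s)

  size≡1+edges : ∀ t → size t ≡ suc (edges t)
  size≡1+edges single     = refl
  size≡1+edges (join s t) = trans (cong₂ ℕ._+_ (size≡1+edges t) (size≡1+edges s))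
    (cong suc (ℕ.+-suc (edges t) (edges s)))

  -- Junk value 0 for lists of length less than 2.
  excess : List Tree → ℕ
  excess (t ∷ s ∷ [])        = edges t ℕ.+ edges s
  excess (t ∷ ts@(_ ∷ _ ∷ _)) = size t ℕ.+ excess ts
  excess _                   = 0

  -- `edges r` plus this excess is the number of pendants once a ring `r ∷ t ∷ s ∷ ts` has become a
  -- triangle with all other vertices hung on one of its vertices.
  sizes≡2+excess : ∀ t s ts → sizes (t ∷ s ∷ ts) ≡ 2 ℕ.+ excess (t ∷ s ∷ ts)
  sizes≡2+excess t s [] = trans (cong (size t ℕ.+_) (ℕ.+-identityʳ (size s)))
    (trans (cong₂ ℕ._+_ (size≡1+edges t) (size≡1+edges s))
      (cong suc (ℕ.+-suc (edges t) (edges s))))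
  sizes≡2+excess t s (u ∷ us) = trans (cong (size t ℕ.+_) (sizes≡2+excess s u us))
    (trans (ℕ.+-suc (size t) _) (cong suc (ℕ.+-suc (size t) _)))

  -- Everything is evaluated at x = - z.
  module At (z : ℚ) (0≤z : 0ℚ ≤ z) where

    -- The independence polynomials of a tree without its root, and without the
    -- closed neighbourhood of its root.
    B D : Tree → ℚ
    B single     = 1ℚ
    B (join s t) = B s * (B t - z * D t)
    D single     = 1ℚ
    D (join s t) = D s * B t

    A : Tree → ℚ
    A t = B t - z * D t

    -- The condition is imposed on all parts of the tree as well, which are induced subgraphs; only
    -- so does it make `B` and `D` positive too.
    data Pos : Tree → Set where
      single : 0ℚ < A single → Pos single
      join   : ∀ {s t} → Pos s → Pos t → 0ℚ < A (join s t) → Pos (join s t)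

    A>0 : ∀ {t} → Pos t → 0ℚ < A t
    A>0 (single A>0)   = A>0
    A>0 (join _ _ A>0) = A>0

    B>0 : ∀ {t} → Pos t → 0ℚ < B t
    B>0 (single _)   = 0<1
    B>0 (join s t _) = *>0 (B>0 s) (A>0 t)

    D>0 : ∀ {t} → Pos t → 0ℚ < D t
    D>0 (single _)   = 0<1
    D>0 (join s t _) = *>0 (D>0 s) (B>0 t)

    B≥0 : ∀ {t} → Pos t → 0ℚ ≤ B t
    B≥0 t = ℚ.<⇒≤ (B>0 t)

    D≥0 : ∀ {t} → Pos t → 0ℚ ≤ D t
    D≥0 t = ℚ.<⇒≤ (D>0 t)

    -- Deleting vertices raises the value at `- z` under positivity, and `D` lacks the children of
    -- the root, which `B` still contains.
    B≤D : ∀ {t} → Pos t → B t ≤ D t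
    B≤D (single _) = ℚ.≤-refl
    B≤D (join {s} {t} ps pt _) =
      ≤-from (+≥0 (*≥0 (sub≥0 (B≤D ps)) (B≥0 pt)) (*≥0 (B≥0 ps) (*≥0 0≤z (D≥0 pt))))
             (identity z (B s) (B t) (D s) (D t))
      where
      identity = solve 5 (λ z B₁ B₂ D₁ D₂ →
        (D₁ :- B₁) :* B₂ :+ B₁ :* (z :* D₂) := D₁ :* B₂ :- B₁ :* (B₂ :- z :* D₂)) refl

    -- The recurrence of paths and Sturm comparison

    Pair : Set
    Pair = ℚ × ℚ

    -- A pair holds the value without the last vertex and the full value; one more path vertex at
    -- the end maps it by this matrix.
    step : Pair → Pair
    step (p , q) = q , q - z * p

    step^ : ℕ → Pair → Pair
    step^ zero    s = s
    step^ (suc k) s = step^ k (step s)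

    step^-+ : ∀ j k s → step^ k (step^ j s) ≡ step^ (j ℕ.+ k) s
    step^-+ zero    k s = refl
    step^-+ (suc j) k s = step^-+ j k (step s)

    step^-step : ∀ k s → step^ k (step s) ≡ step (step^ k s)
    step^-step zero    s = refl
    step^-step (suc k) s = step^-step k (step s)

    comb : ℚ → Pair → ℚ → Pair → Pair
    comb c (p , q) d (r , s) = c * p + d * r , c * q + d * s

    -- Linearity turns the comparison of two sequences into the sign of a single one, their
    -- difference.
    step^-comb : ∀ k c u d v → step^ k (comb c u d v) ≡ comb c (step^ k u) d (step^ k v)
    step^-comb zero    c u d v = refl
    step^-comb (suc k) c (p , q) d (r , s) =
      trans (cong (λ e → step^ k (c * q + d * s , e)) (identity z c p q d r s))
            (step^-comb k c (step (p , q)) d (step (r , s)))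
      where
      identity = solve 7 (λ z c p q d r s →
        (c :* q :+ d :* s) :- z :* (c :* p :+ d :* r)
          := c :* (q :- z :* p) :+ d :* (s :- z :* r)) refl

    PosTo : ℕ → Pair → Set
    PosTo zero    v = ⊤
    PosTo (suc k) v = 0ℚ < proj₂ v × PosTo k (step v)

    PosTo-pred : ∀ k {v} → PosTo (suc k) v → PosTo k v
    PosTo-pred zero    _       = tt
    PosTo-pred (suc k) (p , ps) = p , PosTo-pred k ps

    PosTo-+ : ∀ j k {v} → PosTo j v → PosTo k (step^ j v) → PosTo (j ℕ.+ k) v
    PosTo-+ zero    k _        qs = qs
    PosTo-+ (suc j) k (p , ps) qs = p , PosTo-+ j k ps qs

    -- Sturm comparison: both sequences solve s (k + 2) = s (k + 1) - z s k, so
    -- the sign of their Casoratian is preserved.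
    private
      casorati : ∀ z d₀ d₁ v₀ v₁ →
        z * (d₁ * v₀ - v₁ * d₀) ≡ (d₁ - z * d₀) * v₁ - (v₁ - z * v₀) * d₁
      casorati = solve 5 (λ z d₀ d₁ v₀ v₁ →
        z :* (d₁ :* v₀ :- v₁ :* d₀) := (d₁ :- z :* d₀) :* v₁ :- (v₁ :- z :* v₀) :* d₁) refl

      casorati≥0 : ∀ {d₀ d₁ v₀ v₁} → 0ℚ ≤ d₁ * v₀ - v₁ * d₀ →
        0ℚ ≤ (d₁ - z * d₀) * v₁ - (v₁ - z * v₀) * d₁
      casorati≥0 {d₀} {d₁} {v₀} {v₁} det =
        subst (0ℚ ≤_) (casorati z d₀ d₁ v₀ v₁) (*≥0 0≤z det)

      from-det : ∀ v₀ v₁ d₀ d₁ → (d₁ * v₀ - v₁ * d₀) + v₁ * d₀ ≡ v₀ * d₁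
      from-det = solve 4 (λ v₀ v₁ d₀ d₁ → (d₁ :* v₀ :- v₁ :* d₀) :+ v₁ :* d₀ := v₀ :* d₁) refl

      from-det′ : ∀ v₀ v₁ d₀ d₁ → v₁ * d₀ + (d₁ * v₀ - v₁ * d₀) ≡ v₀ * d₁
      from-det′ = solve 4 (λ v₀ v₁ d₀ d₁ → v₁ :* d₀ :+ (d₁ :* v₀ :- v₁ :* d₀) := v₀ :* d₁) refl

    -- While `v` is positive, a nonnegative Casoratian says that the quotient of `d` by `v` does not
    -- decrease, so `d` cannot become negative before `v` stops being positive.
    sturm≥ : ∀ k {d₀ d₁ v₀ v₁} → 0ℚ < v₀ → PosTo k (v₀ , v₁) → 0ℚ ≤ d₀ →
      0ℚ ≤ d₁ * v₀ - v₁ * d₀ → 0ℚ ≤ proj₁ (step^ k (d₀ , d₁))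
    sturm≥ zero    _    _           d₀≥0 _   = d₀≥0
    sturm≥ (suc k) {d₀} {d₁} {v₀} {v₁} v₀>0 (v₁>0 , ps) d₀≥0 det =
      sturm≥ k v₁>0 ps
        (*-cancel≥0 v₀>0 (subst (0ℚ ≤_) (from-det v₀ v₁ d₀ d₁)
          (+≥0 det (*≥0 (ℚ.<⇒≤ v₁>0) d₀≥0))))
        (casorati≥0 {d₀} {d₁} det)

    sturm> : ∀ k {d₀ d₁ v₀ v₁} → 0ℚ < v₀ → PosTo k (v₀ , v₁) → 0ℚ < d₀ →
      0ℚ ≤ d₁ * v₀ - v₁ * d₀ → PosTo k (d₀ , d₁)
    sturm> zero    _    _           _    _   = tt
    sturm> (suc k) {d₀} {d₁} {v₀} {v₁} v₀>0 (v₁>0 , ps) d₀>0 det =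
      d₁>0 , sturm> k v₁>0 ps d₁>0 (casorati≥0 {d₀} {d₁} det)
      where
      d₁>0 : 0ℚ < d₁
      d₁>0 = *-cancel>0 v₀>0 (subst (0ℚ <_) (from-det′ v₀ v₁ d₀ d₁)
               (+>0 (*>0 v₁>0 d₀>0) det))

    -- An arc of rooted trees with a path of k further vertices at its far end has
    -- the polynomial proj₂ (step^ k a); for b the near end is left out as well.
    record Weak (a b : Pair) : Set where
      constructor weak
      field
        a₁>0  : 0ℚ < proj₂ a
        a₁≤a₀ : proj₂ a ≤ proj₁ a
        b₁≤b₀ : proj₂ b ≤ proj₁ b
        a₀≤b₀ : proj₁ a ≤ proj₁ b
        a₁≤b₁ : proj₂ a ≤ proj₂ b
        det≥0 : 0ℚ ≤ proj₂ b * proj₁ a - proj₂ a * proj₁ b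

    -- `drop≤` compares what the last vertex of the arc costs with the near end present and with the
    -- near end left out. It is the inequality that allows a path to be moved into the ring.
    record Strong (a b : Pair) : Set where
      constructor strong
      field
        isWeak : Weak a b
        drop≤  : proj₁ a - proj₂ a ≤ proj₁ b - proj₂ b
      open Weak isWeak public

    private
      drop : ∀ z p q → z * p ≡ q - (q - z * p)
      drop = solve 3 (λ z p q → z :* p := q :- (q :- z :* p)) refl

      <⇒≤-by-det : ∀ {a₀ a₁ b₀ b₁} → 0ℚ < a₀ → 0ℚ ≤ a₁ → a₀ ≤ b₀ →
        0ℚ ≤ b₁ * a₀ - a₁ * b₀ → a₁ ≤ b₁
      <⇒≤-by-det {a₀} {a₁} {b₀} {b₁} a₀>0 a₁≥0 a₀≤b₀ det =
        ≤-from (*-cancel≥0 a₀>0 (subst (0ℚ ≤_) (identity a₀ a₁ b₀ b₁)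
          (+≥0 det (*≥0 a₁≥0 (sub≥0 a₀≤b₀))))) refl
        where
        identity = solve 4 (λ a₀ a₁ b₀ b₁ →
          (b₁ :* a₀ :- a₁ :* b₀) :+ a₁ :* (b₀ :- a₀) := a₀ :* (b₁ :- a₁)) refl

    -- After one path vertex the two drops are z a₀ and z b₀, so `drop≤` reduces to a₀ ≤ b₀.
    Weak-step : ∀ {a b} → Weak a b → 0ℚ < proj₂ (step a) → Strong (step a) (step b)
    Weak-step {a₀ , a₁} {b₀ , b₁} (weak a₁>0 a₁≤a₀ b₁≤b₀ a₀≤b₀ a₁≤b₁ det) a₂>0 =
      strong (weak a₂>0 (≤-from (*≥0 0≤z a₀≥0) (drop z a₀ a₁))
                        (≤-from (*≥0 0≤z b₀≥0) (drop z b₀ b₁))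
                        a₁≤b₁
                        (<⇒≤-by-det a₁>0 (ℚ.<⇒≤ a₂>0) a₁≤b₁ det′)
                        det′)
             (≤-from (*≥0 0≤z (sub≥0 a₀≤b₀)) (identity z a₀ a₁ b₀ b₁))
      where
      a₀≥0 = ℚ.≤-trans (ℚ.<⇒≤ a₁>0) a₁≤a₀
      b₀≥0 = ℚ.≤-trans a₀≥0 a₀≤b₀
      det′ : 0ℚ ≤ (b₁ - z * b₀) * a₁ - (a₁ - z * a₀) * b₁
      det′ = casorati≥0 {b₀} {b₁} {a₀} {a₁} det
      identity = solve 5 (λ z a₀ a₁ b₀ b₁ → z :* (b₀ :- a₀)
        := (b₁ :- (b₁ :- z :* b₀)) :- (a₁ :- (a₁ :- z :* a₀))) refl

    Strong-step^ : ∀ k {a b} → Strong a b → PosTo (suc k) a →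
      Strong (step^ k a) (step^ k b)
    Strong-step^ zero    s _                = s
    Strong-step^ (suc k) s (_ , (a₂>0 , ps)) =
      Strong-step^ k (Weak-step (Strong.isWeak s) a₂>0) (a₂>0 , ps)

    Weak-step^ : ∀ k {a b} → Weak a b → PosTo (suc (suc k)) a →
      Strong (step^ (suc k) a) (step^ (suc k) b)
    Weak-step^ k w (_ , (a₂>0 , ps)) = Strong-step^ k (Weak-step w a₂>0) (a₂>0 , ps)

    Weak-PosTo : ∀ k {a b} → Weak a b → PosTo k a → PosTo k b
    Weak-PosTo zero          w _ = tt
    Weak-PosTo (suc zero)    w _ = ℚ.<-≤-trans (Weak.a₁>0 w) (Weak.a₁≤b₁ w) , tt
    Weak-PosTo (suc (suc k)) w (_ , (a₂>0 , ps)) =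
      ℚ.<-≤-trans (Weak.a₁>0 w) (Weak.a₁≤b₁ w)
      , Weak-PosTo (suc k) (Strong.isWeak (Weak-step w a₂>0)) (a₂>0 , ps)

    -- A tree whose root closes the arc to a ring.
    close : Tree → Pair → Pair → ℚ
    close t a b = proj₂ a * B t - z * (proj₁ b * D t)

    -- If `a` and `b` are the images of (1 , 1) and (0 , 1) under a matrix, then a - b and b are the
    -- images of the unit vectors, and this is the trace of that matrix.
    tr : Pair → Pair → ℚ
    tr a b = proj₁ a - proj₁ b + proj₂ b

    -- The closed ring, as a function of the number of path vertices in its arc, solves the same
    -- recurrence; hence Sturm comparison applies to it.
    close-step^ : ∀ k t a b →
      step^ k (close t a b , close t (step a) (step b))
        ≡ (close t (step^ k a) (step^ k b) , close t (step^ k (step a)) (step^ k (step b)))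
    close-step^ zero    t a b = refl
    close-step^ (suc k) t (a₀ , a₁) (b₀ , b₁) =
      trans (cong (λ e → step^ k (close t (step (a₀ , a₁)) (step (b₀ , b₁)) , e))
                  (identity z a₀ a₁ b₀ b₁ (B t) (D t)))
            (close-step^ k t (step (a₀ , a₁)) (step (b₀ , b₁)))
      where
      identity = solve 7 (λ z a₀ a₁ b₀ b₁ B D →
        ((a₁ :- z :* a₀) :* B :- z :* (b₁ :* D)) :- z :* (a₁ :* B :- z :* (b₀ :* D))
          := ((a₁ :- z :* a₀) :- z :* a₁) :* B :- z :* ((b₁ :- z :* b₀) :* D)) refl

    -- The subtree t₂ is unrolled in the ring opened at its parent, and the resulting
    -- path is then moved from the parent into the ring.
    unroll : ∀ {t} → Pos t → ∀ {a b} → Strong a b → 0ℚ < close t a b →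
      close t a b ≤ tr (step^ (size t) a) (step^ (size t) b) × PosTo (suc (size t)) a
    unroll (single _) {a₀ , a₁} {b₀ , b₁} s 0<R =
      ℚ.≤-reflexive (identity z a₁ b₀ b₁) , Strong.a₁>0 s ,
      subst (0ℚ <_) (identity′ z a₀ a₁ b₀)
        (+>0 0<R (*≥0 0≤z (sub≥0 (Strong.a₀≤b₀ s)))) , tt
      where
      identity = solve 4 (λ z a₁ b₀ b₁ → a₁ :* con 1ℚ :- z :* (b₀ :* con 1ℚ)
        := a₁ :- b₁ :+ (b₁ :- z :* b₀)) refl
      identity′ = solve 4 (λ z a₀ a₁ b₀ → (a₁ :* con 1ℚ :- z :* (b₀ :* con 1ℚ)) :+ z :* (b₀ :- a₀)
        := a₁ :- z :* a₀) refl
    unroll (join {t₁} {t₂} p₁ p₂ _) {a@(a₀ , a₁)} {b@(b₀ , b₁)} s 0<R =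
      ℚ.≤-trans R≤close₁ (subst (λ c → close t₁ (step^ m a) (step^ m b) ≤ c)
        (cong₂ tr (step^-+ m (size t₁) a) (step^-+ m (size t₁) b)) (proj₁ IH₁))
      , subst (λ k → PosTo k a) (ℕ.+-suc m (size t₁))
          (PosTo-+ m (suc (size t₁)) (PosTo-pred m (PosTo-pred (suc m) a-pos)) (proj₂ IH₁))
      where
      m  = size t₂
      -- `ℓ` is the ring without and with the parent of `t₂`, before `t₂` is attached. A tree hung
      -- on one vertex closes an arc whose near and far end coincide, so the induction hypothesis is
      -- used for the pair of `ℓ` with itself.
      ℓ₀ = a₁ * B t₁
      ℓ₁ = close t₁ a b
      ℓ : Pair
      ℓ  = ℓ₀ , ℓ₁
      open Strong s
      b₀≥0 = ℚ.≤-trans (ℚ.≤-trans (ℚ.<⇒≤ a₁>0) a₁≤a₀) a₀≤b₀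
      ℓ₀>0 = *>0 a₁>0 (B>0 p₁)
      regroup = solve 7 (λ z a₁ b₀ B₁ D₁ B₂ D₂ →
        a₁ :* (B₁ :* (B₂ :- z :* D₂)) :- z :* (b₀ :* (D₁ :* B₂))
          := (a₁ :* B₁ :- z :* (b₀ :* D₁)) :* B₂ :- z :* (a₁ :* B₁ :* D₂)) refl
      R≡ : close (join t₁ t₂) a b ≡ close t₂ ℓ ℓ
      R≡ = regroup z a₁ b₀ (B t₁) (D t₁) (B t₂) (D t₂)
      0<R₂ = subst (0ℚ <_) R≡ 0<R
      ℓ₁>0 : 0ℚ < ℓ₁
      ℓ₁>0 = *-cancel>0 (B>0 p₂) (subst (0ℚ <_) (identity z ℓ₀ ℓ₁ (B t₂) (D t₂))
        (+>0 0<R₂ (*≥0 0≤z (*≥0 (ℚ.<⇒≤ ℓ₀>0) (D≥0 p₂)))))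
        where
        identity = solve 5 (λ z ℓ₀ ℓ₁ B D →
          (ℓ₁ :* B :- z :* (ℓ₀ :* D)) :+ z :* (ℓ₀ :* D) := B :* ℓ₁) refl
      ℓ₁≤ℓ₀ : ℓ₁ ≤ ℓ₀
      ℓ₁≤ℓ₀ = ≤-from (*≥0 0≤z (*≥0 b₀≥0 (D≥0 p₁))) (drop′ ℓ₀ (z * (b₀ * D t₁)))
        where drop′ = solve 2 (λ p q → q := p :- (p :- q)) refl
      ℓ-strong : Strong ℓ ℓ
      ℓ-strong = strong (weak ℓ₁>0 ℓ₁≤ℓ₀ ℓ₁≤ℓ₀ ℚ.≤-refl ℚ.≤-refl
        (ℚ.≤-reflexive (sym (ℚ.+-inverseʳ (ℓ₁ * ℓ₀))))) ℚ.≤-refl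
      IH₂ = unroll p₂ ℓ-strong 0<R₂
      ρ : Pair
      ρ = ℓ₁ , close t₁ (step a) (step b)
      det≡ = solve 7 (λ z a₀ a₁ b₀ b₁ B D →
        let r = a₁ :* B :- z :* (b₀ :* D)
            s = (a₁ :- z :* a₀) :* B :- z :* (b₁ :* D)
            ℓ₂ = r :- z :* (a₁ :* B)
        in z :* (((b₀ :- b₁) :- (a₀ :- a₁)) :* D :+ (a₀ :- a₁) :* (D :- B)) :* r
             := (con 1ℚ :* s :+ (:- con 1ℚ) :* ℓ₂) :* r
                :- ℓ₂ :* (con 1ℚ :* r :+ (:- con 1ℚ) :* r)) refl
      zero≡ = solve 1 (λ r → con 0ℚ := con 1ℚ :* r :+ (:- con 1ℚ) :* r) refl
      -- The sequence is the ring with k path vertices inside it minus the ring with k path vertices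
      -- pendant at the parent. It starts at 0, its second term is nonnegative by `drop≤` and `B≤D`,
      -- and the comparison sequence is `step ℓ`, positive by the induction hypothesis for `t₂`.
      moved : 0ℚ ≤ proj₁ (step^ m (comb 1ℚ ρ (- 1ℚ) (step ℓ)))
      moved = sturm≥ m ℓ₁>0 (proj₂ (proj₂ IH₂)) (ℚ.≤-reflexive (zero≡ ℓ₁))
        (subst (0ℚ ≤_) (det≡ z a₀ a₁ b₀ b₁ (B t₁) (D t₁))
          (*≥0 (*≥0 0≤z (+≥0 (*≥0 (sub≥0 drop≤) (D≥0 p₁))
                             (*≥0 (sub≥0 a₁≤a₀) (sub≥0 (B≤D p₁)))))
               (ℚ.<⇒≤ ℓ₁>0)))
      moved≡ : proj₁ (step^ m (comb 1ℚ ρ (- 1ℚ) (step ℓ)))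
        ≡ 1ℚ * close t₁ (step^ m a) (step^ m b) + (- 1ℚ) * proj₂ (step^ m ℓ)
      moved≡ = trans (cong proj₁ (step^-comb m 1ℚ ρ (- 1ℚ) (step ℓ)))
        (cong₂ (λ p q → 1ℚ * p + (- 1ℚ) * q)
          (cong proj₁ (close-step^ m t₁ a b)) (cong proj₁ (step^-step m ℓ)))
      R≤close₁ : close (join t₁ t₂) a b ≤ close t₁ (step^ m a) (step^ m b)
      R≤close₁ = ℚ.≤-trans (subst (_≤ tr (step^ m ℓ) (step^ m ℓ)) (sym R≡) (proj₁ IH₂))
        (ℚ.≤-trans (ℚ.≤-reflexive (tr≡ (proj₁ (step^ m ℓ)) (proj₂ (step^ m ℓ))))
          (≤-from (subst (0ℚ ≤_) moved≡ moved)
            (sub≡ (close t₁ (step^ m a) (step^ m b)) (proj₂ (step^ m ℓ)))))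
        where
        tr≡ = solve 2 (λ p q → p :- p :+ q := q) refl
        sub≡ = solve 2 (λ p q → con 1ℚ :* p :+ (:- con 1ℚ) :* q := p :- q) refl
      -- The arc alone is compared with `ℓ`, so it stays positive for as many further path vertices
      -- as `ℓ` does.
      a-pos : PosTo (suc (suc m)) a
      a-pos = a₁>0 , sturm> (suc m) ℓ₀>0 (proj₂ IH₂) a₁>0
        (subst (0ℚ ≤_) (identity z a₀ a₁ b₀ (B t₁) (D t₁))
          (*≥0 (*≥0 0≤z (ℚ.<⇒≤ a₁>0)) (+≥0 (*≥0 b₀≥0 (sub≥0 (B≤D p₁))) (*≥0 (sub≥0 a₀≤b₀) (B≥0 p₁)))))
        where
        identity = solve 6 (λ z a₀ a₁ b₀ B D →
          z :* a₁ :* (b₀ :* (D :- B) :+ (b₀ :- a₀) :* B)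
            := (a₁ :- z :* a₀) :* (a₁ :* B) :- (a₁ :* B :- z :* (b₀ :* D)) :* a₁) refl
      IH₁ = unroll p₁ (Strong-step^ m s (PosTo-pred (suc m) a-pos))
        (ℚ.<-≤-trans 0<R R≤close₁)

    -- The images of (1 , 1) and (0 , 1) under the product of the transfer matrices. For a nonempty
    -- list, `colA` is the arc without and with its far root, and `colB` is the same with the near
    -- root deleted.
    colA colB : List Tree → Pair
    colA []       = 1ℚ , 1ℚ
    colA (t ∷ ts) = comb (B t) (colA ts) (- (z * D t)) (colB ts)
    colB []       = 0ℚ , 1ℚ
    colB (t ∷ ts) = comb (B t) (colA ts) 0ℚ (0ℚ , 0ℚ)

    arc : List Tree → ℚ
    arc ts = proj₂ (colA ts)

    -- Junk value 0 for the empty ring.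
    ring : List Tree → ℚ
    ring []       = 0ℚ
    ring (t ∷ ts) = close t (colA ts) (colB ts)

    -- The trace of the n-th power of the path matrix, which for n ≥ 3 is the independence
    -- polynomial of the n-cycle at `- z`.
    path-ring : ℕ → ℚ
    path-ring n = tr (step^ n (1ℚ , 1ℚ)) (step^ n (0ℚ , 1ℚ))

    data Good : List Tree → Set where
      []  : Good []
      _∷_ : ∀ {t ts} → Pos t × 0ℚ < arc (t ∷ ts) → Good ts → Good (t ∷ ts)

    Good⇒Weak : ∀ {t ts} → Good (t ∷ ts) → Weak (colA (t ∷ ts)) (colB (t ∷ ts))
    -- Two trees are required: with a single one the near and the far root coincide, so that `b`
    -- does not drop at all while `a` drops by z D.
    Good⇒Strong : ∀ {t s ts} → Good (t ∷ s ∷ ts) →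
      Strong (colA (t ∷ s ∷ ts)) (colB (t ∷ s ∷ ts))

    Good⇒Weak {t} ((pt , arc>0) ∷ []) = weak arc>0
      (≤-from (*≥0 0≤z (D≥0 pt)) (i₁ z (B t) (D t))) ℚ.≤-refl
      (ℚ.≤-reflexive (i₂ z (B t) (D t)))
      (≤-from (*≥0 0≤z (D≥0 pt)) (i₃ z (B t) (D t)))
      (subst (0ℚ ≤_) (i₄ z (B t) (D t)) (*≥0 (B≥0 pt) (*≥0 0≤z (D≥0 pt))))
      where
      i₁ = solve 3 (λ z B D → z :* D := (B :* con 1ℚ :+ (:- (z :* D)) :* con 0ℚ)
        :- (B :* con 1ℚ :+ (:- (z :* D)) :* con 1ℚ)) refl
      i₂ = solve 3 (λ z B D → B :* con 1ℚ :+ (:- (z :* D)) :* con 0ℚ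
        := B :* con 1ℚ :+ con 0ℚ :* con 0ℚ) refl
      i₃ = solve 3 (λ z B D → z :* D := (B :* con 1ℚ :+ con 0ℚ :* con 0ℚ)
        :- (B :* con 1ℚ :+ (:- (z :* D)) :* con 1ℚ)) refl
      i₄ = solve 3 (λ z B D → B :* (z :* D)
        := (B :* con 1ℚ :+ con 0ℚ :* con 0ℚ) :* (B :* con 1ℚ :+ (:- (z :* D)) :* con 0ℚ)
           :- (B :* con 1ℚ :+ (:- (z :* D)) :* con 1ℚ) :* (B :* con 1ℚ :+ con 0ℚ :* con 0ℚ)) refl
    Good⇒Weak g@(_ ∷ (_ ∷ _)) = Strong.isWeak (Good⇒Strong g)

    Good⇒Strong {t} {s} {ts} ((pt , arc>0) ∷ g) = strong
      (weak arc>0 (≤-from δ≥0 refl)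
        (≤-from (*≥0 (B≥0 pt) (sub≥0 a₁≤a₀)) (i₃ (B t) a₀ a₁))
        (≤-from (*≥0 (*≥0 0≤z (D≥0 pt)) b₀≥0) (i₅ z (B t) (D t) a₀ b₀))
        (≤-from (*≥0 (*≥0 0≤z (D≥0 pt)) b₁≥0) (i₅ z (B t) (D t) a₁ b₁))
        det′)
      (≤-from (*≥0 (*≥0 0≤z (D≥0 pt)) (sub≥0 b₁≤b₀)) (i₆ z (B t) (D t) a₀ a₁ b₀ b₁))
      where
      open Weak (Good⇒Weak g)
      a₀ = proj₁ (colA (s ∷ ts))
      a₁ = proj₂ (colA (s ∷ ts))
      b₀ = proj₁ (colB (s ∷ ts))
      b₁ = proj₂ (colB (s ∷ ts))
      a₀′ = proj₁ (colA (t ∷ s ∷ ts))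
      a₁′ = proj₂ (colA (t ∷ s ∷ ts))
      b₀′ = proj₁ (colB (t ∷ s ∷ ts))
      b₁′ = proj₂ (colB (t ∷ s ∷ ts))
      b₁≥0 = ℚ.≤-trans (ℚ.<⇒≤ a₁>0) a₁≤b₁
      b₀≥0 = ℚ.≤-trans b₁≥0 b₁≤b₀
      i₁ = solve 7 (λ z B D a₀ a₁ b₀ b₁ → z :* D :* B :* (b₁ :* a₀ :- a₁ :* b₀)
        := (B :* a₁ :+ con 0ℚ :* con 0ℚ) :* (B :* a₀ :+ (:- (z :* D)) :* b₀)
           :- (B :* a₁ :+ (:- (z :* D)) :* b₁) :* (B :* a₀ :+ con 0ℚ :* con 0ℚ)) refl
      det′ : 0ℚ ≤ b₁′ * a₀′ - a₁′ * b₀′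
      det′ = subst (0ℚ ≤_) (i₁ z (B t) (D t) a₀ a₁ b₀ b₁)
        (*≥0 (*≥0 (*≥0 0≤z (D≥0 pt)) (B≥0 pt)) det≥0)
      i₂ = solve 4 (λ x₀ x₁ y₀ y₁ → (y₁ :* x₀ :- x₁ :* y₀) :+ x₁ :* (y₀ :- y₁)
        := y₁ :* (x₀ :- x₁)) refl
      i₃ = solve 3 (λ B a₀ a₁ → B :* (a₀ :- a₁)
        := (B :* a₀ :+ con 0ℚ :* con 0ℚ) :- (B :* a₁ :+ con 0ℚ :* con 0ℚ)) refl
      i₄ = solve 2 (λ B a₁ → B :* a₁ := B :* a₁ :+ con 0ℚ :* con 0ℚ) refl
      i₅ = solve 5 (λ z B D a b → z :* D :* b
        := (B :* a :+ con 0ℚ :* con 0ℚ) :- (B :* a :+ (:- (z :* D)) :* b)) refl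
      i₆ = solve 7 (λ z B D a₀ a₁ b₀ b₁ → z :* D :* (b₀ :- b₁)
        := ((B :* a₀ :+ con 0ℚ :* con 0ℚ) :- (B :* a₁ :+ con 0ℚ :* con 0ℚ))
           :- ((B :* a₀ :+ (:- (z :* D)) :* b₀) :- (B :* a₁ :+ (:- (z :* D)) :* b₁))) refl
      -- Written out, this drop is a difference of terms without a visible sign. Multiplied by b₁′
      -- it becomes the determinant plus a₁′ times the drop of b′.
      δ≥0 : 0ℚ ≤ a₀′ - a₁′
      δ≥0 = *-cancel≥0 (subst (0ℚ <_) (i₄ (B t) a₁) (*>0 (B>0 pt) a₁>0))
        (subst (0ℚ ≤_) (i₂ a₀′ a₁′ b₀′ b₁′)
          (+≥0 det′ (*≥0 (ℚ.<⇒≤ arc>0)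
            (subst (0ℚ ≤_) (i₃ (B t) a₀ a₁) (*≥0 (B≥0 pt) (sub≥0 a₁≤a₀))))))

    PosTo-unscale : ∀ k {c a b} → 0ℚ < c → b ≡ comb c a 0ℚ (0ℚ , 0ℚ) → PosTo k b → PosTo k a
    PosTo-unscale zero    _   _    _        = tt
    PosTo-unscale (suc k) {c} {a₀ , a₁} 0<c refl (p , ps) =
      *-cancel>0 0<c (subst (0ℚ <_) (i₁ c a₁) p)
      , PosTo-unscale k 0<c (cong (_ ,_) (i₂ z c a₀ a₁)) ps
      where
      i₁ = solve 2 (λ c a → c :* a :+ con 0ℚ :* con 0ℚ := c :* a) refl
      i₂ = solve 4 (λ z c a₀ a₁ → (c :* a₁ :+ con 0ℚ :* con 0ℚ) :- z :* (c :* a₀ :+ con 0ℚ :* con 0ℚ)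
        := c :* (a₁ :- z :* a₀) :+ con 0ℚ :* con 0ℚ) refl

    -- Appending `t` to the arc and taking the trace amounts to closing the arc through the root of
    -- `t`; so a ring may be opened at any next tree.
    close≡tr : ∀ k t ts → close t (step^ k (colA ts)) (step^ k (colB ts))
      ≡ tr (step^ k (colA (t ∷ ts))) (step^ k (colB (t ∷ ts)))
    close≡tr k t ts = sym (trans
      (cong₂ tr (step^-comb k (B t) (colA ts) (- (z * D t)) (colB ts))
                (step^-comb k (B t) (colA ts) 0ℚ (0ℚ , 0ℚ)))
      (identity z (B t) (D t) (proj₁ a) (proj₂ a) (proj₁ b) (proj₂ b) (proj₁ o) (proj₂ o)))
      where
      a = step^ k (colA ts)
      b = step^ k (colB ts)
      o = step^ k (0ℚ , 0ℚ)
      identity = solve 9 (λ z B D a₀ a₁ b₀ b₁ o₀ o₁ →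
        (B :* a₀ :+ (:- (z :* D)) :* b₀) :- (B :* a₀ :+ con 0ℚ :* o₀) :+ (B :* a₁ :+ con 0ℚ :* o₁)
          := a₁ :* B :- z :* (b₀ :* D)) refl

    private
      trace : ℕ → List Tree → ℚ
      trace k ts = tr (step^ k (colA ts)) (step^ k (colB ts))

      unroll-head : ∀ k t ts → Pos t → Strong (step^ k (colA ts)) (step^ k (colB ts)) →
        PosTo k (colA ts) → 0ℚ < trace k (t ∷ ts) →
        trace k (t ∷ ts) ≤ trace (k ℕ.+ size t) ts × PosTo (suc (k ℕ.+ size t)) (colA ts)
      unroll-head k t ts pt s ps 0<tr =
        subst₂ _≤_ (close≡tr k t ts)
          (cong₂ tr (step^-+ k (size t) (colA ts)) (step^-+ k (size t) (colB ts))) (proj₁ unrolled)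
        , subst (λ k → PosTo k (colA ts)) (ℕ.+-suc k (size t))
            (PosTo-+ k (suc (size t)) ps (proj₂ unrolled))
        where unrolled = unroll pt s (subst (0ℚ <_) (sym (close≡tr k t ts)) 0<tr)

      -- `colB (t ∷ ts)` is `B t` times `colA ts`, so positivity passes from `colA (t ∷ ts)` over
      -- `colB (t ∷ ts)` to the shorter list.
      PosTo-tail : ∀ k t ts → Good (t ∷ ts) → PosTo k (colA (t ∷ ts)) → PosTo k (colA ts)
      PosTo-tail k t ts g@((pt , _) ∷ _) ps =
        PosTo-unscale k (B>0 pt) refl (Weak-PosTo k (Good⇒Weak g) ps)

      Strong-path : ∀ k → PosTo (suc (suc (suc k))) (colA []) →
        Strong (step^ (suc (suc k)) (colA [])) (step^ (suc (suc k)) (colB []))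
      Strong-path k (_ , ps) = Weak-step^ k {step (1ℚ , 1ℚ)} {step (0ℚ , 1ℚ)}
        (weak (proj₁ ps) (≤-from 0≤z (i₁ z)) (ℚ.≤-reflexive (i₂ z))
          ℚ.≤-refl (≤-from 0≤z (i₃ z)) (subst (0ℚ ≤_) (i₄ z) 0≤z)) ps
        where
        i₁ = solve 1 (λ z → z := con 1ℚ :- (con 1ℚ :- z :* con 1ℚ)) refl
        i₂ = solve 1 (λ z → con 1ℚ :- z :* con 0ℚ := con 1ℚ) refl
        i₃ = solve 1 (λ z → z := (con 1ℚ :- z :* con 0ℚ) :- (con 1ℚ :- z :* con 1ℚ)) refl
        i₄ = solve 1 (λ z → z := (con 1ℚ :- z :* con 0ℚ) :* con 1ℚ
               :- (con 1ℚ :- z :* con 1ℚ) :* con 1ℚ) refl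

      -- Here `k` path vertices are on the ring already. The two bounds on `k` ensure that at least
      -- two ring vertices remain besides the root of `t`, which makes the arc left by opening the
      -- ring at `t` a `Strong` one.
      unroll-all : ∀ k t ts → Good (t ∷ ts) → 1 ℕ.≤ k → (ts ≡ [] → 2 ℕ.≤ k) →
        PosTo (suc k) (colA (t ∷ ts)) → 0ℚ < trace k (t ∷ ts) →
        trace k (t ∷ ts) ≤ path-ring (k ℕ.+ sizes (t ∷ ts))
      unroll-all zero          t ts       _ () _ _ _
      unroll-all (suc zero)    t []       _ _ 2≤k _ _ with 2≤k refl
      ... | ℕ.s≤s ()
      unroll-all (suc (suc j)) t []       g@((pt , _) ∷ _) _ _ ps 0<tr =
        subst (λ n → trace k (t ∷ []) ≤ path-ring (k ℕ.+ n)) (sym (ℕ.+-identityʳ (size t)))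
          (proj₁ (unroll-head k t [] pt (Strong-path j ps′) (PosTo-pred k ps′) 0<tr))
        where
        k = suc (suc j)
        ps′ : PosTo (suc k) (colA [])
        ps′ = PosTo-tail (suc k) t [] g ps
      unroll-all (suc j) t (u ∷ us) g@((pt , _) ∷ gs) _ _ ps 0<tr =
        ℚ.≤-trans (proj₁ headed)
          (subst (λ n → trace (k ℕ.+ size t) (u ∷ us) ≤ path-ring n) (ℕ.+-assoc k (size t) (sizes (u ∷ us)))
            (unroll-all (k ℕ.+ size t) u us gs (ℕ.s≤s ℕ.z≤n)
              (λ _ → ℕ.+-mono-≤ (ℕ.s≤s {n = j} ℕ.z≤n)
                (subst (1 ℕ.≤_) (sym (size≡1+edges t)) (ℕ.s≤s ℕ.z≤n)))
              (proj₂ headed) (ℚ.<-≤-trans 0<tr (proj₁ headed))))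
        where
        k = suc j
        headed = unroll-head k t (u ∷ us) pt
          (Weak-step^ j (Good⇒Weak gs) (PosTo-tail (suc k) t (u ∷ us) g ps))
          (PosTo-pred k (PosTo-tail (suc k) t (u ∷ us) g ps)) 0<tr

    ring≤path-ring : ∀ {t₁ t₂ t₃ ts} → Pos t₁ → Good (t₂ ∷ t₃ ∷ ts) → 0ℚ < ring (t₁ ∷ t₂ ∷ t₃ ∷ ts) →
      ring (t₁ ∷ t₂ ∷ t₃ ∷ ts) ≤ path-ring (sizes (t₁ ∷ t₂ ∷ t₃ ∷ ts))
    ring≤path-ring {t₁} {t₂} {t₃} {ts} p₁ g 0<R = ℚ.≤-trans (proj₁ unrolled)
      (unroll-all (size t₁) t₂ (t₃ ∷ ts) g
        (subst (1 ℕ.≤_) (sym (size≡1+edges t₁)) (ℕ.s≤s ℕ.z≤n)) (λ ())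
        (proj₂ unrolled) (ℚ.<-≤-trans 0<R (proj₁ unrolled)))
      where unrolled = unroll p₁ (Good⇒Strong g) 0<R

    ring-singles : ∀ k → ring (replicate (suc k) single) ≡ path-ring (suc k)
    ring-singles k = trans (close≡tr 0 single (replicate k single)) (go (suc k) 0)
      where
      go : ∀ j i → tr (step^ i (colA (replicate j single))) (step^ i (colB (replicate j single)))
        ≡ path-ring (i ℕ.+ j)
      go zero    i = cong path-ring (sym (ℕ.+-identityʳ i))
      go (suc j) i = trans (sym (close≡tr i single (replicate j single)))
        (trans (identity z (proj₁ a) (proj₂ a) (proj₁ b) (proj₂ b))
          (trans (cong₂ tr (sym (step^-step i (colA (replicate j single))))
                           (sym (step^-step i (colB (replicate j single)))))
            (trans (go j (suc i)) (cong path-ring (sym (ℕ.+-suc i j))))))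
        where
        a = step^ i (colA (replicate j single))
        b = step^ i (colB (replicate j single))
        identity = solve 5 (λ z a₀ a₁ b₀ b₁ → a₁ :* con 1ℚ :- z :* (b₀ :* con 1ℚ)
          := a₁ :- b₁ :+ (b₁ :- z :* b₀)) refl

    -- Lower bound by the triangle with pendants

    infixr 8 κ^_
    κ^_ : ℕ → ℚ
    κ^ zero  = 1ℚ
    κ^ suc k = (1ℚ - z) * κ^ k

    -- The independence polynomial of U n at - z, for n = 3 + k.
    fan-ring : ℕ → ℚ
    fan-ring k = κ^ k * (1ℚ - z - z) - z

    κ^-+ : ∀ j k → κ^ (j ℕ.+ k) ≡ κ^ j * κ^ k
    κ^-+ zero    k = sym (ℚ.*-identityˡ (κ^ k))
    κ^-+ (suc j) k = trans (cong ((1ℚ - z) *_) (κ^-+ j k)) (sym (ℚ.*-assoc (1ℚ - z) (κ^ j) (κ^ k)))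

    -- The star with k leaves, rooted at its centre.
    fan : ℕ → Tree
    fan zero    = single
    fan (suc k) = join (fan k) single

    ring-fan : ∀ k → ring (fan k ∷ single ∷ single ∷ []) ≡ fan-ring k
    ring-fan k = trans (cong₂ (λ b d → α * b - z * (β * d)) (B-fan k) (D-fan k))
      (identity z (κ^ k))
      where
      α = proj₂ (colA (single ∷ single ∷ []))
      β = proj₁ (colB (single ∷ single ∷ []))
      B-fan : ∀ k → B (fan k) ≡ κ^ k
      B-fan zero    = refl
      B-fan (suc k) = trans (cong (_* (1ℚ - z * 1ℚ)) (B-fan k)) (i z (κ^ k))
        where i = solve 2 (λ z q → q :* (con 1ℚ :- z :* con 1ℚ) := (con 1ℚ :- z) :* q) refl
      D-fan : ∀ k → D (fan k) ≡ 1ℚ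
      D-fan zero    = refl
      D-fan (suc k) = trans (cong (_* 1ℚ) (D-fan k)) (ℚ.*-identityˡ 1ℚ)
      identity = solve 2 (λ z q →
        let d  = :- (z :* con 1ℚ)
            o  = con 0ℚ
            I  = con 1ℚ
            a₀ = I :* I :+ d :* o
            b₀ = I :* I :+ o :* o
            a₁ = I :* I :+ d :* I
            b₁ = I :* I :+ o :* o
        in (I :* a₁ :+ d :* b₁) :* q :- z :* ((I :* a₀ :+ o :* o) :* I)
             := q :* (I :- z :- z) :- z) refl

    module _ (κ≥0 : 0ℚ ≤ 1ℚ - z) where

      κ^≥0 : ∀ k → 0ℚ ≤ κ^ k
      κ^≥0 zero    = 0≤1
      κ^≥0 (suc k) = *≥0 κ≥0 (κ^≥0 k)

      κ^≤1 : ∀ k → κ^ k ≤ 1ℚ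
      κ^≤1 zero    = ℚ.≤-refl
      κ^≤1 (suc k) = ≤-from (+≥0 (sub≥0 (κ^≤1 k)) (*≥0 0≤z (κ^≥0 k))) (i z (κ^ k))
        where i = solve 2 (λ z q → (con 1ℚ :- q) :+ z :* q := con 1ℚ :- (con 1ℚ :- z) :* q) refl

      D≤1 : ∀ {t} → Pos t → D t ≤ 1ℚ
      B≤1 : ∀ {t} → Pos t → B t ≤ 1ℚ
      B≤1 p = ℚ.≤-trans (B≤D p) (D≤1 p)
      D≤1 (single _) = ℚ.≤-refl
      D≤1 (join {s} {t} ps pt _) =
        ≤-from (+≥0 (sub≥0 (D≤1 ps)) (*≥0 (D≥0 ps) (sub≥0 (B≤1 pt)))) (i (D s) (B t))
        where i = solve 2 (λ d b → (con 1ℚ :- d) :+ d :* (con 1ℚ :- b) := con 1ℚ :- d :* b) refl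

      -- `κ^ m` is the value of m isolated vertices, and dropping edges raises the value.
      B≤κ^ : ∀ {t} → Pos t → B t ≤ κ^ edges t
      A≤κ^ : ∀ {t} → Pos t → A t ≤ κ^ suc (edges t)
      A≤κ^ {t} p = ≤-from (+≥0 (*≥0 κ≥0 (sub≥0 (B≤κ^ p))) (*≥0 0≤z (sub≥0 (B≤D p))))
        (i z (B t) (D t) (κ^ edges t))
        where i = solve 4 (λ z b d q → (con 1ℚ :- z) :* (q :- b) :+ z :* (d :- b)
                := (con 1ℚ :- z) :* q :- (b :- z :* d)) refl
      B≤κ^ (single _) = ℚ.≤-refl
      B≤κ^ {join s t} (join ps pt _) = subst (B s * A t ≤_)
        (trans (ℚ.*-comm (κ^ edges s) (κ^ suc (edges t))) (sym (κ^-+ (suc (edges t)) (edges s))))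
        (≤-from (+≥0 (*≥0 (sub≥0 (B≤κ^ ps)) (κ^≥0 (suc (edges t))))
                     (*≥0 (B≥0 ps) (sub≥0 (A≤κ^ pt))))
          (i (B s) (A t) (κ^ edges s) (κ^ suc (edges t))))
        where i = solve 4 (λ b a p q → (p :- b) :* q :+ b :* (q :- a) := p :* q :- b :* a) refl

      -- The left-hand side is the value of a star attached at its centre.
      star≤ : ∀ {t} → Pos t → ∀ {α β} → α ≤ β → 0ℚ ≤ β →
        α * κ^ edges t - z * β ≤ α * B t - z * (β * D t)
      star≤-join : ∀ {s t} → Pos s → Pos t → ∀ {α β} → α ≤ β → 0ℚ ≤ β →
        α * κ^ edges (join s t) - z * β ≤ α * B (join s t) - z * (β * D (join s t))

      star≤ (single _) {α} {β} _ _ = ℚ.≤-reflexive (i z α β)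
        where i = solve 3 (λ z α β → α :* con 1ℚ :- z :* β := α :* con 1ℚ :- z :* (β :* con 1ℚ)) refl
      star≤ (join ps pt _) = star≤-join ps pt

      star≤-join {s} {t} ps pt {α} {β} α≤β β≥0 = by-sign (ℚ.≤-total α 0ℚ)
        where
        Q = κ^ edges t
        q = κ^ edges s
        α₂ = α * B s - z * (β * D s)
        i₁ = solve 8 (λ z α β Bs Ds Bt Dt k →
          ((:- α) :* (k :- Bs :* (Bt :- z :* Dt))) :+ z :* (β :* ((con 1ℚ :- Ds) :+ Ds :* (con 1ℚ :- Bt)))
          := (α :* (Bs :* (Bt :- z :* Dt)) :- z :* (β :* (Ds :* Bt))) :- (α :* k :- z :* β)) refl
        i₂ = solve 6 (λ z α β B D Q → z :* (con 1ℚ :- Q) :* ((β :- α) :* B :+ β :* (D :- B))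
          := ((α :* B :- z :* (β :* D)) :* Q :- z :* (α :* B))
             :- ((α :* ((con 1ℚ :- z) :* Q)) :* B :- z :* (β :* D))) refl
        i₃ = solve 7 (λ z α β Bs Ds Bt Dt →
          (α :* Bs :- z :* (β :* Ds)) :* Bt :- z :* ((α :* Bs) :* Dt)
          := α :* (Bs :* (Bt :- z :* Dt)) :- z :* (β :* (Ds :* Bt))) refl
        i₄ = solve 5 (λ z α β Q q → (α :* ((con 1ℚ :- z) :* Q)) :* q :- z :* β
          := α :* ((con 1ℚ :- z) :* (Q :* q)) :- z :* β) refl
        i₅ = solve 3 (λ α β κ → (β :- α) :+ α :* (con 1ℚ :- κ) := β :- α :* κ) refl
        i₆ = solve 2 (λ α p → p := α :- (α :- p)) refl
        by-sign : _ → α * κ^ edges (join s t) - z * β ≤ α * B (join s t) - z * (β * D (join s t))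
        by-sign (inj₁ α≤0) = ≤-from
          (+≥0 (*≥0 (subst (_≤ - α) refl (ℚ.neg-antimono-≤ α≤0)) (sub≥0 B≤))
               (*≥0 0≤z (*≥0 β≥0 (+≥0 (sub≥0 (D≤1 ps)) (*≥0 (D≥0 ps) (sub≥0 (B≤1 pt)))))))
          (i₁ z α β (B s) (D s) (B t) (D t) (κ^ edges (join s t)))
          where
          B≤ : B s * A t ≤ κ^ edges (join s t)
          B≤ = subst (B s * A t ≤_)
            (trans (ℚ.*-comm q (κ^ suc (edges t))) (sym (κ^-+ (suc (edges t)) (edges s))))
            (≤-from (+≥0 (*≥0 (sub≥0 (B≤κ^ ps)) (κ^≥0 (suc (edges t))))
                         (*≥0 (B≥0 ps) (sub≥0 (A≤κ^ pt))))
              (i (B s) (A t) q (κ^ suc (edges t))))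
            where i = solve 4 (λ b a p q → (p :- b) :* q :+ b :* (q :- a) := p :* q :- b :* a) refl
        by-sign (inj₂ α≥0) = begin
          α * ((1ℚ - z) * κ^ (edges t ℕ.+ edges s)) - z * β
            ≡⟨ cong (λ k → α * ((1ℚ - z) * k) - z * β) (κ^-+ (edges t) (edges s)) ⟩
          α * ((1ℚ - z) * (Q * q)) - z * β
            ≡⟨ i₄ z α β Q q ⟨
          (α * κ^ suc (edges t)) * q - z * β
            ≤⟨ star≤ ps (≤-from (+≥0 (sub≥0 α≤β) (*≥0 α≥0 (sub≥0 (κ^≤1 (suc (edges t))))))
                 (i₅ α β (κ^ suc (edges t)))) β≥0 ⟩
          (α * κ^ suc (edges t)) * B s - z * (β * D s)
            -- Of the `suc (edges t)` pendants at the root one becomes the root of `t`, and the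
            -- others are hung on it.
            ≤⟨ ≤-from (*≥0 (*≥0 0≤z (sub≥0 (κ^≤1 (edges t))))
                 (+≥0 (*≥0 (sub≥0 α≤β) (B≥0 ps)) (*≥0 β≥0 (sub≥0 (B≤D ps)))))
                 (i₂ z α β (B s) (D s) Q) ⟩
          α₂ * Q - z * (α * B s)
            ≤⟨ star≤ pt (≤-from (*≥0 0≤z (*≥0 β≥0 (D≥0 ps))) (i₆ (α * B s) (z * (β * D s))))
                 (*≥0 α≥0 (B≥0 ps)) ⟩
          α₂ * B t - z * ((α * B s) * D t)
            ≡⟨ i₃ z α β (B s) (D s) (B t) (D t) ⟩
          α * B (join s t) - z * (β * D (join s t)) ∎
          where open ℚ.≤-Reasoning

      private
        arc₂ : ∀ t s → arc (t ∷ s ∷ []) ≡ B t * B s - z * (B t * D s + D t * B s)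
        arc₂ t s = i z (B t) (D t) (B s) (D s)
          where i = solve 5 (λ z Bt Dt Bs Ds →
                  Bt :* (Bs :* con 1ℚ :+ (:- (z :* Ds)) :* con 1ℚ)
                  :+ (:- (z :* Dt)) :* (Bs :* con 1ℚ :+ con 0ℚ :* con 0ℚ)
                  := Bt :* Bs :- z :* (Bt :* Ds :+ Dt :* Bs)) refl

        arc₂≤ : ∀ {t s} → Pos t → Pos s → arc (t ∷ s ∷ []) ≤ B t * B s * (1ℚ - z - z)
        arc₂≤ {t} {s} pt ps = subst (_≤ B t * B s * (1ℚ - z - z)) (sym (arc₂ t s))
          (≤-from (*≥0 0≤z (+≥0 (*≥0 (B≥0 pt) (sub≥0 (B≤D ps))) (*≥0 (B≥0 ps) (sub≥0 (B≤D pt)))))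
            (i z (B t) (D t) (B s) (D s)))
          where i = solve 5 (λ z Bt Dt Bs Ds → z :* (Bt :* (Ds :- Bs) :+ Bs :* (Dt :- Bt))
                  := Bt :* Bs :* (con 1ℚ :- z :- z) :- (Bt :* Bs :- z :* (Bt :* Ds :+ Dt :* Bs))) refl

      -- The last two trees form a positive arc, and `arc₂≤` compares it with the edge between their
      -- roots, whose value is 1 - 2 z.
      2z≤1 : ∀ {t s ts} → Good (t ∷ s ∷ ts) → 0ℚ ≤ 1ℚ - z - z
      2z≤1 {ts = []} ((pt , arc>0) ∷ (ps , _) ∷ []) =
        ℚ.<⇒≤ (*-cancel>0 (*>0 (B>0 pt) (B>0 ps)) (ℚ.<-≤-trans arc>0 (arc₂≤ pt ps)))
      2z≤1 {ts = _ ∷ _} (_ ∷ g) = 2z≤1 g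

      -- The right-hand side is one edge with `excess` isolated vertices, which is what is left of
      -- the arc when all its other edges are dropped.
      arc≤ : ∀ {t s ts} → Good (t ∷ s ∷ ts) →
        arc (t ∷ s ∷ ts) ≤ κ^ excess (t ∷ s ∷ ts) * (1ℚ - z - z)
      arc≤ {t} {s} {[]} g@((pt , _) ∷ (ps , _) ∷ []) = ℚ.≤-trans (arc₂≤ pt ps)
        (≤-from (*≥0 (+≥0 (*≥0 (sub≥0 (B≤κ^ pt)) (κ^≥0 (edges s))) (*≥0 (B≥0 pt) (sub≥0 (B≤κ^ ps)))) (2z≤1 g))
          (trans (i (B t) (B s) (κ^ edges t) (κ^ edges s) (1ℚ - z - z))
            (cong (λ q → q * (1ℚ - z - z) - B t * B s * (1ℚ - z - z)) (sym (κ^-+ (edges t) (edges s))))))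
        where i = solve 5 (λ b a p q c → ((p :- b) :* q :+ b :* (q :- a)) :* c := p :* q :* c :- b :* a :* c) refl
      arc≤ {t} {s} {u ∷ us} ((pt , _) ∷ g) = begin
        arc (t ∷ s ∷ u ∷ us)
          ≤⟨ ≤-from (*≥0 (*≥0 0≤z (D≥0 pt)) (sub≥0 (Weak.a₁≤b₁ w)))
               (i₁ z (B t) (D t) (proj₂ (colA (s ∷ u ∷ us))) (proj₂ (colB (s ∷ u ∷ us)))) ⟩
        A t * arc (s ∷ u ∷ us)
          ≤⟨ ≤-from (+≥0 (*≥0 (sub≥0 (A≤κ^ pt)) (ℚ.<⇒≤ (Weak.a₁>0 w)))
                         (*≥0 (κ^≥0 (suc (edges t))) (sub≥0 (arc≤ g))))
               (i₂ (A t) (arc (s ∷ u ∷ us)) (κ^ suc (edges t)) (κ^ excess (s ∷ u ∷ us) * (1ℚ - z - z))) ⟩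
        κ^ suc (edges t) * (κ^ excess (s ∷ u ∷ us) * (1ℚ - z - z))
          ≡⟨ trans (sym (ℚ.*-assoc (κ^ suc (edges t)) (κ^ excess (s ∷ u ∷ us)) (1ℚ - z - z)))
               (cong (_* (1ℚ - z - z)) (trans (sym (κ^-+ (suc (edges t)) (excess (s ∷ u ∷ us))))
                 (cong (λ k → κ^ (k ℕ.+ excess (s ∷ u ∷ us))) (sym (size≡1+edges t))))) ⟩
        κ^ excess (t ∷ s ∷ u ∷ us) * (1ℚ - z - z) ∎
        where
        open ℚ.≤-Reasoning
        w = Good⇒Weak g
        i₁ = solve 5 (λ z B D a b → z :* D :* (b :- a)
          := (B :- z :* D) :* a :- (B :* a :+ (:- (z :* D)) :* b)) refl
        i₂ = solve 4 (λ a x p q → (p :- a) :* x :+ p :* (q :- x) := p :* q :- a :* x) refl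

      -- By induction on the length of the ring. In a triangle the other two trees are compared with
      -- stars, whose leaves are gathered at one vertex. A longer ring is shortened by turning its
      -- bare vertex into a leaf of the next tree.
      fan-ring≤single : ∀ {t s ts} → Good (t ∷ s ∷ ts) →
        fan-ring (excess (t ∷ s ∷ ts)) ≤ ring (single ∷ t ∷ s ∷ ts)

      -- The leaves of a star in place of `r` multiply only the part without the root, by a factor
      -- at most 1. By `arc≤` this part is larger in the fan, so the leaves cost the fan at least as
      -- much as the ring. The star inequality is a hypothesis because `r` may be a join of unknown
      -- positivity.
      fan-ring≤-by-star : ∀ r {t s ts} → Good (t ∷ s ∷ ts) →
        (∀ {α β} → α ≤ β → 0ℚ ≤ β → α * κ^ edges r - z * β ≤ α * B r - z * (β * D r)) →
        fan-ring (edges r ℕ.+ excess (t ∷ s ∷ ts)) ≤ ring (r ∷ t ∷ s ∷ ts)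
      fan-ring≤-by-star r {t} {s} {ts} g star = begin
        fan-ring (edges r ℕ.+ m)
          ≡⟨ cong (λ k → k * (1ℚ - z - z) - z) (κ^-+ (edges r) m) ⟩
        κ^ edges r * κ^ m * (1ℚ - z - z) - z
          ≤⟨ ≤-from (+≥0 (sub≥0 (fan-ring≤single g)) (*≥0 (sub≥0 (arc≤ g)) (sub≥0 (κ^≤1 (edges r)))))
               (i z α β (κ^ edges r) (κ^ m)) ⟩
        α * κ^ edges r - z * β
          ≤⟨ star (ℚ.≤-trans a₁≤b₁ b₁≤b₀) (ℚ.≤-trans (ℚ.<⇒≤ a₁>0) (ℚ.≤-trans a₁≤a₀ a₀≤b₀)) ⟩
        ring (r ∷ t ∷ s ∷ ts) ∎
        where
        open ℚ.≤-Reasoning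
        open Strong (Good⇒Strong g)
        m = excess (t ∷ s ∷ ts)
        α = proj₂ (colA (t ∷ s ∷ ts))
        β = proj₁ (colB (t ∷ s ∷ ts))
        i = solve 5 (λ z α β q k →
          let c = con 1ℚ :- z :- z in
          ((α :* con 1ℚ :- z :* (β :* con 1ℚ)) :- (k :* c :- z)) :+ (k :* c :- α) :* (con 1ℚ :- q)
          := (α :* q :- z :* β) :- (q :* k :* c :- z)) refl

      fan-ring≤single {t} {s} {[]} ((pt , _) ∷ (ps , _) ∷ []) = begin
        fan-ring (edges t ℕ.+ edges s)
          ≡⟨ cong (λ k → k * (1ℚ - z - z) - z) (κ^-+ (edges t) (edges s)) ⟩
        q * q′ * (1ℚ - z - z) - z
          -- All leaves at one vertex of a triangle against the same leaves divided between two of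
          -- its vertices.
          ≤⟨ ≤-from (*≥0 0≤z (*≥0 (sub≥0 (κ^≤1 (edges t))) (sub≥0 (κ^≤1 (edges s))))) (i₁ z q q′) ⟩
        α′ * q′ - z * q
          ≤⟨ star≤ ps (≤-from (*≥0 0≤z (+≥0 (κ^≥0 (edges t)) 0≤1)) (i₂ z q)) (κ^≥0 (edges t)) ⟩
        α′ * B s - z * (q * D s)
          ≡⟨ i₃ z q (B s) (D s) ⟩
        α * q - z * B s
          ≤⟨ star≤ pt (≤-from (*≥0 0≤z (+≥0 (D≥0 ps) (B≥0 ps))) (i₄ z (B s) (D s))) (B≥0 ps) ⟩
        α * B t - z * (B s * D t)
          ≡⟨ i₅ z (B t) (D t) (B s) (D s) ⟩
        ring (single ∷ t ∷ s ∷ []) ∎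
        where
        open ℚ.≤-Reasoning
        q  = κ^ edges t
        q′ = κ^ edges s
        α  = B s - z * (D s + B s)
        α′ = q - z * (q + 1ℚ)
        i₁ = solve 3 (λ z q q′ → z :* ((con 1ℚ :- q) :* (con 1ℚ :- q′))
          := ((q :- z :* (q :+ con 1ℚ)) :* q′ :- z :* q) :- (q :* q′ :* (con 1ℚ :- z :- z) :- z)) refl
        i₂ = solve 2 (λ z q → z :* (q :+ con 1ℚ) := q :- (q :- z :* (q :+ con 1ℚ))) refl
        i₃ = solve 4 (λ z q b d → (q :- z :* (q :+ con 1ℚ)) :* b :- z :* (q :* d)
          := (b :- z :* (d :+ b)) :* q :- z :* b) refl
        i₄ = solve 3 (λ z b d → z :* (d :+ b) := b :- (b :- z :* (d :+ b))) refl
        i₅ = solve 5 (λ z b d b′ d′ →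
          let I = con 1ℚ
              o = con 0ℚ
              a₀ = b′ :* I :+ (:- (z :* d′)) :* o
              a₁ = b′ :* I :+ (:- (z :* d′)) :* I
              b₁ = b′ :* I :+ o :* o
          in (b′ :- z :* (d′ :+ b′)) :* b :- z :* (b′ :* d)
             := (b :* a₁ :+ (:- (z :* d)) :* b₁) :* I :- z :* ((b :* a₀ :+ o :* o) :* I)) refl
      fan-ring≤single {t} {s} {u ∷ us} g₀@((pt , _) ∷ g) = begin
        fan-ring (size t ℕ.+ excess (s ∷ u ∷ us))
          ≡⟨ cong (λ k → fan-ring (k ℕ.+ excess (s ∷ u ∷ us))) (size≡1+edges t) ⟩
        fan-ring (edges (join t single) ℕ.+ excess (s ∷ u ∷ us))
          ≤⟨ fan-ring≤-by-star (join t single) g (star≤-join pt (single κ>0)) ⟩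
        ring (join t single ∷ s ∷ u ∷ us)
          -- The bare vertex leaves the ring and becomes a leaf at the root of `t`; `drop≤` again
          -- decides the comparison.
          ≤⟨ ≤-from (*≥0 0≤z (+≥0 (*≥0 (sub≥0 (B≤D pt)) (sub≥0 b₁≤b₀)) (*≥0 (B≥0 pt) (sub≥0 drop≤))))
               (i z (B t) (D t) (proj₁ a) (proj₂ a) (proj₁ b) (proj₂ b)) ⟩
        ring (single ∷ t ∷ s ∷ u ∷ us) ∎
        where
        open ℚ.≤-Reasoning
        open Strong (Good⇒Strong g)
        a = colA (s ∷ u ∷ us)
        b = colB (s ∷ u ∷ us)
        κ>0 : 0ℚ < 1ℚ - z * 1ℚ
        κ>0 = pos-single pt
          where
          pos-single : ∀ {t} → Pos t → 0ℚ < A single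
          pos-single (single p)   = p
          pos-single (join p _ _) = pos-single p
        i = solve 7 (λ z B D a₀ a₁ b₀ b₁ →
          z :* ((D :- B) :* (b₀ :- b₁) :+ B :* ((b₀ :- b₁) :- (a₀ :- a₁)))
          := ((B :* a₁ :+ (:- (z :* D)) :* b₁) :* con 1ℚ :- z :* ((B :* a₀ :+ con 0ℚ :* con 0ℚ) :* con 1ℚ))
             :- (a₁ :* (B :* (con 1ℚ :- z :* con 1ℚ)) :- z :* (b₀ :* (D :* con 1ℚ)))) refl

      fan-ring≤ring : ∀ {r t s ts} → Pos r → Good (t ∷ s ∷ ts) →
        fan-ring (edges r ℕ.+ excess (t ∷ s ∷ ts)) ≤ ring (r ∷ t ∷ s ∷ ts)
      fan-ring≤ring {r} pr g = fan-ring≤-by-star r g (star≤ pr)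

-- Weighted independence polynomials and Shearer's condition

module Weighted where

  open import Data.Bool using (Bool; true; false; if_then_else_; _∧_; not)
  open import Data.Empty using (⊥-elim)
  open import Data.Fin using (Fin; zero; suc; _≟_)
  open import Data.Nat using (ℕ; zero; suc)
  open import Data.List using (List; []; _∷_; map; foldr; allFin)
  import Data.List.Properties as List
  open import Data.List.Membership.Propositional using (_∈_; _∉_)
  open import Data.List.Membership.Propositional.Properties using (∈-allFin)
  open import Data.List.Relation.Unary.Any using (here; there)
  open import Data.List.Relation.Unary.All as All using (All; []; _∷_)
  open import Data.Product using (_×_; _,_; proj₁; proj₂)
  open import Data.Unit using (⊤; tt)
  open import Data.Rational hiding (_≟_)
  import Data.Rational.Properties as ℚ
  open import Data.Rational.Solver using (module +-*-Solver)
  open import Function using (_∘_)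
  open import Relation.Nullary using (Dec; yes; no; does)
  open import Relation.Nullary.Decidable using (dec-true; dec-false)
  open import Relation.Binary.PropositionalEquality
  open +-*-Solver using (solve; con; _:+_; _:*_; _:-_; :-_; _:=_)
  open Order

  private variable
    n : ℕ

  AdjMatrix : ℕ → Set
  AdjMatrix n = Fin n → Fin n → Bool

  -- The factors contributed by a vertex outside, respectively inside, the
  -- independent set.
  Weight : Set
  Weight = ℚ × ℚ

  absent : Weight
  absent = 1ℚ , 0ℚ

  mask : Bool → Weight → Weight
  mask b (o , i) = o , (if b then 0ℚ else i)

  tailAdj : AdjMatrix (suc n) → AdjMatrix n
  tailAdj adj u v = adj (suc u) (suc v)

  -- The weighted independence polynomial: the sum over all independent sets of
  -- the products of the factors of all vertices.
  Z : AdjMatrix n → (Fin n → Weight) → ℚ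
  Z {zero}  adj w = 1ℚ
  Z {suc n} adj w =
    proj₁ (w zero) * Z (tailAdj adj) (w ∘ suc)
    + proj₂ (w zero) * Z (tailAdj adj) (λ u → mask (adj zero (suc u)) (w (suc u)))

  infixl 10 _[_≔_]
  _[_≔_] : {A : Set} → (Fin n → A) → Fin n → A → Fin n → A
  (w [ v ≔ p ]) u = if does (u ≟ v) then p else w u

  update-≡ : ∀ {A : Set} (w : Fin n → A) v {p} → (w [ v ≔ p ]) v ≡ p
  update-≡ w v rewrite dec-true (v ≟ v) refl = refl

  update-≢ : ∀ {A : Set} (w : Fin n → A) {u v} {p} → u ≢ v → (w [ v ≔ p ]) u ≡ w u
  update-≢ w {u} {v} u≢v rewrite dec-false (u ≟ v) u≢v = refl

  update-elim : ∀ {A : Set} {P : A → Set} (w : Fin n → A) v {p} u →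
    (u ≡ v → P p) → (u ≢ v → P (w u)) → P ((w [ v ≔ p ]) u)
  update-elim {P = P} w v u eq neq = go (u ≟ v)
    where
    go : Dec (u ≡ v) → P ((w [ v ≔ _ ]) u)
    go (yes refl) = subst P (sym (update-≡ w v)) (eq refl)
    go (no u≢v)   = subst P (sym (update-≢ w u≢v)) (neq u≢v)

  update-self : ∀ {A : Set} (w : Fin n → A) v u → (w [ v ≔ w v ]) u ≡ w u
  update-self w v u = update-elim {P = _≡ w u} w v u (λ { refl → refl }) (λ _ → refl)

  map-update : ∀ {A : Set} (w : Fin n → A) {u p} us → u ∉ us → map (w [ u ≔ p ]) us ≡ map w us
  map-update w {u} us u∉us = List.map-cong-local (All.tabulate (λ {v} v∈us →
    update-≢ w {v} {u} (λ { refl → u∉us v∈us })))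

  Z-cong : (adj : AdjMatrix n) {w w′ : Fin n → Weight} → (∀ u → w u ≡ w′ u) → Z adj w ≡ Z adj w′
  Z-cong {zero}  adj eq = refl
  Z-cong {suc n} adj eq = cong₂ _+_
    (cong₂ _*_ (cong proj₁ (eq zero)) (Z-cong (tailAdj adj) (eq ∘ suc)))
    (cong₂ _*_ (cong proj₂ (eq zero))
      (Z-cong (tailAdj adj) (λ u → cong (mask (adj zero (suc u))) (eq (suc u)))))

  private
    mask-update : ∀ (f : Fin n → Bool) (w : Fin n → Weight) v p u →
      mask (f u) ((w [ v ≔ p ]) u) ≡ ((λ u → mask (f u) (w u)) [ v ≔ mask (f v) p ]) u
    mask-update f w v p u with u ≟ v
    ... | yes refl = refl
    ... | no  _    = refl

    mask-comm : ∀ a b p → mask a (mask b p) ≡ mask b (mask a p)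
    mask-comm true  true  p = refl
    mask-comm true  false p = refl
    mask-comm false b     p = refl

  -- Every term of the sum contains exactly one of the two factors of `v`.
  Z-linear : (adj : AdjMatrix n) (w : Fin n → Weight) (v : Fin n) (o i : ℚ) →
    Z adj (w [ v ≔ (o , i) ]) ≡ o * Z adj (w [ v ≔ absent ]) + i * Z adj (w [ v ≔ (0ℚ , 1ℚ) ])
  Z-linear {suc n} adj w zero o i =
    identity o i (Z (tailAdj adj) (w ∘ suc))
      (Z (tailAdj adj) (λ u → mask (adj zero (suc u)) (w (suc u))))
    where
    identity = solve 4 (λ o i x y → o :* x :+ i :* y
      := o :* (con 1ℚ :* x :+ con 0ℚ :* y) :+ i :* (con 0ℚ :* x :+ con 1ℚ :* y)) refl
  Z-linear {suc n} adj w (suc v) o i = trans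
    (cong₂ (λ x y → o₀ * x + i₀ * y) (Z-linear (tailAdj adj) (w ∘ suc) v o i) (mask≡ (o , i)))
    (trans (by-cases (adj zero (suc v)))
      (sym (cong₂ (λ x y → o * (o₀ * A₁ + i₀ * x) + i * (o₀ * A₂ + i₀ * y))
        (mask≡ absent) (mask≡ (0ℚ , 1ℚ)))))
    where
    o₀ = proj₁ (w zero)
    i₀ = proj₂ (w zero)
    A₁ = Z (tailAdj adj) ((w ∘ suc) [ v ≔ absent ])
    A₂ = Z (tailAdj adj) ((w ∘ suc) [ v ≔ (0ℚ , 1ℚ) ])
    masked : Fin n → Weight
    masked u = mask (adj zero (suc u)) (w (suc u))
    X : Weight → ℚ
    X p = Z (tailAdj adj) (masked [ v ≔ p ])
    mask≡ : ∀ p → Z (tailAdj adj) (λ u → mask (adj zero (suc u)) ((w [ suc v ≔ p ]) (suc u)))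
      ≡ X (mask (adj zero (suc v)) p)
    mask≡ p = Z-cong (tailAdj adj) (mask-update (λ u → adj zero (suc u)) (w ∘ suc) v p)
    linear : ∀ o i → X (o , i) ≡ o * X absent + i * X (0ℚ , 1ℚ)
    linear = Z-linear (tailAdj adj) masked v
    by-cases : ∀ b → o₀ * (o * A₁ + i * A₂) + i₀ * X (mask b (o , i))
      ≡ o * (o₀ * A₁ + i₀ * X (mask b absent)) + i * (o₀ * A₂ + i₀ * X (mask b (0ℚ , 1ℚ)))
    by-cases true = trans (cong (λ x → o₀ * (o * A₁ + i * A₂) + i₀ * x) (linear o 0ℚ))
      (trans (identity o i o₀ i₀ A₁ A₂ (X absent) (X (0ℚ , 1ℚ)))
        (cong (λ x → o * (o₀ * A₁ + i₀ * X absent) + i * (o₀ * A₂ + i₀ * x)) (sym (linear 0ℚ 0ℚ))))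
      where
      identity = solve 8 (λ o i o₀ i₀ A₁ A₂ x y →
        o₀ :* (o :* A₁ :+ i :* A₂) :+ i₀ :* (o :* x :+ con 0ℚ :* y)
          := o :* (o₀ :* A₁ :+ i₀ :* x) :+ i :* (o₀ :* A₂ :+ i₀ :* (con 0ℚ :* x :+ con 0ℚ :* y))) refl
    by-cases false = trans (cong (λ x → o₀ * (o * A₁ + i * A₂) + i₀ * x) (linear o i))
      (identity o i o₀ i₀ A₁ A₂ (X absent) (X (0ℚ , 1ℚ)))
      where
      identity = solve 8 (λ o i o₀ i₀ A₁ A₂ x y →
        o₀ :* (o :* A₁ :+ i :* A₂) :+ i₀ :* (o :* x :+ i :* y)
          := o :* (o₀ :* A₁ :+ i₀ :* x) :+ i :* (o₀ :* A₂ :+ i₀ :* y)) refl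

  kill : AdjMatrix n → Fin n → (Fin n → Weight) → Fin n → Weight
  kill adj v w u = mask (adj v u) (w u)

  -- A vertex forced into the set with factor 1 does nothing but exclude its neighbours, so it may
  -- as well be absent once they are masked.
  Z-forced : (adj : AdjMatrix n) → (∀ u v → adj u v ≡ adj v u) → (w : Fin n → Weight) (v : Fin n) →
    Z adj (w [ v ≔ (0ℚ , 1ℚ) ]) ≡ Z adj (kill adj v w [ v ≔ absent ])
  Z-forced {suc n} adj symm w zero = identity
    (Z (tailAdj adj) (w ∘ suc))
    (Z (tailAdj adj) (λ u → mask (adj zero (suc u)) (w (suc u))))
    (Z (tailAdj adj) (λ u → mask (adj zero (suc u)) (mask (adj zero (suc u)) (w (suc u)))))
    where
    identity : ∀ x y z → 0ℚ * x + 1ℚ * y ≡ 1ℚ * y + 0ℚ * z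
    identity = solve 3 (λ x y z → con 0ℚ :* x :+ con 1ℚ :* y := con 1ℚ :* y :+ con 0ℚ :* z) refl
  Z-forced {suc n} adj symm w (suc v) = cong₂ _+_
    (cong (o₀ *_) (Z-forced (tailAdj adj) symm′ (w ∘ suc) v))
    (trans (cong (i₀ *_) (Z-cong (tailAdj adj)
             (mask-update (λ u → adj zero (suc u)) (w ∘ suc) v (0ℚ , 1ℚ))))
      (by-cases (adj zero (suc v)) (adj (suc v) zero) refl (symm zero (suc v))))
    where
    o₀ = proj₁ (w zero)
    i₀ = proj₂ (w zero)
    symm′ : ∀ u v → tailAdj adj u v ≡ tailAdj adj v u
    symm′ u v = symm (suc u) (suc v)
    masked : Fin n → Weight
    masked u = mask (adj zero (suc u)) (w (suc u))
    right : ℚ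
    right = Z (tailAdj adj) (λ u → mask (adj zero (suc u)) ((kill adj (suc v) w [ suc v ≔ absent ]) (suc u)))
    right≡ : adj zero (suc v) ≡ false → right ≡ Z (tailAdj adj) (kill (tailAdj adj) v masked [ v ≔ absent ])
    right≡ eq = Z-cong (tailAdj adj) (λ u →
      trans (mask-update (λ u → adj zero (suc u)) (kill (tailAdj adj) v (w ∘ suc)) v absent u)
        (trans (cong (λ p → ((λ u → mask (adj zero (suc u)) (kill (tailAdj adj) v (w ∘ suc) u)) [ v ≔ p ]) u)
                 (mask-absent (adj zero (suc v))))
          (cong (λ p → if does (u ≟ v) then absent else p)
            (mask-comm (adj zero (suc u)) (adj (suc v) (suc u)) (w (suc u))))))
      where
      mask-absent : ∀ b → mask b absent ≡ absent
      mask-absent true  = refl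
      mask-absent false = refl
    by-cases : ∀ b b′ → adj zero (suc v) ≡ b → b ≡ b′ →
      i₀ * Z (tailAdj adj) (masked [ v ≔ mask b (0ℚ , 1ℚ) ]) ≡ (if b′ then 0ℚ else i₀) * right
    by-cases true  .true  _  refl = trans (cong (i₀ *_) (Z-linear (tailAdj adj) masked v 0ℚ 0ℚ))
      (identity i₀ (Z (tailAdj adj) (masked [ v ≔ absent ])) (Z (tailAdj adj) (masked [ v ≔ (0ℚ , 1ℚ) ])) right)
      where
      identity : ∀ i x y r → i * (0ℚ * x + 0ℚ * y) ≡ 0ℚ * r
      identity = solve 4 (λ i x y r → i :* (con 0ℚ :* x :+ con 0ℚ :* y) := con 0ℚ :* r) refl
    by-cases false .false eq refl = cong (i₀ *_)
      (trans (Z-forced (tailAdj adj) symm′ masked v) (sym (right≡ eq)))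

  unit : (Fin n → ℚ) → Fin n → Weight
  unit i u = 1ℚ , i u

  -- The first vertex absorbs the second as a pendant: if the former is outside the set, the latter
  -- is free; if it is inside, the latter must be outside.
  join-weight : Weight → Weight → Weight
  join-weight (o , i) (o′ , i′) = o * (o′ + i′) , i * o′

  -- A state is the value of a path with its first vertex outside the set, together with its full
  -- value. Starting from (0 , 1) instead of (1 , 1) forces the last vertex outside.
  transfer : Weight → ℚ × ℚ → ℚ × ℚ
  transfer (o , i) (p , q) = o * q , o * q + i * p

  transfers : List Weight → ℚ × ℚ → ℚ × ℚ
  transfers ps s = foldr transfer s ps

  -- Junk value 0 for the empty list.
  ring-weight : List Weight → ℚ
  ring-weight []             = 0ℚ
  ring-weight ((o , i) ∷ ps) =
    o * proj₂ (transfers ps (1ℚ , 1ℚ)) + i * proj₁ (transfers ps (0ℚ , 1ℚ))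

  module _ (adj : AdjMatrix n) (symm : ∀ u v → adj u v ≡ adj v u) where

    Z-expand : (w : Fin n → Weight) (v : Fin n) →
      Z adj w ≡ proj₁ (w v) * Z adj (w [ v ≔ absent ])
                + proj₂ (w v) * Z adj (kill adj v w [ v ≔ absent ])
    Z-expand w v = trans (Z-cong adj (λ u → sym (update-self w v u)))
      (trans (Z-linear adj w v (proj₁ (w v)) (proj₂ (w v)))
        (cong (λ x → proj₁ (w v) * Z adj (w [ v ≔ absent ]) + proj₂ (w v) * x)
          (Z-forced adj symm w v)))

    merge : (w : Fin n → Weight) (c v : Fin n) → Fin n → Weight
    merge w c v = w [ c ≔ absent ] [ v ≔ join-weight (w v) (w c) ]

    -- Neighbours of `c` with inner factor 0 do not count, so a vertex that becomes pendant only in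
    -- the course of the reduction can be merged as well.
    Z-merge : ∀ {w : Fin n → Weight} {c v} → c ≢ v → adj c v ≡ true →
      (∀ u → adj c u ≡ true → u ≢ v → proj₂ (w u) ≡ 0ℚ) → Z adj w ≡ Z adj (merge w c v)
    Z-merge {w} {c} {v} c≢v c~v other = begin
      Z adj w
        ≡⟨ Z-expand w c ⟩
      o′ * Z adj (w [ c ≔ absent ]) + i′ * Z adj (kill adj c w [ c ≔ absent ])
        ≡⟨ cong₂ (λ x y → o′ * x + i′ * y) (trans (Z-cong adj w₁≡) (linear o i))
             (trans (Z-cong adj killed≡) (linear o 0ℚ)) ⟩
      o′ * (o * Y absent + i * Y (0ℚ , 1ℚ)) + i′ * (o * Y absent + 0ℚ * Y (0ℚ , 1ℚ))
        ≡⟨ identity o i o′ i′ (Y absent) (Y (0ℚ , 1ℚ)) ⟩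
      o * (o′ + i′) * Y absent + i * o′ * Y (0ℚ , 1ℚ)
        ≡⟨ linear (o * (o′ + i′)) (i * o′) ⟨
      Z adj (merge w c v) ∎
      where
      open ≡-Reasoning
      o  = proj₁ (w v)
      i  = proj₂ (w v)
      o′ = proj₁ (w c)
      i′ = proj₂ (w c)
      w₁ : Fin n → Weight
      w₁ = w [ c ≔ absent ]
      Y : Weight → ℚ
      Y p = Z adj (w₁ [ v ≔ p ])
      linear : ∀ o i → Y (o , i) ≡ o * Y absent + i * Y (0ℚ , 1ℚ)
      linear = Z-linear adj w₁ v
      w₁≡ : ∀ u → w₁ u ≡ (w₁ [ v ≔ w v ]) u
      w₁≡ u = update-elim {P = w₁ u ≡_} w₁ v u
        (λ { refl → update-≢ w (c≢v ∘ sym) }) (λ _ → refl)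
      killed≡ : ∀ u → (kill adj c w [ c ≔ absent ]) u ≡ (w₁ [ v ≔ (o , 0ℚ) ]) u
      killed≡ u = update-elim {P = (kill adj c w [ c ≔ absent ]) u ≡_} w₁ v u
        (λ { refl → trans (update-≢ (kill adj c w) (c≢v ∘ sym)) (cong (λ b → mask b (w v)) c~v) })
        (λ u≢v → update-elim {P = _≡ w₁ u} (kill adj c w) c u
          (λ { refl → sym (update-≡ w c) })
          (λ u≢c → trans (unaffected (adj c u) refl u≢v) (sym (update-≢ w u≢c))))
        where
        unaffected : ∀ b → adj c u ≡ b → u ≢ v → mask (adj c u) (w u) ≡ w u
        unaffected true  eq u≢v rewrite eq = cong (proj₁ (w u) ,_) (sym (other u eq u≢v))
        unaffected false eq u≢v rewrite eq = refl
      identity = solve 6 (λ o i o′ i′ x y →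
        o′ :* (o :* x :+ i :* y) :+ i′ :* (o :* x :+ con 0ℚ :* y)
          := o :* (o′ :+ i′) :* x :+ i :* o′ :* y) refl

    infixl 9 _∣_
    _∣_ : (Fin n → Weight) → (Fin n → Bool) → Fin n → Weight
    (w ∣ χ) u = if χ u then w u else absent

    -- Shearer's condition: positivity on all induced subgraphs.
    Shearer : (Fin n → Weight) → Set
    Shearer w = ∀ χ → 0ℚ < Z adj (w ∣ χ)

    Shearer-cong : ∀ {w w′} → (∀ u → w u ≡ w′ u) → Shearer w → Shearer w′
    Shearer-cong eq sh χ = subst (0ℚ <_)
      (Z-cong adj (λ u → cong (λ p → if χ u then p else absent) (eq u))) (sh χ)

    Shearer⇒Z>0 : ∀ {w} → Shearer w → 0ℚ < Z adj w
    Shearer⇒Z>0 sh = sh (λ _ → true)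

    -- Each induced subgraph of the merged graph comes from one of the given graph: if it contains
    -- `v`, then `c` is taken along, and otherwise `c` is left out.
    Shearer-merge : ∀ {w c v} → c ≢ v → adj c v ≡ true →
      (∀ u → adj c u ≡ true → u ≢ v → proj₂ (w u) ≡ 0ℚ) → Shearer w → Shearer (merge w c v)
    Shearer-merge {w} {c} {v} c≢v c~v other sh χ = by-cases (χ v) refl
      where
      if-same : ∀ b → (if b then absent else absent) ≡ absent
      if-same true  = refl
      if-same false = refl
      other′ : ∀ χ u → adj c u ≡ true → u ≢ v → proj₂ ((w ∣ χ) u) ≡ 0ℚ
      other′ χ u eq u≢v with χ u
      ... | true  = other u eq u≢v
      ... | false = refl
      by-cases : ∀ b → χ v ≡ b → 0ℚ < Z adj (merge w c v ∣ χ)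
      by-cases true eq = subst (0ℚ <_)
        (trans (Z-merge c≢v c~v (other′ χ′)) (Z-cong adj same)) (sh χ′)
        where
        χ′ : Fin n → Bool
        χ′ = χ [ c ≔ true ]
        χ′c : χ′ c ≡ true
        χ′c = update-≡ χ c
        χ′v : χ′ v ≡ true
        χ′v = trans (update-≢ χ (c≢v ∘ sym)) eq
        same : ∀ u → merge (w ∣ χ′) c v u ≡ (merge w c v ∣ χ) u
        same u = update-elim {P = _≡ (merge w c v ∣ χ) u} ((w ∣ χ′) [ c ≔ absent ]) v u
          (λ { refl → trans (cong₂ join-weight (cong (λ b → if b then w v else absent) χ′v)
                                               (cong (λ b → if b then w c else absent) χ′c))
                      (sym (trans (cong (λ b → if b then merge w c v v else absent) eq)
                             (update-≡ (w [ c ≔ absent ]) v))) })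
          (λ u≢v → update-elim {P = _≡ (merge w c v ∣ χ) u} (w ∣ χ′) c u
            (λ { refl → sym (trans (cong (λ p → if χ c then p else absent)
                   (trans (update-≢ (w [ c ≔ absent ]) c≢v) (update-≡ w c))) (if-same (χ c))) })
            (λ u≢c → cong₂ (λ b p → if b then p else absent) (update-≢ χ u≢c)
              (sym (trans (update-≢ (w [ c ≔ absent ]) u≢v) (update-≢ w u≢c)))))
      by-cases false eq = subst (0ℚ <_) (Z-cong adj same) (sh (χ [ c ≔ false ]))
        where
        same : ∀ u → (w ∣ (χ [ c ≔ false ])) u ≡ (merge w c v ∣ χ) u
        same u = go (u ≟ v) (u ≟ c)
          where
          go : Dec (u ≡ v) → Dec (u ≡ c) → (w ∣ (χ [ c ≔ false ])) u ≡ (merge w c v ∣ χ) u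
          go (yes refl) _ = trans
            (cong (λ b → if b then w u else absent) (trans (update-≢ χ (c≢v ∘ sym)) eq))
            (sym (cong (λ b → if b then merge w c v u else absent) eq))
          go (no u≢v) (yes refl) = trans
            (cong (λ b → if b then w u else absent) (update-≡ χ c))
            (sym (trans (cong (λ p → if χ c then p else absent)
                   (trans (update-≢ (w [ c ≔ absent ]) c≢v) (update-≡ w c))) (if-same (χ c))))
          go (no u≢v) (no u≢c) = cong₂ (λ b p → if b then p else absent) (update-≢ χ u≢c)
            (sym (trans (update-≢ (w [ c ≔ absent ]) u≢v) (update-≢ w u≢c)))

    private
      -- The coefficient of the weight of `v` is the value of the subgraph without the closed
      -- neighbourhood of `v`, which is positive by Shearer's condition.
      Z-mono-step : ∀ {i v p} → Shearer (unit i) → i v ≤ p → ∀ χ →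
        Z adj (unit i ∣ χ) ≤ Z adj (unit (i [ v ≔ p ]) ∣ χ)
      Z-mono-step {i} {v} {p} sh iv≤p χ = by-cases (χ v) refl
        where
        w w′ : Fin n → Weight
        w  = unit i ∣ χ
        w′ = unit (i [ v ≔ p ]) ∣ χ
        same : ∀ u → u ≢ v → w′ u ≡ w u
        same u u≢v = cong (λ q → if χ u then (1ℚ , q) else absent) (update-≢ i u≢v)
        by-cases : ∀ b → χ v ≡ b → Z adj w ≤ Z adj w′
        by-cases false eq = ℚ.≤-reflexive (Z-cong adj (λ u → sym (go u (u ≟ v))))
          where
          go : ∀ u → Dec (u ≡ v) → w′ u ≡ w u
          go u (yes refl) = trans (cong (λ b → if b then (1ℚ , (i [ v ≔ p ]) v) else absent) eq)
            (sym (cong (λ b → if b then (1ℚ , i v) else absent) eq))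
          go u (no u≢v)   = same u u≢v
        by-cases true eq = subst₂ _≤_ (sym w≡) (sym w′≡)
          (≤-from (*≥0 (sub≥0 iv≤p) (ℚ.<⇒≤ Z₂>0)) (identity (i v) p Z₁ Z₂))
          where
          Z₁ = Z adj (w [ v ≔ absent ])
          Z₂ = Z adj (kill adj v w [ v ≔ absent ])
          wv : w v ≡ (1ℚ , i v)
          wv = cong (λ b → if b then (1ℚ , i v) else absent) eq
          w′v : w′ v ≡ (1ℚ , p)
          w′v = trans (cong (λ b → if b then (1ℚ , (i [ v ≔ p ]) v) else absent) eq)
            (cong (1ℚ ,_) (update-≡ i v))
          w≡ : Z adj w ≡ 1ℚ * Z₁ + i v * Z₂
          w≡ = trans (Z-expand w v) (cong (λ q → proj₁ q * Z₁ + proj₂ q * Z₂) wv)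
          w′≡ : Z adj w′ ≡ 1ℚ * Z₁ + p * Z₂
          w′≡ = trans (Z-expand w′ v) (trans
            (cong (λ q → proj₁ q * Z adj (w′ [ v ≔ absent ])
                         + proj₂ q * Z adj (kill adj v w′ [ v ≔ absent ])) w′v)
            (cong₂ (λ x y → 1ℚ * x + p * y)
              (Z-cong adj (λ u → update-elim {P = _≡ (w [ v ≔ absent ]) u} w′ v u
                (λ { refl → sym (update-≡ w v) })
                (λ u≢v → trans (same u u≢v) (sym (update-≢ w u≢v)))))
              (Z-cong adj (λ u → update-elim {P = _≡ (kill adj v w [ v ≔ absent ]) u} (kill adj v w′) v u
                (λ { refl → sym (update-≡ (kill adj v w) v) })
                (λ u≢v → trans (cong (mask (adj v u)) (same u u≢v))
                  (sym (update-≢ (kill adj v w) u≢v)))))))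
          χ′ : Fin n → Bool
          χ′ = (λ u → χ u ∧ not (adj v u)) [ v ≔ false ]
          Z₂>0 : 0ℚ < Z₂
          Z₂>0 = subst (0ℚ <_) (Z-cong adj (λ u → go u (u ≟ v))) (sh χ′)
            where
            cases : ∀ u b b′ → (if b ∧ not b′ then (1ℚ , i u) else absent)
              ≡ mask b′ (if b then (1ℚ , i u) else absent)
            cases u true  true  = refl
            cases u true  false = refl
            cases u false true  = refl
            cases u false false = refl
            go : ∀ u → Dec (u ≡ v) → (unit i ∣ χ′) u ≡ (kill adj v w [ v ≔ absent ]) u
            go u (yes refl) = trans (cong (λ b → if b then (1ℚ , i u) else absent)
                (update-≡ (λ u → χ u ∧ not (adj v u)) v))
              (sym (update-≡ (kill adj v w) v))
            go u (no u≢v) = trans (cong (λ b → if b then (1ℚ , i u) else absent)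
                (update-≢ (λ u → χ u ∧ not (adj v u)) u≢v))
              (trans (cases u (χ u) (adj v u)) (sym (update-≢ (kill adj v w) u≢v)))
          identity = solve 4 (λ a p x y → (p :- a) :* y
            := (con 1ℚ :* x :+ p :* y) :- (con 1ℚ :* x :+ a :* y)) refl

    module _ {i i′ : Fin n → ℚ} (i≤i′ : ∀ u → i u ≤ i′ u) where

      private
        hybrid : List (Fin n) → Fin n → ℚ
        hybrid []       = i
        hybrid (u ∷ us) = hybrid us [ u ≔ i′ u ]

        hybrid≤ : ∀ us v → hybrid us v ≤ i′ v
        hybrid≤ []       v = i≤i′ v
        hybrid≤ (u ∷ us) v = update-elim {P = _≤ i′ v} (hybrid us) u v
          (λ { refl → ℚ.≤-refl }) (λ _ → hybrid≤ us v)

        hybrid-∈ : ∀ us v → v ∈ us → hybrid us v ≡ i′ v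
        hybrid-∈ (u ∷ us) v v∈ = update-elim {P = _≡ i′ v} (hybrid us) u v
          (λ { refl → refl }) (λ v≢u → hybrid-∈ us v (tail v≢u v∈))
          where
          tail : v ≢ u → v ∈ u ∷ us → v ∈ us
          tail v≢u (here v≡u) = ⊥-elim (v≢u v≡u)
          tail _   (there v∈) = v∈

        -- The weights are raised one vertex at a time. No value decreases in such a step, so
        -- Shearer's condition is again available for the next one.
        Z-hybrid : Shearer (unit i) → ∀ us χ → Z adj (unit i ∣ χ) ≤ Z adj (unit (hybrid us) ∣ χ)
        Z-hybrid sh []       χ = ℚ.≤-refl
        Z-hybrid sh (u ∷ us) χ = ℚ.≤-trans (Z-hybrid sh us χ)
          (Z-mono-step (λ χ → ℚ.<-≤-trans (sh χ) (Z-hybrid sh us χ)) (hybrid≤ us u) χ)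

      Z-mono : Shearer (unit i) → ∀ χ → Z adj (unit i ∣ χ) ≤ Z adj (unit i′ ∣ χ)
      Z-mono sh χ = subst (Z adj (unit i ∣ χ) ≤_)
        (Z-cong adj (λ u → cong (λ q → if χ u then (1ℚ , q) else absent)
          (hybrid-∈ (allFin n) u (∈-allFin u))))
        (Z-hybrid sh (allFin n) χ)

      Shearer-mono : Shearer (unit i) → Shearer (unit i′)
      Shearer-mono sh χ = ℚ.<-≤-trans (sh χ) (Z-mono sh χ)

    Z-absent : Z adj (λ _ → absent) ≡ 1ℚ
    Z-absent = go adj
      where
      identity : ∀ x → 1ℚ * 1ℚ + 0ℚ * x ≡ 1ℚ
      identity = solve 1 (λ x → con 1ℚ :* con 1ℚ :+ con 0ℚ :* x := con 1ℚ) refl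
      go : ∀ {m} (adj : AdjMatrix m) → Z adj (λ _ → absent) ≡ 1ℚ
      go {zero}  adj = refl
      go {suc m} adj = trans (cong (λ x → 1ℚ * x + 0ℚ * Z (tailAdj adj) (λ u → mask (adj zero (suc u)) absent)) (go (tailAdj adj)))
        (identity (Z (tailAdj adj) (λ u → mask (adj zero (suc u)) absent)))

    FirstOnly : Fin n → List (Fin n) → Set
    FirstOnly u []       = ⊤
    FirstOnly u (v ∷ vs) = adj u v ≡ true × All (λ x → adj u x ≡ false) vs

    LastOnly : Fin n → List (Fin n) → Set
    LastOnly u []           = ⊤
    LastOnly u (v ∷ [])     = adj u v ≡ true
    LastOnly u (v ∷ vs@(_ ∷ _)) = adj u v ≡ false × LastOnly u vs

    InducedPath : List (Fin n) → Set
    InducedPath []       = ⊤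
    InducedPath (u ∷ us) = u ∉ us × FirstOnly u us × InducedPath us

    private
      mask-absent : ∀ b → mask b absent ≡ absent
      mask-absent true  = refl
      mask-absent false = refl

      support-tail : ∀ (w : Fin n → Weight) {u us} → (∀ v → v ∉ u ∷ us → w v ≡ absent) →
        ∀ v → v ∉ us → (w [ u ≔ absent ]) v ≡ absent
      support-tail w {u} supp v v∉us = update-elim {P = _≡ absent} w u v (λ _ → refl)
        (λ v≢u → supp v λ { (here v≡u) → v≢u v≡u ; (there v∈us) → v∉us v∈us })

      support-kill : ∀ (w : Fin n → Weight) {u us} c → (∀ v → v ∉ u ∷ us → w v ≡ absent) →
        ∀ v → v ∉ us → (kill adj c w [ u ≔ absent ]) v ≡ absent
      support-kill w c supp = support-tail (kill adj c w)
        (λ v v∉ → trans (cong (mask (adj c v)) (supp v v∉)) (mask-absent (adj c v)))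

    Z-path : ∀ us (w : Fin n → Weight) → InducedPath us → (∀ v → v ∉ us → w v ≡ absent) →
      Z adj w ≡ proj₂ (transfers (map w us) (1ℚ , 1ℚ))
    Z-path []       w _ supp = trans (Z-cong adj (λ v → supp v λ ())) Z-absent
    Z-path (u ∷ us) w (u∉us , first , path) supp = trans (Z-expand w u)
      (cong₂ (λ x y → proj₁ (w u) * x + proj₂ (w u) * y)
        (trans (Z-path us (w [ u ≔ absent ]) path (support-tail w supp))
          (cong (λ ps → proj₂ (transfers ps (1ℚ , 1ℚ))) (map-update w us u∉us)))
        (trans (Z-path us (kill adj u w [ u ≔ absent ]) path (support-kill w u supp))
          (trans (cong (λ ps → proj₂ (transfers ps (1ℚ , 1ℚ))) (map-update (kill adj u w) us u∉us))
            (killed us first))))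
      where
      killed : ∀ us → FirstOnly u us →
        proj₂ (transfers (map (kill adj u w) us) (1ℚ , 1ℚ)) ≡ proj₁ (transfers (map w us) (1ℚ , 1ℚ))
      killed []       _             = refl
      killed (v ∷ vs) (u~v , rest) = trans
        (cong₂ (λ b ps → proj₂ (transfer (mask b (w v)) (transfers ps (1ℚ , 1ℚ)))) u~v
          (List.map-cong-local (All.map (λ {x} eq → cong (λ b → mask b (w x)) eq) rest)))
        (identity (proj₁ (w v)) (proj₂ (transfers (map w vs) (1ℚ , 1ℚ)))
          (proj₁ (transfers (map w vs) (1ℚ , 1ℚ))))
        where
        identity : ∀ o q p → o * q + 0ℚ * p ≡ o * q
        identity = solve 3 (λ o q p → o :* q :+ con 0ℚ :* p := o :* q) refl

    Z-vertex : ∀ (w : Fin n → Weight) v →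
      Z adj (w ∣ (λ u → does (u ≟ v))) ≡ proj₁ (w v) + proj₂ (w v)
    Z-vertex w v = trans
      (Z-path (v ∷ []) (w ∣ (λ u → does (u ≟ v))) ((λ ()) , tt , tt) (λ u u∉ →
        cong (λ b → if b then w u else absent) (dec-false (u ≟ v) (λ { refl → u∉ (here refl) }))))
      (trans (cong (λ p → proj₂ (transfer p (1ℚ , 1ℚ)))
               (cong (λ b → if b then w v else absent) (dec-true (v ≟ v) refl)))
        (identity (proj₁ (w v)) (proj₂ (w v))))
      where
      identity : ∀ o i → o * 1ℚ + i * 1ℚ ≡ o + i
      identity = solve 2 (λ o i → o :* con 1ℚ :+ i :* con 1ℚ := o :+ i) refl

    InducedRing : List (Fin n) → Set
    InducedRing []           = ⊤
    InducedRing (u ∷ [])     = ⊤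
    InducedRing (u ∷ v ∷ vs) = u ∉ v ∷ vs × adj u v ≡ true × LastOnly u vs × InducedPath (v ∷ vs)

    -- Expansion at `u`: outside the set it leaves a path; inside, it excludes the first vertex of
    -- that path, hence the first component, and the last one, hence the start (0 , 1).
    Z-ring : ∀ u v t vs (w : Fin n → Weight) → InducedRing (u ∷ v ∷ t ∷ vs) →
      (∀ x → x ∉ u ∷ v ∷ t ∷ vs → w x ≡ absent) →
      Z adj w ≡ ring-weight (map w (u ∷ v ∷ t ∷ vs))
    Z-ring u v t vs w (u∉ , u~v , last , path) supp = trans (Z-expand w u)
      (cong₂ (λ x y → proj₁ (w u) * x + proj₂ (w u) * y)
        (trans (Z-path us (w [ u ≔ absent ]) path (support-tail w supp))
          (cong (λ ps → proj₂ (transfers ps (1ℚ , 1ℚ))) (map-update w us u∉)))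
        (trans (Z-path us (kill adj u w [ u ≔ absent ]) path (support-kill w u supp))
          (trans (cong (λ ps → proj₂ (transfers ps (1ℚ , 1ℚ))) (map-update (kill adj u w) us u∉))
            (trans (cong₂ (λ b s → proj₂ (transfer (mask b (w v)) s)) u~v (killed t vs last))
              (identity (proj₁ (w v)) (proj₂ (transfers (map w (t ∷ vs)) (0ℚ , 1ℚ)))
                (proj₁ (transfers (map w (t ∷ vs)) (0ℚ , 1ℚ))))))))
      where
      us = v ∷ t ∷ vs
      identity : ∀ o q p → o * q + 0ℚ * p ≡ o * q
      identity = solve 3 (λ o q p → o :* q :+ con 0ℚ :* p := o :* q) refl
      killed : ∀ t vs → LastOnly u (t ∷ vs) →
        transfers (map (kill adj u w) (t ∷ vs)) (1ℚ , 1ℚ) ≡ transfers (map w (t ∷ vs)) (0ℚ , 1ℚ)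
      killed t []       u~t         = trans (cong (λ b → transfer (mask b (w t)) (1ℚ , 1ℚ)) u~t)
        (cong (proj₁ (w t) * 1ℚ ,_) (i (proj₁ (w t)) (proj₂ (w t))))
        where
        i : ∀ o i → o * 1ℚ + 0ℚ * 1ℚ ≡ o * 1ℚ + i * 0ℚ
        i = solve 2 (λ o i → o :* con 1ℚ :+ con 0ℚ :* con 1ℚ := o :* con 1ℚ :+ i :* con 0ℚ) refl
      killed t (x ∷ vs) (u≁t , last) = cong₂ (λ b s → transfer (mask b (w t)) s) u≁t (killed x vs last)

-- Roots by bisection at rational points

module Analysis where

  open import Data.Bool using (Bool; true; false; if_then_else_)
  open import Data.Empty using (⊥; ⊥-elim)
  open import Data.Fin using (Fin; zero; suc)
  open import Data.Fin.Subset.Properties using (anySubset?)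
  open import Data.Integer as ℤ using (+_; -[1+_])
  import Data.Integer.Properties as ℤ
  open import Data.Nat as ℕ using (ℕ; zero; suc)
  import Data.Nat.Properties as ℕ
  open import Data.List using ([]; _∷_)
  open import Data.Product using (∃-syntax; Σ-syntax; _×_; _,_; proj₁; proj₂)
  open import Data.Rational
  import Data.Rational.Properties as ℚ
  import Data.Rational.Unnormalised as ℚᵘ
  import Data.Rational.Unnormalised.Properties as ℚᵘ
  open import Data.Rational.Solver using (module +-*-Solver)
  open import Data.Sum using (_⊎_; inj₁; inj₂; [_,_]′)
  open import Data.Vec using (lookup; tabulate)
  open import Data.Vec.Properties using (lookup∘tabulate)
  open import Function using (_∘_)
  open import Relation.Nullary using (Dec; yes; no; ¬_)
  open import Relation.Binary.PropositionalEquality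
  open +-*-Solver using (solve; con; _:+_; _:*_; _:-_; :-_; _:=_)
  open Defs using (ℝ; mkℝ; seq; cauchy; Poly; eval; IsRoot)
  open Order
  open Weighted hiding (_∣_)

  evalℚ : Poly → ℚ → ℚ
  evalℚ []      x = + 0 / 1
  evalℚ (a ∷ p) x = + a / 1 + x * evalℚ p x

  seq-eval : ∀ p x m → seq (eval p x) m ≡ evalℚ p (seq x m)
  seq-eval []      x m = refl
  seq-eval (a ∷ p) x m = cong (λ y → + a / 1 + seq x m * y) (seq-eval p x m)

  suc/1 : ∀ k → + suc k / 1 ≡ 1ℚ + + k / 1
  suc/1 k = ℚ.toℚᵘ-injective (begin
    toℚᵘ (+ suc k / 1)               ≈⟨ ℚ.toℚᵘ-fromℚᵘ (ℚᵘ.mkℚᵘ (+ suc k) 0) ⟩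
    ℚᵘ.mkℚᵘ (+ suc k) 0              ≈⟨ ℚᵘ.*≡* (cong (λ j → (+ 1 ℤ.+ j) ℤ.* + 1) (sym (ℤ.*-identityʳ (+ k)))) ⟩
    ℚᵘ.1ℚᵘ ℚᵘ.+ ℚᵘ.mkℚᵘ (+ k) 0       ≈⟨ ℚᵘ.+-congʳ ℚᵘ.1ℚᵘ (ℚ.toℚᵘ-fromℚᵘ (ℚᵘ.mkℚᵘ (+ k) 0)) ⟨
    toℚᵘ 1ℚ ℚᵘ.+ toℚᵘ (+ k / 1)      ≈⟨ ℚ.toℚᵘ-homo-+ 1ℚ (+ k / 1) ⟨
    toℚᵘ (1ℚ + + k / 1)              ∎)
    where
    open ℚᵘ.≃-Reasoning

  archimedean : ∀ p → ∃[ k ] p ≤ + k / 1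
  archimedean p@(mkℚ i d _) = ℤ.∣ i ∣ , ℚ.toℚᵘ-cancel-≤ (ℚᵘ.≤-respʳ-≃
    (ℚᵘ.≃-sym (ℚ.toℚᵘ-fromℚᵘ (ℚᵘ.mkℚᵘ (+ ℤ.∣ i ∣) 0))) (ℚᵘ.*≤* (begin
      i ℤ.* + 1             ≡⟨ ℤ.*-identityʳ i ⟩
      i                     ≤⟨ i≤∣i∣ i ⟩
      + ℤ.∣ i ∣             ≤⟨ ℤ.+≤+ (ℕ.m≤m*n ℤ.∣ i ∣ (suc d)) ⟩
      + (ℤ.∣ i ∣ ℕ.* suc d) ≡⟨ ℤ.pos-* ℤ.∣ i ∣ (suc d) ⟩
      + ℤ.∣ i ∣ ℤ.* + suc d ∎)))
    where
    open ℤ.≤-Reasoning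
    i≤∣i∣ : ∀ i → i ℤ.≤ + ℤ.∣ i ∣
    i≤∣i∣ (+ k)      = ℤ.≤-refl
    i≤∣i∣ (-[1+ k ]) = ℤ.-≤+

  half^ : ℕ → ℚ
  half^ zero    = 1ℚ
  half^ (suc k) = ½ * half^ k

  0<½ : 0ℚ < ½
  0<½ = ℚ.positive⁻¹ ½

  half^>0 : ∀ k → 0ℚ < half^ k
  half^>0 zero    = 0<1
  half^>0 (suc k) = *>0 0<½ (half^>0 k)

  half^≤1 : ∀ k → half^ k ≤ 1ℚ
  half^≤1 zero    = ℚ.≤-refl
  half^≤1 (suc k) = ≤-from (+≥0 (*≥0 (ℚ.<⇒≤ 0<½) (sub≥0 (half^≤1 k))) (ℚ.<⇒≤ 0<½)) (i (half^ k))
    where i = solve 1 (λ h → con ½ :* (con 1ℚ :- h) :+ con ½ := con 1ℚ :- con ½ :* h) refl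

  k*half^<1 : ∀ k → (+ k / 1) * half^ k < 1ℚ
  k*half^<1 zero    = subst (_< 1ℚ) (sym (ℚ.*-zeroˡ 1ℚ)) 0<1
  k*half^<1 (suc k) = subst (λ c → c * half^ (suc k) < 1ℚ) (sym (suc/1 k))
    (<-from (+>0 (*>0 0<½ (sub>0 (k*half^<1 k))) (*≥0 (ℚ.<⇒≤ 0<½) (sub≥0 (half^≤1 k))))
      (i (+ k / 1) (half^ k)))
    where i = solve 2 (λ c h → con ½ :* (con 1ℚ :- c :* h) :+ con ½ :* (con 1ℚ :- h)
            := con 1ℚ :- (con 1ℚ :+ c) :* (con ½ :* h)) refl

  half^-mono : ∀ {j k} → j ℕ.≤ k → half^ k ≤ half^ j
  half^-mono {k = k}     ℕ.z≤n       = half^≤1 k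
  half^-mono {suc j} {suc k} (ℕ.s≤s j≤k) = ≤-from (*≥0 (ℚ.<⇒≤ 0<½) (sub≥0 (half^-mono j≤k)))
    (i (half^ j) (half^ k))
    where i = solve 2 (λ p q → con ½ :* (p :- q) := con ½ :* p :- con ½ :* q) refl

  half^-small : ∀ c {ε} → 0ℚ ≤ c → 0ℚ < ε → ∃[ N ] (∀ m → N ℕ.≤ m → c * half^ m < ε)
  half^-small c {ε} c≥0 0<ε = proj₁ bound , λ m N≤m → ℚ.≤-<-trans
    (≤-from (*≥0 c≥0 (sub≥0 (half^-mono N≤m))) (i₁ c (half^ (proj₁ bound)) (half^ m)))
    small
    where
    instance
      posε = positive 0<ε
      nzε  = ℚ.pos⇒nonZero ε
    bound = archimedean (c * 1/ ε)
    k = + proj₁ bound / 1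
    h = half^ (proj₁ bound)
    i₁ = solve 3 (λ c p q → c :* (p :- q) := c :* p :- c :* q) refl
    i₂ = solve 5 (λ c ε e k h → ε :* ((con 1ℚ :- k :* h) :+ (k :- c :* e) :* h)
      := ε :- (ε :* e) :* (c :* h)) refl
    small : c * h < ε
    small = <-from (*>0 0<ε (+>0 (sub>0 (k*half^<1 (proj₁ bound)))
                                 (*≥0 (sub≥0 (proj₂ bound)) (ℚ.<⇒≤ (half^>0 (proj₁ bound))))))
      (trans (i₂ c ε (1/ ε) k h)
        (trans (cong (λ e → ε - e * (c * h)) (ℚ.*-inverseʳ ε))
          (cong (λ e → ε - e) (ℚ.*-identityˡ (c * h)))))

  ≤-∣∣ : ∀ p → p ≤ ∣ p ∣
  ≤-∣∣ p = go (ℚ.≤-total 0ℚ p)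
    where
    go : _ → p ≤ ∣ p ∣
    go (inj₁ 0≤p) = ℚ.≤-reflexive (sym (ℚ.0≤p⇒∣p∣≡p 0≤p))
    go (inj₂ p≤0) = ℚ.≤-trans p≤0 (ℚ.0≤∣p∣ p)

  -- The number of vertex subsets, each of which contributes at most 1 in absolute value if the
  -- weights do.
  bound : ℕ → ℚ
  bound zero    = 1ℚ
  bound (suc n) = bound n + bound n

  lipschitz : ℕ → ℚ
  lipschitz zero    = 0ℚ
  lipschitz (suc n) = (lipschitz n + lipschitz n) + bound n

  bound≥0 : ∀ n → 0ℚ ≤ bound n
  bound≥0 zero    = 0≤1
  bound≥0 (suc n) = +≥0 (bound≥0 n) (bound≥0 n)

  lipschitz≥0 : ∀ n → 0ℚ ≤ lipschitz n
  lipschitz≥0 zero    = ℚ.≤-refl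
  lipschitz≥0 (suc n) = +≥0 (+≥0 (lipschitz≥0 n) (lipschitz≥0 n)) (bound≥0 n)

  private
    ∣∣-if : ∀ {ε} → 0ℚ ≤ ε → ∀ b p → ∣ p ∣ ≤ ε → ∣ (if b then 0ℚ else p) ∣ ≤ ε
    ∣∣-if 0≤ε true  p _  = 0≤ε
    ∣∣-if 0≤ε false p le = le

    ∣-∣-if : ∀ {ε} → 0ℚ ≤ ε → ∀ b p q → ∣ p - q ∣ ≤ ε →
      ∣ (if b then 0ℚ else p) - (if b then 0ℚ else q) ∣ ≤ ε
    ∣-∣-if 0≤ε true  p q _  = 0≤ε
    ∣-∣-if 0≤ε false p q le = le

    ∣∣-* : ∀ {p q a b} → 0ℚ ≤ a → ∣ p ∣ ≤ a → ∣ q ∣ ≤ b → ∣ p * q ∣ ≤ a * b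
    ∣∣-* {p} {q} {a} {b} 0≤a pa qb = subst (_≤ a * b) (sym (ℚ.∣p*q∣≡∣p∣*∣q∣ p q))
      (≤-from (+≥0 (*≥0 (sub≥0 pa) (ℚ.0≤∣p∣ q)) (*≥0 0≤a (sub≥0 qb))) (i a b ∣ p ∣ ∣ q ∣))
      where i = solve 4 (λ a b p q → (a :- p) :* q :+ a :* (b :- q) := a :* b :- p :* q) refl

    ∣∣-+ : ∀ {p q a b} → ∣ p ∣ ≤ a → ∣ q ∣ ≤ b → ∣ p + q ∣ ≤ a + b
    ∣∣-+ {p} {q} pa qb = ℚ.≤-trans (ℚ.∣p+q∣≤∣p∣+∣q∣ p q) (ℚ.+-mono-≤ pa qb)

  Z-bound : ∀ {n} (adj : AdjMatrix n) i → (∀ u → ∣ i u ∣ ≤ 1ℚ) → ∣ Z adj (unit i) ∣ ≤ bound n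
  Z-bound {zero}  adj i le = ℚ.≤-refl
  Z-bound {suc n} adj i le = subst (∣ Z adj (unit i) ∣ ≤_)
    (cong₂ _+_ (ℚ.*-identityˡ (bound n)) (ℚ.*-identityˡ (bound n)))
    (∣∣-+ (∣∣-* {1ℚ} {a = 1ℚ} 0≤1 ℚ.≤-refl (Z-bound (tailAdj adj) (i ∘ suc) (le ∘ suc)))
          (∣∣-* {i zero} {a = 1ℚ} 0≤1 (le zero) (Z-bound (tailAdj adj) (λ u → if adj zero (suc u) then 0ℚ else i (suc u))
            (λ u → ∣∣-if 0≤1 (adj zero (suc u)) (i (suc u)) (le (suc u))))))

  Z-lipschitz : ∀ {n} (adj : AdjMatrix n) i j {ε} → 0ℚ ≤ ε → (∀ u → ∣ i u ∣ ≤ 1ℚ) → (∀ u → ∣ j u ∣ ≤ 1ℚ) →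
    (∀ u → ∣ i u - j u ∣ ≤ ε) → ∣ Z adj (unit i) - Z adj (unit j) ∣ ≤ lipschitz n * ε
  Z-lipschitz {zero}  adj i j {ε} 0≤ε _ _ _ = ℚ.≤-reflexive (sym (ℚ.*-zeroˡ ε))
  Z-lipschitz {suc n} adj i j {ε} 0≤ε il jl ij = subst₂ _≤_
    (cong ∣_∣ (split (i zero) (j zero) X X′ Y Y′)) (collect (lipschitz n) (bound n) ε)
    (∣∣-+ (∣∣-+ (Z-lipschitz (tailAdj adj) (i ∘ suc) (j ∘ suc) 0≤ε (il ∘ suc) (jl ∘ suc) (ij ∘ suc))
                (∣∣-* {i zero} {a = 1ℚ} 0≤1 (il zero) (Z-lipschitz (tailAdj adj) i′ j′ 0≤ε il′ jl′
                  (λ u → ∣-∣-if 0≤ε (adj zero (suc u)) (i (suc u)) (j (suc u)) (ij (suc u))))))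
          (∣∣-* 0≤ε (ij zero) (Z-bound (tailAdj adj) j′ jl′)))
    where
    i′ j′ : Fin n → ℚ
    i′ u = if adj zero (suc u) then 0ℚ else i (suc u)
    j′ u = if adj zero (suc u) then 0ℚ else j (suc u)
    il′ : ∀ u → ∣ i′ u ∣ ≤ 1ℚ
    il′ u = ∣∣-if 0≤1 (adj zero (suc u)) (i (suc u)) (il (suc u))
    jl′ : ∀ u → ∣ j′ u ∣ ≤ 1ℚ
    jl′ u = ∣∣-if 0≤1 (adj zero (suc u)) (j (suc u)) (jl (suc u))
    X  = Z (tailAdj adj) (unit (i ∘ suc))
    X′ = Z (tailAdj adj) (unit (j ∘ suc))
    Y  = Z (tailAdj adj) (unit i′)
    Y′ = Z (tailAdj adj) (unit j′)
    split = solve 6 (λ i j X X′ Y Y′ → (X :- X′) :+ i :* (Y :- Y′) :+ (i :- j) :* Y′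
      := (con 1ℚ :* X :+ i :* Y) :- (con 1ℚ :* X′ :+ j :* Y′)) refl
    collect = solve 3 (λ L M ε → L :* ε :+ con 1ℚ :* (L :* ε) :+ ε :* M := (L :+ L :+ M) :* ε) refl

  module Roots {n} (adj : AdjMatrix n) (symm : ∀ u v → adj u v ≡ adj v u) where

    const-unit : ℚ → Fin n → Weight
    const-unit x = unit (λ _ → x)

    poly : ℚ → ℚ
    poly x = Z adj (const-unit x)

    Positive-at : ℚ → Set
    Positive-at x = Shearer adj symm (const-unit x)

    private
      _∣_′ : ℚ → (Fin n → Bool) → Fin n → Weight
      x ∣ χ ′ = Weighted._∣_ adj symm (const-unit x) χ

      as-unit : ∀ x χ u → (x ∣ χ ′) u ≡ unit (λ u → if χ u then x else 0ℚ) u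
      as-unit x χ u = go (χ u)
        where
        go : ∀ b → (if b then (1ℚ , x) else absent) ≡ (1ℚ , (if b then x else 0ℚ))
        go true  = refl
        go false = refl

    positive-at-0 : Positive-at 0ℚ
    positive-at-0 χ = subst (0ℚ <_) (sym (trans (Z-cong adj (λ u → go (χ u))) (Z-absent adj symm))) 0<1
      where
      go : ∀ b → (if b then (1ℚ , 0ℚ) else absent) ≡ absent
      go true  = refl
      go false = refl

    poly-mono : ∀ {x y} → Positive-at x → x ≤ y → poly x ≤ poly y
    poly-mono pos x≤y = Z-mono adj symm (λ _ → x≤y) pos (λ _ → true)

    positive-mono : ∀ {x y} → Positive-at x → x ≤ y → Positive-at y
    positive-mono pos x≤y = Shearer-mono adj symm (λ _ → x≤y) pos

    -- Leaving a vertex out amounts to raising its weight from x ≤ 0 to 0.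
    poly≤restricted : ∀ {x} χ → x ≤ 0ℚ → Positive-at x → poly x ≤ Z adj (x ∣ χ ′)
    poly≤restricted {x} χ x≤0 pos = subst (poly x ≤_)
      (sym (Z-cong adj (as-unit x χ)))
      (Z-mono adj symm (λ u → go (χ u)) pos (λ _ → true))
      where
      go : ∀ b → x ≤ (if b then x else 0ℚ)
      go true  = ℚ.≤-refl
      go false = x≤0

    NonPositive-at : ℚ → Set
    NonPositive-at x = ∃[ χ ] Z adj (x ∣ χ ′) ≤ 0ℚ

    -- The induced subgraphs are finitely many and their values rational; this decision is what
    -- bisection runs on.
    decide : ∀ x → Positive-at x ⊎ NonPositive-at x
    decide x = go (anySubset? λ S → Z adj (x ∣ lookup S ′) ℚ.≤? 0ℚ)
      where
      go : Dec (∃[ S ] Z adj (x ∣ lookup S ′) ≤ 0ℚ) → Positive-at x ⊎ NonPositive-at x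
      go (yes (S , le)) = inj₂ (lookup S , le)
      go (no none)      = inj₁ λ χ → ℚ.≰⇒> λ le → none (tabulate χ ,
        subst (_≤ 0ℚ) (Z-cong adj λ u → cong (λ b → if b then (1ℚ , x) else absent)
          (sym (lookup∘tabulate χ u))) le)

    -- Some induced subgraph has a value ≤ 0 at `a`, so at `b` its value is small by the Lipschitz
    -- bound, and the whole graph lies below it there. Hence the limit of the bisection is a root of
    -- the whole polynomial, whichever subgraph fails.
    poly-small : ∀ {a b} → - 1ℚ ≤ a → a ≤ b → b ≤ 0ℚ → NonPositive-at a → Positive-at b →
      poly b ≤ lipschitz n * (b - a)
    poly-small {a} {b} -1≤a a≤b b≤0 (χ , le) pos = ℚ.≤-trans (poly≤restricted χ b≤0 pos) (begin
      Zb              ≤⟨ ≤-from (sub≥0 le) (i Za Zb) ⟩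
      Zb - Za         ≤⟨ ≤-∣∣ (Zb - Za) ⟩
      ∣ Zb - Za ∣     ≤⟨ subst₂ (λ p q → ∣ p - q ∣ ≤ lipschitz n * (b - a))
                           (sym (Z-cong adj (as-unit b χ))) (sym (Z-cong adj (as-unit a χ)))
                           (Z-lipschitz adj (λ u → if χ u then b else 0ℚ) (λ u → if χ u then a else 0ℚ)
                             (sub≥0 a≤b) (λ u → small b -1≤b b≤0 (χ u))
                             (λ u → small a -1≤a (ℚ.≤-trans a≤b b≤0) (χ u)) (λ u → close (χ u))) ⟩
      lipschitz n * (b - a) ∎)
      where
      open ℚ.≤-Reasoning
      Zb = Z adj (b ∣ χ ′)
      Za = Z adj (a ∣ χ ′)
      -1≤b = ℚ.≤-trans -1≤a a≤b
      i = solve 2 (λ p q → con 0ℚ :- p := (q :- p) :- q) refl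
      small : ∀ c → - 1ℚ ≤ c → c ≤ 0ℚ → ∀ t → ∣ (if t then c else 0ℚ) ∣ ≤ 1ℚ
      small c -1≤c c≤0 false = 0≤1
      small c -1≤c c≤0 true  = subst (_≤ 1ℚ) (trans (sym (ℚ.0≤p⇒∣p∣≡p (ℚ.neg-antimono-≤ c≤0))) (ℚ.∣-p∣≡∣p∣ c))
        (ℚ.neg-antimono-≤ -1≤c)
      close : ∀ t → ∣ (if t then b else 0ℚ) - (if t then a else 0ℚ) ∣ ≤ b - a
      close false = sub≥0 a≤b
      close true  = ℚ.≤-reflexive (ℚ.0≤p⇒∣p∣≡p (sub≥0 a≤b))

    module Bisection {r} (-1≤r : - 1ℚ ≤ r) (r≤0 : r ≤ 0ℚ) (nonPos : NonPositive-at r) where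

      record Bracket (w : ℚ) : Set where
        field
          low high : ℚ
          r≤low    : r ≤ low
          low≤high : low ≤ high
          high≤0   : high ≤ 0ℚ
          width    : high - low ≡ w
          low-non  : NonPositive-at low
          high-pos : Positive-at high

      open Bracket

      halve : ∀ {w} (B : Bracket w) → Σ[ B′ ∈ Bracket (½ * w) ] low B ≤ low B′ × high B′ ≤ high B
      halve {w} B = go (decide mid)
        where
        mid = ½ * (low B + high B)
        i₁ = solve 2 (λ a b → con ½ :* (b :- a) := con ½ :* (a :+ b) :- a) refl
        i₂ = solve 2 (λ a b → con ½ :* (b :- a) := b :- con ½ :* (a :+ b)) refl
        half≥0 = *≥0 (ℚ.<⇒≤ 0<½) (sub≥0 (low≤high B))
        low≤mid : low B ≤ mid
        low≤mid = ≤-from half≥0 (i₁ (low B) (high B))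
        mid≤high : mid ≤ high B
        mid≤high = ≤-from half≥0 (i₂ (low B) (high B))
        go : Positive-at mid ⊎ NonPositive-at mid →
          Σ[ B′ ∈ Bracket (½ * w) ] low B ≤ low B′ × high B′ ≤ high B
        go (inj₁ pos) = record
          { low = low B ; high = mid ; r≤low = r≤low B ; low≤high = low≤mid
          ; high≤0 = ℚ.≤-trans mid≤high (high≤0 B)
          ; width = trans (sym (i₁ (low B) (high B))) (cong (½ *_) (width B))
          ; low-non = low-non B ; high-pos = pos } , ℚ.≤-refl , mid≤high
        go (inj₂ non) = record
          { low = mid ; high = high B ; r≤low = ℚ.≤-trans (r≤low B) low≤mid ; low≤high = mid≤high
          ; high≤0 = high≤0 B
          ; width = trans (sym (i₂ (low B) (high B))) (cong (½ *_) (width B))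
          ; low-non = non ; high-pos = high-pos B } , low≤mid , ℚ.≤-refl

      widths : ℕ → ℚ
      widths zero    = 0ℚ - r
      widths (suc m) = ½ * widths m

      widths≡ : ∀ m → widths m ≡ (0ℚ - r) * half^ m
      widths≡ zero    = sym (ℚ.*-identityʳ (0ℚ - r))
      widths≡ (suc m) = trans (cong (½ *_) (widths≡ m)) (i (0ℚ - r) (half^ m))
        where i = solve 2 (λ w h → con ½ :* (w :* h) := w :* (con ½ :* h)) refl

      bracket : ∀ m → Bracket (widths m)
      bracket zero = record
        { low = r ; high = 0ℚ ; r≤low = ℚ.≤-refl ; low≤high = r≤0 ; high≤0 = ℚ.≤-refl
        ; width = refl ; low-non = nonPos ; high-pos = positive-at-0 }
      bracket (suc m) = proj₁ (halve (bracket m))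

      nested : ∀ m k → low (bracket m) ≤ low (bracket (k ℕ.+ m)) × high (bracket (k ℕ.+ m)) ≤ high (bracket m)
      nested m zero    = ℚ.≤-refl , ℚ.≤-refl
      nested m (suc k) = ℚ.≤-trans (proj₁ (nested m k)) (proj₁ (proj₂ halved))
                       , ℚ.≤-trans (proj₂ (proj₂ halved)) (proj₂ (nested m k))
        where halved = halve (bracket (k ℕ.+ m))

      -- Upper ends are taken because Shearer's condition holds there, so that `poly` is positive at
      -- all these points and `poly-small` applies.
      point : ℕ → ℚ
      point m = high (bracket m)

      in-bracket : ∀ {N m} → N ℕ.≤ m → low (bracket N) ≤ point m × point m ≤ point N
      in-bracket {N} {m} N≤m = subst (λ m → low (bracket N) ≤ point m × point m ≤ point N)
        (ℕ.m∸n+n≡m N≤m)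
        (ℚ.≤-trans (proj₁ (nested N (m ℕ.∸ N))) (low≤high (bracket (m ℕ.∸ N ℕ.+ N)))
        , proj₂ (nested N (m ℕ.∸ N)))

      point-close : ∀ {N m k} → N ℕ.≤ m → N ℕ.≤ k → ∣ point m - point k ∣ ≤ widths N
      point-close {N} {m} {k} N≤m N≤k = go (ℚ.≤-total (point k) (point m))
        where
        i = solve 4 (λ l h p q → (h :- p) :+ (q :- l) := (h :- l) :- (p :- q)) refl
        i′ = solve 2 (λ p q → :- (p :- q) := q :- p) refl
        diff≤ : ∀ {m k} → N ℕ.≤ m → N ℕ.≤ k → point m - point k ≤ widths N
        diff≤ {m} {k} N≤m N≤k = subst (point m - point k ≤_) (width (bracket N))
          (≤-from (+≥0 (sub≥0 (proj₂ (in-bracket N≤m))) (sub≥0 (proj₁ (in-bracket N≤k))))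
            (i (low (bracket N)) (point N) (point m) (point k)))
        go : _ → ∣ point m - point k ∣ ≤ widths N
        go (inj₁ k≤m) = subst (_≤ widths N) (sym (ℚ.0≤p⇒∣p∣≡p (sub≥0 k≤m))) (diff≤ N≤m N≤k)
        go (inj₂ m≤k) = subst (_≤ widths N)
          (trans (sym (ℚ.0≤p⇒∣p∣≡p (sub≥0 m≤k)))
            (trans (cong ∣_∣ (sym (i′ (point m) (point k)))) (ℚ.∣-p∣≡∣p∣ (point m - point k))))
          (diff≤ N≤k N≤m)

      poly-point : ∀ m → poly (point m) ≤ lipschitz n * widths m
      poly-point m = subst (λ w → poly (point m) ≤ lipschitz n * w) (width (bracket m))
        (poly-small (ℚ.≤-trans -1≤r (r≤low (bracket m))) (low≤high (bracket m)) (high≤0 (bracket m))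
          (low-non (bracket m)) (high-pos (bracket m)))

      widths-small : ∀ c {ε} → 0ℚ ≤ c → 0ℚ < ε → ∃[ N ] (∀ m → N ℕ.≤ m → c * widths m < ε)
      widths-small c c≥0 0<ε = proj₁ small , λ m N≤m → subst (_< _)
        (trans (ℚ.*-assoc c (0ℚ - r) (half^ m)) (cong (c *_) (sym (widths≡ m)))) (proj₂ small m N≤m)
        where small = half^-small (c * (0ℚ - r)) (*≥0 c≥0 (sub≥0 r≤0)) 0<ε

      limit : ℝ
      limit = mkℝ point λ ε 0<ε → let (N , small) = widths-small 1ℚ 0≤1 0<ε in
        N , λ m k N≤m N≤k → ℚ.≤-<-trans (point-close N≤m N≤k)
          (subst (_< ε) (ℚ.*-identityˡ (widths N)) (small N ℕ.≤-refl))

      limit-root : ∀ P → (∀ x → evalℚ P x ≡ poly x) → IsRoot P limit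
      limit-root P P≡ ε 0<ε = let (N , small) = widths-small (lipschitz n) (lipschitz≥0 n) 0<ε in
        N , λ m N≤m → subst (_< ε)
          (sym (trans (cong (λ p → ∣ p - + 0 / 1 ∣) (trans (seq-eval P limit m) (P≡ (point m))))
            (trans (cong ∣_∣ (ℚ.+-identityʳ (poly (point m))))
              (ℚ.0≤p⇒∣p∣≡p (ℚ.<⇒≤ (Shearer⇒Z>0 adj symm (high-pos (bracket m))))))))
          (ℚ.≤-<-trans (poly-point m) (small m N≤m))

      r≤limit : ∀ m → r ≤ seq limit m
      r≤limit m = ℚ.≤-trans (r≤low (bracket m)) (low≤high (bracket m))

      -- Positivity cannot break off while `poly` is bounded away from 0; this is used to carry
      -- positivity from one graph over to another.
      small-positive : ∀ {δ} → 0ℚ < δ → ∃[ b ] r ≤ b × b ≤ 0ℚ × Positive-at b × poly b < δ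
      small-positive 0<δ = let (N , small) = widths-small (lipschitz n) (lipschitz≥0 n) 0<δ in
        point N , r≤limit N , high≤0 (bracket N) , high-pos (bracket N)
        , ℚ.≤-<-trans (poly-point N) (small N ℕ.≤-refl)

  private
    near : ∀ p q {η} → ∣ p - q ∣ < η → p < q + η
    near p q {η} lt = <-from (sub>0 (ℚ.≤-<-trans (≤-∣∣ (p - q)) lt)) (i p q η)
      where i = solve 3 (λ p q η → η :- (p :- q) := (q :+ η) :- p) refl

  -- It is enough to refute that a rational separates y from a larger x. The only case distinction
  -- is one comparison of rationals, at an index from which both sequences vary by less than η.
  ≤-by-gap : ∀ x y → (∀ r δ M → 0ℚ < δ → (∀ m → M ℕ.≤ m → seq y m + δ < r × r < seq x m) → ⊥) →
    x Defs.≤ y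
  ≤-by-gap x y gap ε 0<ε = go (xM ℚ.<? yM + (η + η + η + η))
    where
    -- In the first case the gap takes four η and the two Cauchy errors one each, and two of the
    -- eight η are to spare. In the second case r lies two η above yM, which leaves a margin on
    -- either side.
    η = ½ * (½ * (½ * ε))
    0<η : 0ℚ < η
    0<η = *>0 0<½ (*>0 0<½ (*>0 0<½ 0<ε))
    cx = cauchy x η 0<η
    cy = cauchy y η 0<η
    M  = proj₁ cx ℕ.⊔ proj₁ cy
    xM = seq x M
    yM = seq y M
    Mx : ∀ {m} → M ℕ.≤ m → proj₁ cx ℕ.≤ m
    Mx = ℕ.m⊔n≤o⇒m≤o (proj₁ cx) (proj₁ cy)
    My : ∀ {m} → M ℕ.≤ m → proj₁ cy ℕ.≤ m
    My = ℕ.m⊔n≤o⇒n≤o (proj₁ cx) (proj₁ cy)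
    go : Dec (xM < yM + (η + η + η + η)) → ∃[ N ] (∀ m → N ℕ.≤ m → seq x m < seq y m + ε)
    go (yes lt) = M , λ m M≤m → <-from
      (+>0 (+>0 (+>0 (sub>0 lt) (ℚ.<⇒≤ (sub>0 (near (seq x m) xM (proj₂ cx m M (Mx M≤m) (Mx ℕ.≤-refl))))))
                (ℚ.<⇒≤ (sub>0 (near yM (seq y m) (proj₂ cy M m (My ℕ.≤-refl) (My M≤m))))))
           (ℚ.<⇒≤ (+>0 0<η (ℚ.<⇒≤ 0<η))))
      (i (seq x m) xM (seq y m) yM ε)
      where
      i = solve 5 (λ x xM y yM ε → let η = con ½ :* (con ½ :* (con ½ :* ε)) in
        (yM :+ (η :+ η :+ η :+ η) :- xM) :+ (xM :+ η :- x) :+ (y :+ η :- yM) :+ (η :+ η)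
        := (y :+ ε) :- x) refl
    go (no ≮) = ⊥-elim (gap (yM + (η + η)) η M 0<η λ m M≤m →
      <-from (sub>0 (near (seq y m) yM (proj₂ cy m M (My M≤m) (My ℕ.≤-refl)))) (i₁ (seq y m) yM η)
      , <-from (+>0 (+>0 (sub>0 (near xM (seq x m) (proj₂ cx M m (Mx ℕ.≤-refl) (Mx M≤m)))) (sub≥0 (ℚ.≮⇒≥ ≮)))
                    (ℚ.<⇒≤ 0<η))
          (i₂ (seq x m) xM yM η))
      where
      i₁ = solve 3 (λ y yM η → yM :+ η :- y := (yM :+ (η :+ η)) :- (y :+ η)) refl
      i₂ = solve 4 (λ x xM yM η → (x :+ η :- xM) :+ (xM :- (yM :+ (η :+ η :+ η :+ η))) :+ η
        := x :- (yM :+ (η :+ η))) refl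

  module _ {n} (adj : AdjMatrix n) (symm : ∀ u v → adj u v ≡ adj v u) where
    open Roots adj symm

    -- Suppose that a rational r separated y from a larger x. If Shearer's condition fails at r,
    -- bisection gives a root of P at or above r and so above y. If it holds, `lower` keeps Q away
    -- from 0 beyond r, and x is no root.
    root≤-by-bound : ∀ P Q {x y} → IsRoot Q x → (∀ τ → IsRoot P τ → τ Defs.≤ y) →
      (∀ q → evalℚ P q ≡ poly q) → NonPositive-at (- 1ℚ) →
      (∀ r → - 1ℚ < r → r ≤ 0ℚ → Positive-at r →
        ∃[ δ ] 0ℚ < δ × (∀ q → r ≤ q → δ ≤ evalℚ Q q)) →
      x Defs.≤ y
    root≤-by-bound P Q {x} {y} x-root y-max P≡ non lower = ≤-by-gap x y gap
      where
      gap : ∀ r δ M → 0ℚ < δ → (∀ m → M ℕ.≤ m → seq y m + δ < r × r < seq x m) → ⊥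
      gap r δ M 0<δ sep = cases (r ℚ.≤? - 1ℚ) (r ℚ.≤? 0ℚ)
        where
        absurd-root : ∀ {s} → - 1ℚ ≤ s → s ≤ 0ℚ → r ≤ s → NonPositive-at s → ⊥
        absurd-root -1≤s s≤0 r≤s non =
          let
            N , below = y-max limit (limit-root P P≡) δ 0<δ
            k = M ℕ.⊔ N
          in ℚ.<-irrefl refl (ℚ.<-trans (below k (ℕ.m≤n⊔m M N))
               (ℚ.<-≤-trans (proj₁ (sep k (ℕ.m≤m⊔n M N))) (ℚ.≤-trans r≤s (r≤limit k))))
          where open Bisection -1≤s s≤0 non
        absurd-bound : ∀ {s} → s ≤ r → - 1ℚ < s → s ≤ 0ℚ → Positive-at s → ⊥
        absurd-bound s≤r -1<s s≤0 pos =
          let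
            η , 0<η , η≤ = lower _ -1<s s≤0 pos
            N , small = x-root η 0<η
            k = M ℕ.⊔ N
            value = ℚ.≤-trans (η≤ (seq x k) (ℚ.≤-trans s≤r (ℚ.<⇒≤ (proj₂ (sep k (ℕ.m≤m⊔n M N))))))
              (ℚ.≤-trans (≤-∣∣ (evalℚ Q (seq x k)))
                (ℚ.≤-reflexive (cong ∣_∣ (sym (ℚ.+-identityʳ (evalℚ Q (seq x k)))))))
          in ℚ.<-irrefl refl (ℚ.≤-<-trans value
               (subst (λ p → ∣ p - 0ℚ ∣ < η) (seq-eval Q x k) (small k (ℕ.m≤n⊔m M N))))
        -- A point outside the interval is replaced by its nearer end: the condition fails at -1 and
        -- holds at 0.
        cases : Dec (r ≤ - 1ℚ) → Dec (r ≤ 0ℚ) → ⊥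
        cases (yes r≤-1) _         = absurd-root ℚ.≤-refl (ℚ.<⇒≤ (ℚ.negative⁻¹ (- 1ℚ))) r≤-1 non
        cases (no _)     (no r≰0)  = absurd-bound (ℚ.<⇒≤ (ℚ.≰⇒> r≰0)) (ℚ.negative⁻¹ (- 1ℚ)) ℚ.≤-refl positive-at-0
        cases (no r≰-1)  (yes r≤0) = [ absurd-bound ℚ.≤-refl (ℚ.≰⇒> r≰-1) r≤0
                                     , absurd-root (ℚ.<⇒≤ (ℚ.≰⇒> r≰-1)) r≤0 ℚ.≤-refl ]′ (decide r)

  module _ {m n} (adj₁ : AdjMatrix m) (symm₁ : ∀ u v → adj₁ u v ≡ adj₁ v u)
                 (adj₂ : AdjMatrix n) (symm₂ : ∀ u v → adj₂ u v ≡ adj₂ v u) where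
    private
      module R₁ = Roots adj₁ symm₁
      module R₂ = Roots adj₂ symm₂

    poly-at-0 : R₁.poly 0ℚ ≡ R₂.poly 0ℚ
    poly-at-0 = trans (Z-absent adj₁ symm₁) (sym (Z-absent adj₂ symm₂))

    -- The inequality `le` presupposes positivity of the graph of P. This is the case in question at
    -- r, and it persists for all larger arguments, where `poly` only grows.
    root≤-by-positivity₂ : ∀ P Q {x y} → IsRoot Q x → (∀ τ → IsRoot P τ → τ Defs.≤ y) →
      (∀ q → evalℚ P q ≡ R₂.poly q) → (∀ q → evalℚ Q q ≡ R₁.poly q) → R₂.NonPositive-at (- 1ℚ) →
      (∀ r → - 1ℚ < r → r ≤ 0ℚ → R₂.Positive-at r → R₂.poly r ≤ R₁.poly r) → x Defs.≤ y
    root≤-by-positivity₂ P Q {x} {y} x-root y-max P≡ Q≡ non le =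
      root≤-by-bound adj₂ symm₂ P Q {x} {y} x-root y-max P≡ non λ r -1<r r≤0 pos →
        R₂.poly r , Shearer⇒Z>0 adj₂ symm₂ pos , λ q r≤q →
        subst (R₂.poly r ≤_) (sym (Q≡ q)) ([ (λ q≤0 → ℚ.≤-trans (R₂.poly-mono pos r≤q)
            (le q (ℚ.<-≤-trans -1<r r≤q) q≤0 (R₂.positive-mono pos r≤q)))
        , (λ 0≤q → ℚ.≤-trans (R₂.poly-mono pos r≤0)
            (ℚ.≤-trans (ℚ.≤-reflexive (sym poly-at-0)) (R₁.poly-mono R₁.positive-at-0 0≤q))) ]′ (ℚ.≤-total q 0ℚ))

    -- Here `le` presupposes positivity of the graph of Q. If that failed at r, there would be a
    -- point b between r and 0 where it holds, with the value of Q at b below the value of P at r.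
    -- But P does not decrease from r to b and lies below Q at b.
    root≤-by-positivity₁ : ∀ P Q {x y} → IsRoot Q x → (∀ τ → IsRoot P τ → τ Defs.≤ y) →
      (∀ q → evalℚ P q ≡ R₂.poly q) → (∀ q → evalℚ Q q ≡ R₁.poly q) → R₂.NonPositive-at (- 1ℚ) →
      (∀ r → - 1ℚ < r → r ≤ 0ℚ → R₁.Positive-at r → R₂.poly r ≤ R₁.poly r) → x Defs.≤ y
    root≤-by-positivity₁ P Q {x} {y} x-root y-max P≡ Q≡ non le =
      root≤-by-bound adj₂ symm₂ P Q {x} {y} x-root y-max P≡ non λ r -1<r r≤0 pos →
        let pos₁ = continued -1<r r≤0 pos (R₁.decide r)
        in R₁.poly r , Shearer⇒Z>0 adj₁ symm₁ pos₁ , λ q r≤q →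
             subst (R₁.poly r ≤_) (sym (Q≡ q)) (R₁.poly-mono pos₁ r≤q)
      where
      continued : ∀ {r} → - 1ℚ < r → r ≤ 0ℚ → R₂.Positive-at r →
        R₁.Positive-at r ⊎ R₁.NonPositive-at r → R₁.Positive-at r
      continued -1<r r≤0 pos (inj₁ pos₁) = pos₁
      continued -1<r r≤0 pos (inj₂ non₁) =
        let b , r≤b , b≤0 , pos-b , small = small-positive (Shearer⇒Z>0 adj₂ symm₂ pos)
        in ⊥-elim (ℚ.<-irrefl refl (ℚ.<-≤-trans small
             (ℚ.≤-trans (R₂.poly-mono pos r≤b) (le b (ℚ.<-≤-trans -1<r r≤b) b≤0 pos-b))))
        where open R₁.Bisection (ℚ.<⇒≤ -1<r) r≤0 non₁

-- From coefficient lists to weighted polynomials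

module PolyLink where

  open import Data.Bool using (Bool; true; false; if_then_else_; _∧_; not)
  open import Data.Fin using (Fin; zero; suc)
  open import Data.Fin.Subset using (Subset; _∈_) renaming (∣_∣ to card)
  open import Data.Fin.Subset.Properties using (∣p∣≤n)
  open import Data.Integer using () renaming (+_ to int)
  open import Data.Nat as ℕ using (ℕ; zero; suc)
  import Data.Nat.Properties as ℕ
  open import Data.List using (List; []; _∷_; _++_; map; filter; length; applyUpTo)
  open import Data.Product using (_×_; _,_; proj₁; proj₂)
  open import Data.Rational hiding (_≟_)
  import Data.Rational.Properties as ℚ
  open import Data.Rational.Solver using (module +-*-Solver)
  open import Data.Vec using ([]; _∷_; here; there)
  open import Function using (_∘_)
  open import Relation.Nullary using (Dec; yes; no; does; ¬_)
  open import Relation.Nullary.Decidable using (dec-true; dec-false; _×-dec_)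
  open import Relation.Unary using (Decidable)
  open import Relation.Binary.PropositionalEquality
  open +-*-Solver using (solve; con; _:+_; _:*_; _:-_; :-_; _:=_)
  open Defs using (Graph; adj?; Adj; irrefl; symm; independent?; subsets; indepPoly)
  open Order
  open Weighted hiding (_∣_)
  open Analysis

  private variable
    n : ℕ

  _^_ : ℚ → ℕ → ℚ
  x ^ zero  = 1ℚ
  x ^ suc k = x * x ^ k

  sumOver : {A : Set} → (A → ℚ) → List A → ℚ
  sumOver f []       = 0ℚ
  sumOver f (a ∷ as) = f a + sumOver f as

  sumOver-cong : {A : Set} {f g : A → ℚ} → (∀ a → f a ≡ g a) → ∀ as → sumOver f as ≡ sumOver g as
  sumOver-cong eq []       = refl
  sumOver-cong eq (a ∷ as) = cong₂ _+_ (eq a) (sumOver-cong eq as)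

  sumOver-++ : {A : Set} (f : A → ℚ) → ∀ as bs → sumOver f (as ++ bs) ≡ sumOver f as + sumOver f bs
  sumOver-++ f []       bs = sym (ℚ.+-identityˡ (sumOver f bs))
  sumOver-++ f (a ∷ as) bs = trans (cong (f a +_) (sumOver-++ f as bs))
    (sym (ℚ.+-assoc (f a) (sumOver f as) (sumOver f bs)))

  sumOver-map : {A B : Set} (f : B → ℚ) (g : A → B) → ∀ as → sumOver f (map g as) ≡ sumOver (f ∘ g) as
  sumOver-map f g []       = refl
  sumOver-map f g (a ∷ as) = cong (f (g a) +_) (sumOver-map f g as)

  sumOver-* : {A : Set} (c : ℚ) (f : A → ℚ) → ∀ as → sumOver (λ a → c * f a) as ≡ c * sumOver f as
  sumOver-* c f []       = sym (ℚ.*-zeroʳ c)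
  sumOver-* c f (a ∷ as) = trans (cong (c * f a +_) (sumOver-* c f as))
    (sym (ℚ.*-distribˡ-+ c (f a) (sumOver f as)))

  +/1 : ∀ a b → int (a ℕ.+ b) / 1 ≡ int a / 1 + int b / 1
  +/1 zero    b = sym (ℚ.+-identityˡ (int b / 1))
  +/1 (suc a) b = trans (suc/1 (a ℕ.+ b)) (trans (cong (1ℚ +_) (+/1 a b))
    (trans (sym (ℚ.+-assoc 1ℚ (int a / 1) (int b / 1))) (cong (_+ int b / 1) (sym (suc/1 a)))))

  evalℚ-+ : ∀ {f g h : ℕ → ℕ} → (∀ k → f k ≡ g k ℕ.+ h k) → ∀ m x →
    evalℚ (applyUpTo f m) x ≡ evalℚ (applyUpTo g m) x + evalℚ (applyUpTo h m) x
  evalℚ-+ eq zero    x = refl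
  evalℚ-+ {f} {g} {h} eq (suc m) x = trans
    (cong₂ (λ a b → a + x * b) (trans (cong (λ k → int k / 1) (eq 0)) (+/1 (g 0) (h 0)))
      (evalℚ-+ (eq ∘ suc) m x))
    (identity (int (g 0) / 1) (int (h 0) / 1) x (evalℚ (applyUpTo (g ∘ suc) m) x) (evalℚ (applyUpTo (h ∘ suc) m) x))
    where identity = solve 5 (λ a b x p q → (a :+ b) :+ x :* (p :+ q) := (a :+ x :* p) :+ (b :+ x :* q)) refl

  evalℚ-0 : ∀ {f : ℕ → ℕ} → (∀ k → f k ≡ 0) → ∀ m x → evalℚ (applyUpTo f m) x ≡ 0ℚ
  evalℚ-0 eq zero    x = refl
  evalℚ-0 eq (suc m) x = trans (cong₂ (λ a b → int a / 1 + x * b) (eq 0) (evalℚ-0 (eq ∘ suc) m x))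
    (identity x)
    where identity = solve 1 (λ x → con 0ℚ :+ x :* con 0ℚ := con 0ℚ) refl

  evalℚ-monomial : ∀ c m x → c ℕ.< m →
    evalℚ (applyUpTo (λ k → if does (c ℕ.≟ k) then 1 else 0) m) x ≡ x ^ c
  evalℚ-monomial zero    (suc m) x _            = trans
    (cong (λ y → 1ℚ + x * y) (evalℚ-0 (λ _ → refl) m x)) (identity x)
    where identity = solve 1 (λ x → con 1ℚ :+ x :* con 0ℚ := con 1ℚ) refl
  evalℚ-monomial (suc c) (suc m) x (ℕ.s≤s c<m) = trans
    (cong (λ y → 0ℚ + x * y) (evalℚ-monomial c m x c<m)) (ℚ.+-identityˡ (x * x ^ c))

  module _ {A : Set} {P : A → Set} (P? : Decidable P) (size : A → ℕ) {m : ℕ} (size< : ∀ a → size a ℕ.< m) where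

    private
      count : List A → ℕ → ℕ
      count as k = length (filter (λ a → P? a ×-dec (size a ℕ.≟ k)) as)

      count-∷ : ∀ a as k → count (a ∷ as) k
        ≡ (if does (P? a) then (if does (size a ℕ.≟ k) then 1 else 0) else 0) ℕ.+ count as k
      count-∷ a as k with does (P? a) | does (size a ℕ.≟ k)
      ... | true  | true  = refl
      ... | true  | false = refl
      ... | false | _     = refl

    -- Each counted element contributes its monomial to one coefficient, and `size<` guarantees that
    -- the list of coefficients is long enough to contain it.
    evalℚ-count : ∀ as x → evalℚ (applyUpTo (count as) m) x
      ≡ sumOver (λ a → if does (P? a) then x ^ size a else 0ℚ) as
    evalℚ-count []       x = evalℚ-0 (λ _ → refl) m x
    evalℚ-count (a ∷ as) x = trans (evalℚ-+ (count-∷ a as) m x)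
      (cong₂ _+_ (go (does (P? a))) (evalℚ-count as x))
      where
      go : ∀ b → evalℚ (applyUpTo (λ k → if b then (if does (size a ℕ.≟ k) then 1 else 0) else 0) m) x
        ≡ (if b then x ^ size a else 0ℚ)
      go true  = evalℚ-monomial (size a) m x (size< a)
      go false = evalℚ-0 (λ _ → refl) m x

  none : (Fin n → Bool) → Subset n → Bool
  none f []          = true
  none f (true ∷ S)  = not (f zero) ∧ none (f ∘ suc) S
  none f (false ∷ S) = none (f ∘ suc) S

  -- Independence tested along the recursion of `Z`, one vertex at a time; `independent≡indep`
  -- connects it with the definition by pairs of vertices.
  indep : AdjMatrix n → Subset n → Bool
  indep adj []          = true
  indep adj (true ∷ S)  = indep (tailAdj adj) S ∧ none (λ u → adj zero (suc u)) S
  indep adj (false ∷ S) = indep (tailAdj adj) S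

  product : (Fin n → Weight) → Subset n → ℚ
  product w []          = 1ℚ
  product w (true ∷ S)  = proj₂ (w zero) * product (w ∘ suc) S
  product w (false ∷ S) = proj₁ (w zero) * product (w ∘ suc) S

  private
    ∧-if : ∀ a b (p : ℚ) → (if a ∧ b then p else 0ℚ) ≡ (if a then (if b then p else 0ℚ) else 0ℚ)
    ∧-if true  b p = refl
    ∧-if false b p = refl

    if-* : ∀ b c p → (if b then c * p else 0ℚ) ≡ c * (if b then p else 0ℚ)
    if-* true  c p = refl
    if-* false c p = sym (ℚ.*-zeroʳ c)

    product-mask : ∀ (f : Fin n → Bool) w S →
      product (λ u → mask (f u) (w u)) S ≡ (if none f S then product w S else 0ℚ)
    product-mask f w []          = refl
    product-mask f w (false ∷ S) = trans (cong (proj₁ (w zero) *_) (product-mask (f ∘ suc) (w ∘ suc) S))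
      (sym (if-* (none (f ∘ suc) S) (proj₁ (w zero)) (product (w ∘ suc) S)))
    product-mask f w (true ∷ S)  = go (f zero)
      where
      go : ∀ b → (if b then 0ℚ else proj₂ (w zero)) * product (λ u → mask (f (suc u)) (w (suc u))) S
        ≡ (if not b ∧ none (f ∘ suc) S then proj₂ (w zero) * product (w ∘ suc) S else 0ℚ)
      go true  = ℚ.*-zeroˡ (product (λ u → mask (f (suc u)) (w (suc u))) S)
      go false = trans (cong (proj₂ (w zero) *_) (product-mask (f ∘ suc) (w ∘ suc) S))
        (sym (if-* (none (f ∘ suc) S) (proj₂ (w zero)) (product (w ∘ suc) S)))

  Z-sum : ∀ (adj : AdjMatrix n) w →
    Z adj w ≡ sumOver (λ S → if indep adj S then product w S else 0ℚ) (subsets n)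
  Z-sum {zero}  adj w = refl
  Z-sum {suc n} adj w = sym (trans
    (sumOver-++ term (map (true ∷_) (subsets n)) (map (false ∷_) (subsets n)))
    (trans (ℚ.+-comm (sumOver term (map (true ∷_) (subsets n))) (sumOver term (map (false ∷_) (subsets n))))
      (cong₂ _+_
        (trans (sumOver-map term (false ∷_) (subsets n))
          (trans (sumOver-cong (λ S → if-* (indep (tailAdj adj) S) (proj₁ (w zero)) (product (w ∘ suc) S)) (subsets n))
            (trans (sumOver-* (proj₁ (w zero)) (λ S → if indep (tailAdj adj) S then product (w ∘ suc) S else 0ℚ) (subsets n))
              (cong (proj₁ (w zero) *_) (sym (Z-sum (tailAdj adj) (w ∘ suc)))))))
        (trans (sumOver-map term (true ∷_) (subsets n))
          (trans (sumOver-cong killed (subsets n))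
            (trans (sumOver-* (proj₂ (w zero)) (λ S → if indep (tailAdj adj) S then product masked S else 0ℚ) (subsets n))
              (cong (proj₂ (w zero) *_) (sym (Z-sum (tailAdj adj) masked)))))))))
    where
    term : Subset (suc n) → ℚ
    term S = if indep adj S then product w S else 0ℚ
    masked : Fin n → Weight
    masked u = mask (adj zero (suc u)) (w (suc u))
    killed : ∀ S → term (true ∷ S) ≡ proj₂ (w zero) * (if indep (tailAdj adj) S then product masked S else 0ℚ)
    killed S = trans (if-* (indep (tailAdj adj) S ∧ none (λ u → adj zero (suc u)) S) (proj₂ (w zero)) (product (w ∘ suc) S))
      (cong (proj₂ (w zero) *_) (trans (∧-if (indep (tailAdj adj) S) (none (λ u → adj zero (suc u)) S) (product (w ∘ suc) S))
        (cong (λ p → if indep (tailAdj adj) S then p else 0ℚ)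
          (sym (product-mask (λ u → adj zero (suc u)) (w ∘ suc) S)))))

  product-units : ∀ x (S : Subset n) → product (λ _ → 1ℚ , x) S ≡ x ^ card S
  product-units x []          = refl
  product-units x (true ∷ S)  = cong (x *_) (product-units x S)
  product-units x (false ∷ S) = trans (cong (1ℚ *_) (product-units x S)) (ℚ.*-identityˡ (x ^ card S))

  private
    none-sound : ∀ (f : Fin n → Bool) S → none f S ≡ true → ∀ {u} → u ∈ S → f u ≡ false
    none-sound f (true ∷ S)  eq u∈S with f zero in f₀
    none-sound f (true ∷ S)  eq here        | false = f₀
    none-sound f (true ∷ S)  eq (there u∈S) | false = none-sound (f ∘ suc) S eq u∈S
    none-sound f (false ∷ S) eq (there u∈S) = none-sound (f ∘ suc) S eq u∈S

    none-complete : ∀ (f : Fin n → Bool) S → (∀ u → u ∈ S → f u ≡ false) → none f S ≡ true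
    none-complete f []          h = refl
    none-complete f (true ∷ S)  h rewrite h zero here = none-complete (f ∘ suc) S (λ u u∈S → h (suc u) (there u∈S))
    none-complete f (false ∷ S) h = none-complete (f ∘ suc) S (λ u u∈S → h (suc u) (there u∈S))

    ∧-left : ∀ {a b} → a ∧ b ≡ true → a ≡ true
    ∧-left {true} _ = refl

    ∧-right : ∀ {a b} → a ∧ b ≡ true → b ≡ true
    ∧-right {true} eq = eq

  module _ where
    private
      sound : (adj : AdjMatrix n) → (∀ u v → adj u v ≡ adj v u) → (∀ u → adj u u ≡ false) →
        ∀ S → indep adj S ≡ true → ∀ u v → u ∈ S → v ∈ S → adj u v ≡ false
      sound adj sy ir (true ∷ S) eq zero    zero    _           _           = ir zero
      sound adj sy ir (true ∷ S) eq zero    (suc v) _           (there v∈S) =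
        none-sound _ S (∧-right {indep (tailAdj adj) S} eq) v∈S
      sound adj sy ir (true ∷ S) eq (suc u) zero    (there u∈S) _           =
        trans (sy (suc u) zero) (none-sound _ S (∧-right {indep (tailAdj adj) S} eq) u∈S)
      sound adj sy ir (true ∷ S) eq (suc u) (suc v) (there u∈S) (there v∈S) =
        sound (tailAdj adj) (λ u v → sy (suc u) (suc v)) (λ u → ir (suc u)) S (∧-left eq) u v u∈S v∈S
      sound adj sy ir (false ∷ S) eq (suc u) (suc v) (there u∈S) (there v∈S) =
        sound (tailAdj adj) (λ u v → sy (suc u) (suc v)) (λ u → ir (suc u)) S eq u v u∈S v∈S

      complete : (adj : AdjMatrix n) → ∀ S → (∀ u v → u ∈ S → v ∈ S → adj u v ≡ false) → indep adj S ≡ true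
      complete adj []          h = refl
      complete adj (true ∷ S)  h = cong₂ _∧_
        (complete (tailAdj adj) S (λ u v u∈S v∈S → h (suc u) (suc v) (there u∈S) (there v∈S)))
        (none-complete _ S (λ u u∈S → h zero (suc u) here (there u∈S)))
      complete adj (false ∷ S) h =
        complete (tailAdj adj) S (λ u v u∈S v∈S → h (suc u) (suc v) (there u∈S) (there v∈S))

    module _ (G : Graph n) where

      matrix : AdjMatrix n
      matrix u v = does (adj? G u v)

      matrix⇒Adj : ∀ {u v} → matrix u v ≡ true → Adj G u v
      matrix⇒Adj {u} {v} eq with adj? G u v
      ... | yes a = a

      Adj⇒matrix : ∀ {u v} → Adj G u v → matrix u v ≡ true
      Adj⇒matrix {u} {v} a = dec-true (adj? G u v) a

      ¬Adj⇒matrix : ∀ {u v} → ¬ Adj G u v → matrix u v ≡ false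
      ¬Adj⇒matrix {u} {v} na = dec-false (adj? G u v) na

      matrix⇒¬Adj : ∀ {u v} → matrix u v ≡ false → ¬ Adj G u v
      matrix⇒¬Adj eq a with () ← trans (sym eq) (Adj⇒matrix a)

      matrix-symm : ∀ u v → matrix u v ≡ matrix v u
      matrix-symm u v with adj? G u v
      ... | yes a = sym (Adj⇒matrix (symm G a))
      ... | no na = sym (¬Adj⇒matrix (na ∘ symm G))

      matrix-irrefl : ∀ u → matrix u u ≡ false
      matrix-irrefl u = ¬Adj⇒matrix (irrefl G refl)

      independent≡indep : ∀ S → does (independent? G S) ≡ indep matrix S
      independent≡indep S with indep matrix S in eq
      ... | true  = dec-true (independent? G S) (λ u v u∈S v∈S →
            matrix⇒¬Adj (sound matrix matrix-symm matrix-irrefl S eq u v u∈S v∈S))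
      ... | false = dec-false (independent? G S) (λ ind → absurd (trans (sym eq)
            (complete matrix S (λ u v u∈S v∈S → ¬Adj⇒matrix (ind u v u∈S v∈S)))))
        where
        absurd : false ≢ true
        absurd ()

      evalℚ-indepPoly : ∀ x → evalℚ (indepPoly G) x ≡ Z matrix (λ _ → 1ℚ , x)
      evalℚ-indepPoly x = trans
        (evalℚ-count (independent? G) card (λ S → ℕ.s≤s (∣p∣≤n S)) (subsets n) x)
        (sym (trans (Z-sum matrix (λ _ → 1ℚ , x))
          (sumOver-cong (λ S → cong₂ (λ b p → if b then p else 0ℚ)
            (sym (independent≡indep S)) (product-units x S)) (subsets n))))

-- Forests, closed walks and unicyclic graphs

module Cycles where

  open import Data.Nat.Properties using (+-0-commutativeMonoid)
  open import Algebra.Properties.CommutativeMonoid.Sum +-0-commutativeMonoid using (sum)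
    renaming (sum-cong-≗ to sum-cong)
  open import Data.Bool as Bool using (Bool; true; false; if_then_else_)
  open import Data.Empty using (⊥; ⊥-elim)
  open import Data.Fin as Fin using (Fin; zero; suc; toℕ; fromℕ<)
  import Data.Fin.Properties as Fin
  open import Data.Nat as ℕ using (ℕ; zero; suc; _+_; _≤_; _<_; z≤n; s≤s)
  import Data.Nat.Properties as ℕ
  open import Data.Product using (∃-syntax; _×_; _,_; proj₁; proj₂)
  open import Data.Sum using (_⊎_; inj₁; inj₂)
  open import Function using (_∘_; id; Equivalence)
  open import Level using (0ℓ)
  open import Relation.Binary using (Rel; Symmetric; tri<; tri≈; tri>) renaming (Decidable to Decidable₂)
  open import Relation.Nullary using (Dec; yes; no; ¬_)
  open import Relation.Nullary.Decidable using (_×-dec_; ¬?)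
  open import Relation.Unary using (Decidable)
  open import Relation.Binary.PropositionalEquality
  open Defs using (Graph; Adj; adj?; symm; irrefl; Cycle; Unicyclic; C)
  open Weighted using (_[_≔_]; update-≢)

  -- The old value is added on the left, which avoids truncated subtraction.
  sum-update : ∀ {n} (f : Fin n → ℕ) v {a} → sum (f [ v ≔ a ]) + f v ≡ sum f + a
  sum-update {suc n} f zero {a} = begin
    (a + s) + f zero ≡⟨ ℕ.+-assoc a s (f zero) ⟩
    a + (s + f zero) ≡⟨ ℕ.+-comm a (s + f zero) ⟩
    (s + f zero) + a ≡⟨ cong (_+ a) (ℕ.+-comm s (f zero)) ⟩
    (f zero + s) + a ∎
    where
    open ≡-Reasoning
    s = sum (f ∘ suc)
  sum-update {suc n} f (suc v) {a} = trans (ℕ.+-assoc (f zero) _ (f (suc v)))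
    (trans (cong (f zero +_) (sum-update (f ∘ suc) v)) (sym (ℕ.+-assoc (f zero) _ a)))

  sum-mono : ∀ {n} {f g : Fin n → ℕ} → (∀ u → f u ≤ g u) → sum f ≤ sum g
  sum-mono {zero}  le = z≤n
  sum-mono {suc n} le = ℕ.+-mono-≤ (le zero) (sum-mono (le ∘ suc))

  sum-0 : ∀ {n} {f : Fin n → ℕ} → (∀ u → f u ≡ 0) → sum f ≡ 0
  sum-0 {zero}  eq = refl
  sum-0 {suc n} eq = cong₂ _+_ (eq zero) (sum-0 (eq ∘ suc))

  indicator : Bool → ℕ
  indicator b = if b then 1 else 0

  count : ∀ {n} → (Fin n → Bool) → ℕ
  count W = sum (indicator ∘ W)

  module _ {n} (W : Fin n → Bool) where

    private
      indicator-update : ∀ v b u → indicator ((W [ v ≔ b ]) u) ≡ ((indicator ∘ W) [ v ≔ indicator b ]) u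
      indicator-update v b u with u Fin.≟ v
      ... | yes _ = refl
      ... | no  _ = refl

    count-insert : ∀ {v} → W v ≡ false → count (W [ v ≔ true ]) ≡ suc (count W)
    count-insert {v} eq = trans (trans (sum-cong (indicator-update v true)) (sym (ℕ.+-identityʳ _)))
      (trans (cong (λ b → sum ((indicator ∘ W) [ v ≔ 1 ]) + indicator b) (sym eq))
        (trans (sum-update (indicator ∘ W) v) (ℕ.+-comm (count W) 1)))

    count-remove : ∀ {v} → W v ≡ true → count W ≡ suc (count (W [ v ≔ false ]))
    count-remove {v} eq = trans (sym (ℕ.+-identityʳ (count W)))
      (trans (sym (sum-update (indicator ∘ W) v))
        (trans (cong₂ (λ a b → a + indicator b) (sym (sum-cong (indicator-update v false))) eq)
          (ℕ.+-comm _ 1)))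

    remove-∈ : ∀ {v w} → (W [ v ≔ false ]) w ≡ true → w ≢ v × W w ≡ true
    remove-∈ {v} {w} eq with w Fin.≟ v
    ... | yes _   with () ← eq
    ... | no w≢v  = w≢v , eq

    ∈-remove : ∀ {v w} → w ≢ v → W w ≡ true → (W [ v ≔ false ]) w ≡ true
    ∈-remove w≢v eq = trans (update-≢ W w≢v) eq

  least : ∀ {P : ℕ → Set} → Decidable P → ∀ m → P m → ∃[ k ] P k × (∀ j → j < k → ¬ P j)
  least {P} P? m Pm = go m m ℕ.≤-refl Pm
    where
    go : ∀ b m → m ≤ b → P m → ∃[ k ] P k × (∀ j → j < k → ¬ P j)
    go b m m≤b Pm with ℕ.anyUpTo? P? m
    go b       m m≤b Pm | no none            = m , Pm , λ j j<m Pj → none (j , j<m , Pj)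
    go zero    .zero z≤n Pm | yes (j , () , Pj)
    go (suc b) m m≤b Pm | yes (j , j<m , Pj) = go b j (ℕ.≤-pred (ℕ.≤-trans j<m m≤b)) Pj

  module _ {n} (R : Rel (Fin n) 0ℓ) where

    Leafish : (Fin n → Bool) → Fin n → Set
    Leafish W v = ∃[ u ] (∀ w → W w ≡ true → R v w → w ≡ u)

    -- At least two neighbours in `W`, put in the form that lets a walk coming from `u` continue
    -- without turning back.
    Branch : (Fin n → Bool) → Fin n → Set
    Branch W v = ∀ u → ∃[ w ] W w ≡ true × R v w × w ≢ u

    Leafish⇒¬Branch : ∀ {W v} → Leafish W v → ¬ Branch W v
    Leafish⇒¬Branch (u , only) branch with branch u
    ... | w , Ww , vw , w≢u = w≢u (only w Ww vw)

    leafish-or-branch : Decidable₂ R → ∀ W v → Leafish W v ⊎ Branch W v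
    leafish-or-branch R? W v with Fin.all? other?
      where
      other? : Decidable (λ u → ∃[ w ] W w ≡ true × R v w × w ≢ u)
      other? u = Fin.any? λ w → (W w Bool.≟ true) ×-dec (R? v w ×-dec ¬? (w Fin.≟ u))
    ... | yes all  = inj₂ all
    ... | no  ¬all with Fin.¬∀⟶∃¬ n (λ u → ∃[ w ] W w ≡ true × R v w × w ≢ u)
                        (λ u → Fin.any? λ w → (W w Bool.≟ true) ×-dec (R? v w ×-dec ¬? (w Fin.≟ u))) ¬all
    ...   | u , none = inj₁ (u , only)
      where
      only : ∀ w → W w ≡ true → R v w → w ≡ u
      only w Ww vw with w Fin.≟ u
      ... | yes w≡u = w≡u
      ... | no  w≢u = ⊥-elim (none (w , Ww , vw , w≢u))

    -- For symmetric relations without loops this is equivalent to acyclicity, as the vertices of a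
    -- cycle would be a subset without such a vertex. In this form it can be used directly when
    -- vertices are deleted.
    Forest : Set
    Forest = ∀ W → ∃[ v ] W v ≡ true → ∃[ v ] W v ≡ true × Leafish W v

    -- Positions are natural numbers, of which only those below `len` are constrained; this spares
    -- arithmetic in `Fin`.
    record Closed-walk (W : Fin n → Bool) : Set where
      field
        len   : ℕ
        3≤len : 3 ≤ len
        at    : ℕ → Fin n
        inj   : ∀ {a b} → a < len → b < len → at a ≡ at b → a ≡ b
        step  : ∀ {a} → suc a < len → R (at a) (at (suc a))
        close : ∀ {a} → suc a ≡ len → R (at a) (at 0)
        in-W  : ∀ {a} → a < len → W (at a) ≡ true

    module _ (irr : ∀ {u} → ¬ R u u) {W : Fin n → Bool} (branch : ∀ v → W v ≡ true → Branch W v) where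

      private
        -- A walk that never turns back runs into itself.
        State : Set
        State = Fin n × (∃[ v ] W v ≡ true)

        next : State → State
        next (u , v , Wv) with branch v Wv u
        ... | w , Ww , _ = v , w , Ww

        next-R : ∀ s → R (proj₁ (proj₂ s)) (proj₁ (proj₂ (next s)))
        next-R (u , v , Wv) with branch v Wv u
        ... | w , _ , vw , _ = vw

        next-≢ : ∀ s → proj₁ (proj₂ (next s)) ≢ proj₁ s
        next-≢ (u , v , Wv) with branch v Wv u
        ... | w , _ , _ , w≢u = w≢u

        next-prev : ∀ s → proj₁ (next s) ≡ proj₁ (proj₂ s)
        next-prev (u , v , Wv) with branch v Wv u
        ... | _ = refl

        states : State → ℕ → State
        states s zero    = s
        states s (suc k) = next (states s k)

      -- Cut out between the first repetition and the earlier visit of the same vertex: all vertices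
      -- in between are distinct, and there are at least three steps because the walk has neither
      -- loops nor turns.
      branch⇒closed-walk : ∃[ v ] W v ≡ true → Closed-walk W
      branch⇒closed-walk (v₀ , Wv₀) = record
        { len = k ; 3≤len = 3≤k ; at = λ a → f (i + a)
        ; inj = λ {a} {b} a<k b<k eq → ℕ.+-cancelˡ-≡ i a b (f-inj (below a<k) (below b<k) eq)
        ; step = λ {a} _ → subst (λ m → R (f (i + a)) (f m)) (sym (ℕ.+-suc i a)) (f-step (i + a))
        ; close = λ {a} eq → subst (R (f (i + a)))
            (trans (cong f (trans (sym (ℕ.+-suc i a)) (trans (cong (i +_) eq) i+k≡j)))
              (trans (sym fi≡fj) (cong f (sym (ℕ.+-identityʳ i)))))
            (f-step (i + a))
        ; in-W = λ {a} _ → proj₂ (proj₂ (states s₀ (i + a)))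
        }
        where
        s₀ : State
        s₀ = v₀ , v₀ , Wv₀
        f : ℕ → Fin n
        f a = proj₁ (proj₂ (states s₀ a))
        f-step : ∀ a → R (f a) (f (suc a))
        f-step a = next-R (states s₀ a)
        f-turn : ∀ a → f (suc (suc a)) ≢ f a
        f-turn a eq = next-≢ (states s₀ (suc a)) (trans eq (sym (next-prev (states s₀ a))))
        Repeats : ℕ → Set
        Repeats j = ∃[ i ] i < j × f i ≡ f j
        repeats? : Decidable Repeats
        repeats? j = ℕ.anyUpTo? (λ i → f i Fin.≟ f j) j
        some : ∃[ j ] Repeats j
        some with Fin.pigeonhole (ℕ.n<1+n n) (f ∘ toℕ)
        ... | a , b , a<b , eq = toℕ b , toℕ a , a<b , eq
        first = least repeats? (proj₁ some) (proj₂ some)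
        j = proj₁ first
        i = proj₁ (proj₁ (proj₂ first))
        i<j : i < j
        i<j = proj₁ (proj₂ (proj₁ (proj₂ first)))
        fi≡fj : f i ≡ f j
        fi≡fj = proj₂ (proj₂ (proj₁ (proj₂ first)))
        f-inj : ∀ {a b} → a < j → b < j → f a ≡ f b → a ≡ b
        f-inj {a} {b} a<j b<j eq with ℕ.<-cmp a b
        ... | tri< a<b _ _ = ⊥-elim (proj₂ (proj₂ first) b b<j (a , a<b , eq))
        ... | tri≈ _ a≡b _ = a≡b
        ... | tri> _ _ b<a = ⊥-elim (proj₂ (proj₂ first) a a<j (b , b<a , sym eq))
        k = j ℕ.∸ i
        i+k≡j : i + k ≡ j
        i+k≡j = ℕ.m+[n∸m]≡n (ℕ.<⇒≤ i<j)
        below : ∀ {a} → a < k → i + a < j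
        below a<k = subst (i + _ <_) i+k≡j (ℕ.+-monoʳ-< i a<k)
        3≤k : 3 ≤ k
        3≤k = go k i+k≡j
          where
          go : ∀ k → i + k ≡ j → 3 ≤ k
          go 0 eq = ⊥-elim (ℕ.<-irrefl (trans (sym (ℕ.+-identityʳ i)) eq) i<j)
          go 1 eq = ⊥-elim (irr (subst (R (f i)) (trans (cong f (trans (sym (ℕ.+-comm i 1)) eq)) (sym fi≡fj)) (f-step i)))
          go 2 eq = ⊥-elim (f-turn i (trans (cong f (trans (sym (ℕ.+-comm i 2)) eq)) (sym fi≡fj)))
          go (suc (suc (suc k))) _ = s≤s (s≤s (s≤s z≤n))

    module _ (R? : Decidable₂ R) (sym-R : Symmetric R) (irr : ∀ {u} → ¬ R u u) where

      no-closed-walk⇒Forest : (∀ W → ¬ Closed-walk W) → Forest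
      no-closed-walk⇒Forest none W nonempty with Fin.any? leafish?
        where
        leafish? : Decidable (λ v → W v ≡ true × Leafish W v)
        leafish? v with W v Bool.≟ true | leafish-or-branch R? W v
        ... | no  ¬Wv | _       = no (¬Wv ∘ proj₁)
        ... | yes Wv  | inj₁ l  = yes (Wv , l)
        ... | yes _   | inj₂ br = no λ (_ , l) → Leafish⇒¬Branch {W} {v} l br
      ... | yes found = found
      ... | no  ¬leaf = ⊥-elim (none W (branch⇒closed-walk irr all-branch nonempty))
        where
        all-branch : ∀ v → W v ≡ true → Branch W v
        all-branch v Wv with leafish-or-branch R? W v
        ... | inj₁ l  = ⊥-elim (¬leaf (v , Wv , l))
        ... | inj₂ br = br

      -- A forest with an edge has two leaves.
      one-exception : Forest → ∀ W v₀ → W v₀ ≡ true →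
        (∀ v → W v ≡ true → v ≢ v₀ → Branch W v) → ∀ v → W v ≡ true → v ≡ v₀
      one-exception forest W v₀ = go (count W) W v₀ ℕ.≤-refl
        where
        go : ∀ b W v₀ → count W ≤ b → W v₀ ≡ true →
          (∀ v → W v ≡ true → v ≢ v₀ → Branch W v) → ∀ v → W v ≡ true → v ≡ v₀
        go b W v₀ le Wv₀ branch v Wv with v Fin.≟ v₀
        ... | yes v≡v₀ = v≡v₀
        ... | no  v≢v₀ = ⊥-elim (contra b le)
          where
          W′ : Fin n → Bool
          W′ = W [ v₀ ≔ false ]
          leaf : Leafish W v₀
          leaf with forest W (v₀ , Wv₀)
          ... | l , Wl , leafish with l Fin.≟ v₀
          ...   | yes refl = leafish
          ...   | no l≢v₀  = ⊥-elim (Leafish⇒¬Branch {W} {l} leafish (branch l Wl l≢v₀))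
          u = proj₁ leaf
          branch′ : ∀ w → W′ w ≡ true → w ≢ u → Branch W′ w
          branch′ w W′w w≢u x with remove-∈ W {v₀} {w} W′w
          ... | w≢v₀ , Ww with branch w Ww w≢v₀ x
          ...   | y , Wy , wy , y≢x = y , ∈-remove W y≢v₀ Wy , wy , y≢x
            where
            y≢v₀ : y ≢ v₀
            y≢v₀ refl = w≢u (proj₂ leaf w Ww (sym-R wy))
          contra : ∀ b → count W ≤ b → ⊥
          contra b le with W u Bool.≟ true | u Fin.≟ v₀
          ... | no ¬Wu | _ = case-no (forest W′ (v , ∈-remove W v≢v₀ Wv))
            where
            case-no : ∃[ w ] W′ w ≡ true × Leafish W′ w → ⊥
            case-no (w , W′w , l) = Leafish⇒¬Branch {W′} {w} l
              (branch′ w W′w λ { refl → ¬Wu (proj₂ (remove-∈ W {v₀} {w} W′w)) })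
          ... | yes _ | yes u≡v₀ = case-eq (forest W′ (v , ∈-remove W v≢v₀ Wv))
            where
            case-eq : ∃[ w ] W′ w ≡ true × Leafish W′ w → ⊥
            case-eq (w , W′w , l) = Leafish⇒¬Branch {W′} {w} l
              (branch′ w W′w λ w≡u → proj₁ (remove-∈ W {v₀} {w} W′w) (trans w≡u u≡v₀))
          ... | yes Wu | no u≢v₀ = smaller b le
            where
            smaller : ∀ b → count W ≤ b → ⊥
            smaller zero    le = ℕ.<⇒≱ (s≤s z≤n) (ℕ.≤-trans (ℕ.≤-reflexive (sym (count-remove W Wv₀))) le)
            smaller (suc b) le with branch u Wu u≢v₀ v₀
            ... | x , Wx , ux , x≢v₀ = irr (subst (R u)
              (go b W′ u (ℕ.≤-pred (subst (_≤ suc b) (count-remove W Wv₀) le))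
                (∈-remove W u≢v₀ Wu) branch′ x (∈-remove W x≢v₀ Wx)) ux)

  open Closed-walk

  module _ {n} (G : Graph n) {R : Rel (Fin n) 0ℓ} (R⊆Adj : ∀ {u v} → R u v → Adj G u v)
           (sym-R : Symmetric R) {W : Fin n → Bool} (walk : Closed-walk R W) where

    private
      vertex : Fin (len walk) → Fin n
      vertex i = at walk (toℕ i)

      link : ∀ {i j : Fin (len walk)} → suc (toℕ i) ≡ toℕ j ⊎ (suc (toℕ i) ≡ len walk × toℕ j ≡ 0) →
        R (vertex i) (vertex j)
      link {i} {j} (inj₁ eq)       = subst (λ b → R (vertex i) (at walk b)) eq
        (step walk (subst (_< len walk) (sym eq) (Fin.toℕ<n j)))
      link {i}     (inj₂ (eq , z)) = subst (λ b → R (vertex i) (at walk b)) (sym z) (close walk eq)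

      edge-R : ∀ {i j} → Adj (C (len walk)) i j → R (vertex i) (vertex j)
      edge-R {i} {j} (_ , inj₁ r) = link {i} {j} r
      edge-R {i} {j} (_ , inj₂ r) = sym-R (link {j} {i} r)

    toCycle : Cycle G
    toCycle = record
      { len = len walk ; 3≤len = 3≤len walk ; vertex = vertex
      ; inj = λ {i} {j} eq → Fin.toℕ-injective (inj walk (Fin.toℕ<n i) (Fin.toℕ<n j) eq)
      ; edge = λ {i} {j} → R⊆Adj ∘ edge-R {i} {j}
      }

    toCycle-R : ∀ {u v} → Cycle.Edge toCycle u v → R u v
    toCycle-R (i , j , ij , refl , refl) = edge-R {i} {j} ij

    toCycle-vertex : ∀ {u v} → Cycle.Edge toCycle u v → ∃[ a ] a < len walk × u ≡ at walk a
    toCycle-vertex (i , j , ij , refl , refl) = toℕ i , Fin.toℕ<n i , refl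

    toCycle-vertexʳ : ∀ {u v} → Cycle.Edge toCycle u v → ∃[ a ] a < len walk × v ≡ at walk a
    toCycle-vertexʳ (i , j , ij , refl , refl) = toℕ j , Fin.toℕ<n j , refl

    private
      edge-from : ∀ {a b} (p : a < len walk) (q : b < len walk) → a ≢ b →
        (suc a ≡ b ⊎ (suc a ≡ len walk × b ≡ 0)) → Cycle.Edge toCycle (at walk a) (at walk b)
      edge-from {a} {b} p q a≢b r =
        fromℕ< p , fromℕ< q
        , ((λ eq → a≢b (Fin.fromℕ<-injective a b p q eq))
          , inj₁ (subst₂ (λ a b → suc a ≡ b ⊎ (suc a ≡ len walk × b ≡ 0))
                    (sym (Fin.toℕ-fromℕ< p)) (sym (Fin.toℕ-fromℕ< q)) r))
        , cong (at walk) (Fin.toℕ-fromℕ< p) , cong (at walk) (Fin.toℕ-fromℕ< q)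

    toCycle-step : ∀ {a} → suc a < len walk → Cycle.Edge toCycle (at walk a) (at walk (suc a))
    toCycle-step {a} p = edge-from (ℕ.<-trans (ℕ.n<1+n a) p) p (λ eq → ℕ.1+n≢n (sym eq)) (inj₁ refl)

    toCycle-close : ∀ {a} → suc a ≡ len walk → Cycle.Edge toCycle (at walk a) (at walk 0)
    toCycle-close {a} eq = edge-from (subst (a <_) eq (ℕ.n<1+n a))
      (ℕ.≤-trans (s≤s z≤n) (3≤len walk))
      (λ { refl → ℕ.<⇒≱ (s≤s (s≤s z≤n)) (subst (3 ≤_) (sym eq) (3≤len walk)) }) (inj₂ (eq , refl))

  fromCycle : ∀ {n} (G : Graph n) → Cycle G → Closed-walk (Adj G) (λ _ → true)
  fromCycle G c = record
    { len = k ; 3≤len = Cycle.3≤len c ; at = position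
    ; inj = λ {a} {b} a<k b<k eq → Fin.fromℕ<-injective a b a<k b<k (Cycle.inj c
        (trans (sym (position-< a<k)) (trans eq (position-< b<k))))
    ; step = λ {a} p → let q = ℕ.<-trans (ℕ.n<1+n a) p in
        subst₂ (Adj G) (sym (position-< q)) (sym (position-< p)) (Cycle.edge c
          ((λ eq → ℕ.1+n≢n (sym (Fin.fromℕ<-injective a (suc a) q p eq)))
          , inj₁ (inj₁ (trans (cong suc (Fin.toℕ-fromℕ< q)) (sym (Fin.toℕ-fromℕ< p))))))
    ; close = λ {a} eq → let q = subst (a <_) eq (ℕ.n<1+n a) in
        subst₂ (Adj G) (sym (position-< q)) (sym (position-< 0<k)) (Cycle.edge c
          ((λ e → distinct eq (Fin.fromℕ<-injective a 0 q 0<k e))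
          , inj₁ (inj₂ (trans (cong suc (Fin.toℕ-fromℕ< q)) eq , Fin.toℕ-fromℕ< 0<k))))
    ; in-W = λ _ → refl
    }
    where
    k = Cycle.len c
    0<k : 0 < k
    0<k = ℕ.≤-trans (s≤s z≤n) (Cycle.3≤len c)
    distinct : ∀ {a} → suc a ≡ k → a ≢ 0
    distinct eq refl = ℕ.<⇒≱ (s≤s (s≤s z≤n)) (subst (3 ≤_) (sym eq) (Cycle.3≤len c))
    place : ∀ {a} → Dec (a < k) → Fin _
    place (yes p) = Cycle.vertex c (fromℕ< p)
    -- A filler for positions that are not on the cycle.
    place (no _)  = Cycle.vertex c (fromℕ< 0<k)
    position : ℕ → Fin _
    position a = place (a ℕ.<? k)
    position-< : ∀ {a} (p : a < k) → position a ≡ Cycle.vertex c (fromℕ< p)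
    position-< {a} p with a ℕ.<? k
    ... | yes q = refl
    ... | no ¬p = ⊥-elim (¬p p)

  module _ {n} {G : Graph n} (unicyclic : Unicyclic G) where

    same-edges : ∀ (c d : Cycle G) {u v} → Cycle.Edge c u v → Cycle.Edge d u v
    same-edges c d {u} {v} e = Equivalence.to (proj₂ unicyclic d u v)
      (Equivalence.from (proj₂ unicyclic c u v) e)

    module Ring {W₀} (ring : Closed-walk (Adj G) W₀) where

      private
        k = len ring
        c = at ring
        last = ℕ.pred k
        0<k : 0 < k
        0<k = ℕ.≤-trans (s≤s z≤n) (3≤len ring)
        suc-last : suc last ≡ k
        suc-last = ℕ.suc-pred k {{ℕ.>-nonZero 0<k}}
        last<k : last < k
        last<k = ℕ.≤-reflexive suc-last
        2≤last : 2 ≤ last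
        2≤last = ℕ.≤-pred (subst (3 ≤_) (sym suc-last) (3≤len ring))
        p = c 0
        q = c last

      ringCycle : Cycle G
      ringCycle = toCycle G id (symm G) ring

      Cut : Rel (Fin n) 0ℓ
      Cut u v = Adj G u v × ¬ (u ≡ p × v ≡ q) × ¬ (u ≡ q × v ≡ p)

      cut? : Decidable₂ Cut
      cut? u v = adj? G u v ×-dec (¬? ((u Fin.≟ p) ×-dec (v Fin.≟ q)) ×-dec ¬? ((u Fin.≟ q) ×-dec (v Fin.≟ p)))

      cut-sym : Symmetric Cut
      cut-sym (uv , ¬pq , ¬qp) = symm G uv , (λ (a , b) → ¬qp (b , a)) , (λ (a , b) → ¬pq (b , a))

      cut-irr : ∀ {u} → ¬ Cut u u
      cut-irr (uu , _) = irrefl G refl uu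

      -- Every cycle of G has the same edges as the ring and hence contains the edge that has been
      -- cut.
      cut-forest : Forest Cut
      cut-forest = no-closed-walk⇒Forest Cut cut? cut-sym cut-irr λ W walk →
        proj₂ (proj₂ (toCycle-R G proj₁ cut-sym walk
          (same-edges ringCycle (toCycle G proj₁ cut-sym walk)
            (toCycle-close G id (symm G) ring suc-last)))) (refl , refl)

      Chordless : Set
      Chordless = ∀ {a b} → a < b → b < k → Adj G (c a) (c b) → b ≡ suc a ⊎ (a ≡ 0 × suc b ≡ k)

      private
        uncurried : ∀ {a b} → a < k → b < k → c a ≡ c b → a ≡ b
        uncurried = inj ring

        cut-step : ∀ {a} → suc a < k → Cut (c a) (c (suc a))
        cut-step {a} a+1<k = step ring a+1<k
          , (λ (a≡ , b≡) → ℕ.<⇒≢ 2≤last (trans (cong suc (sym (uncurried a<k 0<k a≡))) (uncurried a+1<k last<k b≡)))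
          , (λ (a≡ , _) → ℕ.<-irrefl (trans (cong suc (uncurried a<k last<k a≡)) suc-last) a+1<k)
          where a<k = ℕ.<-trans (ℕ.n<1+n a) a+1<k

        Result : ℕ → ℕ → (Fin n → Bool) → Set
        Result m a W = (∀ v → W v ≡ true → ∃[ b ] b < k × v ≡ c b)
          × (∀ {x y} → a ≤ x → x < y → y < k → Cut (c x) (c y) → y ≡ suc x)
          × count W ≡ suc m

        -- `c a` always is a leaf of `W`: otherwise `q` would be the only vertex possibly without
        -- two neighbours, and `one-exception` would leave nothing but `q`. So its only neighbour is
        -- the next ring vertex, there is no chord at `c a`, and it can be removed.
        peel : ∀ m a → a + suc m ≡ k → ∀ W → (∀ {b} → a ≤ b → b < k → W (c b) ≡ true) →
          (∀ v → W v ≡ true → v ≢ c a → v ≢ q → Branch Cut W v) → Result m a W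
        peel zero a eq W mem branch = (λ v Wv → a , a<k , only v Wv)
          , (λ {x} {y} a≤x x<y y<k _ → ⊥-elim (ℕ.<⇒≱ (ℕ.≤-<-trans a≤x x<y) (ℕ.≤-pred (subst (y <_) k≡ y<k))))
          , trans (count-remove W (mem ℕ.≤-refl a<k)) (cong suc (sum-0 λ u → empty u _ refl))
          where
          k≡ : k ≡ suc a
          k≡ = trans (sym eq) (ℕ.+-comm a 1)
          a<k : a < k
          a<k = ℕ.≤-reflexive (sym k≡)
          a≡last : a ≡ last
          a≡last = ℕ.suc-injective (trans (sym k≡) (sym suc-last))
          only : ∀ v → W v ≡ true → v ≡ c a
          only = one-exception Cut cut? cut-sym cut-irr cut-forest W (c a) (mem ℕ.≤-refl a<k)
            (λ v Wv v≢ → branch v Wv v≢ (λ v≡q → v≢ (trans v≡q (cong c (sym a≡last)))))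
          empty : ∀ u b → (W [ c a ≔ false ]) u ≡ b → indicator b ≡ 0
          empty u false _  = refl
          empty u true  eq = ⊥-elim (proj₁ (remove-∈ W {c a} {u} eq) (only u (proj₂ (remove-∈ W {c a} {u} eq))))
        peel (suc m) a eq W mem branch = members , chord , counted
          where
          a+1<k : suc a < k
          a+1<k = subst (suc a <_) (trans (sym (ℕ.+-suc a (suc m))) eq)
                    (s≤s (ℕ.m<m+n a (s≤s z≤n)))
          a<k : a < k
          a<k = ℕ.<-trans (ℕ.n<1+n a) a+1<k
          ca≢q : c a ≢ q
          ca≢q e = ℕ.<-irrefl (trans (cong suc (uncurried a<k last<k e)) suc-last) a+1<k
          leaf : Leafish Cut W (c a)
          leaf with leafish-or-branch Cut cut? W (c a)
          ... | inj₁ l  = l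
          ... | inj₂ br = ⊥-elim (ca≢q (one-exception Cut cut? cut-sym cut-irr cut-forest W q
            (mem (ℕ.≤-pred (subst (suc a ≤_) (sym suc-last) a<k)) last<k) all (c a) (mem ℕ.≤-refl a<k)))
            where
            all : ∀ v → W v ≡ true → v ≢ q → Branch Cut W v
            all v Wv v≢q with v Fin.≟ c a
            ... | yes refl = br
            ... | no v≢ca  = branch v Wv v≢ca v≢q
          only : ∀ w → W w ≡ true → Cut (c a) w → w ≡ c (suc a)
          only w Ww aw = trans (proj₂ leaf w Ww aw)
            (sym (proj₂ leaf (c (suc a)) (mem (ℕ.n≤1+n a) a+1<k) (cut-step a+1<k)))
          W′ : Fin n → Bool
          W′ = W [ c a ≔ false ]
          rest : Result m (suc a) W′
          rest = peel m (suc a) (trans (sym (ℕ.+-suc a (suc m))) eq) W′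
            (λ {b} a<b b<k → ∈-remove W (λ e → ℕ.<⇒≢ a<b (sym (uncurried b<k a<k e))) (mem (ℕ.<⇒≤ a<b) b<k))
            branch′
            where
            branch′ : ∀ v → W′ v ≡ true → v ≢ c (suc a) → v ≢ q → Branch Cut W′ v
            branch′ v W′v v≢ v≢q u with remove-∈ W {c a} {v} W′v
            ... | v≢ca , Wv with branch v Wv v≢ca v≢q u
            ...   | w , Ww , vw , w≢u = w
              , ∈-remove W (λ { refl → v≢ (only v Wv (cut-sym vw)) }) Ww , vw , w≢u
          members : ∀ v → W v ≡ true → ∃[ b ] b < k × v ≡ c b
          members v Wv with v Fin.≟ c a
          ... | yes v≡ca = a , a<k , v≡ca
          ... | no v≢ca  = proj₁ rest v (∈-remove W v≢ca Wv)
          chord : ∀ {x y} → a ≤ x → x < y → y < k → Cut (c x) (c y) → y ≡ suc x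
          chord {x} {y} a≤x x<y y<k xy with ℕ.m≤n⇒m<n∨m≡n a≤x
          ... | inj₁ a<x  = proj₁ (proj₂ rest) a<x x<y y<k xy
          ... | inj₂ refl = uncurried y<k a+1<k (only (c y) (mem (ℕ.<⇒≤ x<y) y<k) xy)
          counted : count W ≡ suc (suc m)
          counted = trans (count-remove W (mem ℕ.≤-refl a<k)) (cong suc (proj₂ (proj₂ rest)))

      -- Nothing is left to hang on the ring. After the cut every vertex of `W` other than the two
      -- ends has two neighbours in `W`, so that peeling off the ring vertices one by one exhausts
      -- `W`.
      only-ring : ∀ W → (∀ {a} → a < k → W (c a) ≡ true) →
        (∀ v → W v ≡ true → (∀ a → a < k → v ≢ c a) → Branch (Adj G) W v) →
        (∀ v → W v ≡ true → ∃[ a ] a < k × v ≡ c a) × Chordless × count W ≡ k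
      only-ring W mem branch with peel last 0 suc-last W (λ _ → mem) cut-branch
        where
        cut-branch : ∀ v → W v ≡ true → v ≢ p → v ≢ q → Branch Cut W v
        cut-branch v Wv v≢p v≢q u with ℕ.anyUpTo? (λ a → v Fin.≟ c a) k
        ... | no off with branch v Wv (λ a a<k v≡ → off (a , a<k , v≡)) u
        ...   | w , Ww , vw , w≢u = w , Ww , (vw , (λ (e , _) → v≢p e) , (λ (e , _) → v≢q e)) , w≢u
        cut-branch v Wv v≢p v≢q u | yes (zero , _ , v≡) = ⊥-elim (v≢p v≡)
        cut-branch v Wv v≢p v≢q u | yes (suc a , a+1<k , refl) with c a Fin.≟ u
        ... | no ca≢u  = c a , mem a<k , cut-sym (cut-step a+1<k) , ca≢u
          where a<k = ℕ.<-trans (ℕ.n<1+n a) a+1<k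
        ... | yes refl = c (suc (suc a)) , mem a+2<k , cut-step a+2<k
          , λ e → ℕ.<⇒≢ (ℕ.m≤n⇒m≤1+n (ℕ.n<1+n a)) (sym (uncurried a+2<k a<k e))
          where
          a<k = ℕ.<-trans (ℕ.n<1+n a) a+1<k
          a+2<k : suc (suc a) < k
          a+2<k = ℕ.≤∧≢⇒< a+1<k (λ e → v≢q (cong c (ℕ.suc-injective (trans e (sym suc-last)))))
      ... | members , chord , counted = members , chordless , trans counted suc-last
        where
        chordless : Chordless
        chordless {a} {b} a<b b<k ab with a ℕ.≟ 0 | b ℕ.≟ last
        ... | yes a≡0 | yes b≡last = inj₂ (a≡0 , trans (cong suc b≡last) suc-last)
        ... | yes _   | no  b≢last = inj₁ (chord z≤n a<b b<k (ab
          , (λ (_ , e) → b≢last (uncurried b<k last<k e))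
          , (λ (_ , e) → ℕ.<⇒≱ a<b (subst (_≤ a) (sym (uncurried b<k 0<k e)) z≤n))))
        ... | no a≢0  | _          = inj₁ (chord z≤n a<b b<k (ab
          , (λ (e , _) → a≢0 (uncurried (ℕ.<-trans a<b b<k) 0<k e))
          , (λ (_ , e) → ℕ.<⇒≱ a<b (subst (_≤ a) (sym (uncurried b<k 0<k e)) z≤n))))

-- The perfect matching of a well-covered unicyclic graph

module Covered where

  open import Data.Nat.Properties using (+-0-commutativeMonoid)
  open import Algebra.Properties.CommutativeMonoid.Sum +-0-commutativeMonoid using (sum; sum-permute; ∑-distrib-+)
  open import Data.Bool as Bool using (Bool; true; false; not)
  open import Data.Bool.Properties using (¬-not)
  open import Data.Empty using (⊥; ⊥-elim)
  open import Data.Fin as Fin using (Fin; zero; suc)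
  import Data.Fin.Properties as Fin
  open import Data.Fin.Permutation using (permutation)
  open import Data.Fin.Subset using () renaming (∣_∣ to card; _∈_ to _∈ₛ_)
  open import Data.List using (List; []; _∷_; allFin)
  open import Data.List.Membership.Propositional using (_∈_)
  open import Data.List.Membership.Propositional.Properties using (∈-allFin)
  open import Data.List.Relation.Unary.Any using (here; there)
  open import Data.Nat as ℕ using (ℕ; zero; suc; _+_; _≤_; _<_; z≤n; s≤s)
  import Data.Nat.Properties as ℕ
  open import Data.Product using (∃-syntax; _×_; _,_; proj₁; proj₂)
  open import Data.Sum using (_⊎_; inj₁; inj₂; [_,_]′)
  open import Data.Vec using (tabulate)
  open import Data.Vec.Properties using (lookup∘tabulate; lookup⇒[]=; []=⇒lookup)
  open import Function using (_∘_; id)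
  open import Relation.Nullary using (Dec; yes; no; ¬_)
  open import Relation.Nullary.Decidable using (_×-dec_)
  open import Relation.Unary using (Decidable)
  open import Relation.Binary.Construct.Closure.ReflexiveTransitive using (Star; ε; _◅_)
  open import Relation.Binary using (Tri; tri<; tri≈; tri>)
  open import Relation.Binary.PropositionalEquality
  open Defs using (Graph; Adj; adj?; symm; irrefl; Unicyclic; Connected; WellCovered)
  open Weighted using (_[_≔_]; update-≡; update-≢; update-elim)
  open Cycles

  sum-strict : ∀ {n} {f g : Fin n → ℕ} → (∀ u → f u ≤ g u) → ∀ v → f v < g v → sum f < sum g
  sum-strict {n} {f} {g} le v lt = subst (_≤ sum g)
    (ℕ.+-cancelʳ-≡ (f v) _ _ (trans (sum-update f v) (ℕ.+-suc (sum f) (f v))))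
    (sum-mono λ u → update-elim {P = _≤ g u} f v u (λ { refl → lt }) (λ _ → le u))

  count-mono : ∀ {n} {S T : Fin n → Bool} → (∀ v → S v ≡ true → T v ≡ true) → count S ≤ count T
  count-mono {S = S} {T} S⊆T = sum-mono λ u → go u (S u) refl
    where
    go : ∀ u b → S u ≡ b → indicator b ≤ indicator (T u)
    go u false _  = z≤n
    go u true  eq = ℕ.≤-reflexive (cong indicator (sym (S⊆T u eq)))

  count-full : ∀ n → count {n} (λ _ → true) ≡ n
  count-full zero    = refl
  count-full (suc n) = cong suc (count-full n)

  card-tabulate : ∀ {n} (S : Fin n → Bool) → card (tabulate S) ≡ count S
  card-tabulate {zero}  S = refl
  card-tabulate {suc n} S with S zero
  ... | true  = cong suc (card-tabulate (S ∘ suc))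
  ... | false = card-tabulate (S ∘ suc)

  sum-involution : ∀ {n} (π : Fin n → Fin n) → (∀ v → π (π v) ≡ v) → ∀ f → sum (f ∘ π) ≡ sum f
  sum-involution π π-invol f = sym (sum-permute f (permutation π π π-invol π-invol))

  ∈-tabulate : ∀ {n} {S : Fin n → Bool} {v} → S v ≡ true → v ∈ₛ tabulate S
  ∈-tabulate {S = S} {v} eq = lookup⇒[]= v (tabulate S) (trans (lookup∘tabulate S v) eq)

  tabulate-∈ : ∀ {n} {S : Fin n → Bool} {v} → v ∈ₛ tabulate S → S v ≡ true
  tabulate-∈ {S = S} {v} v∈ = trans (sym (lookup∘tabulate S v)) ([]=⇒lookup v∈)

  module _ {n} (G : Graph n) where

    VSet : Set
    VSet = Fin n → Bool

    Ind : VSet → Set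
    Ind S = ∀ {u v} → S u ≡ true → S v ≡ true → ¬ Adj G u v

    record Maximal (S : VSet) : Set where
      field
        ind       : Ind S
        dominated : ∀ v → S v ≡ true ⊎ ∃[ u ] S u ≡ true × Adj G v u

    insert-ind : ∀ {S} v → Ind S → (∀ {u} → S u ≡ true → ¬ Adj G v u) → Ind (S [ v ≔ true ])
    insert-ind {S} v ind off {a} {b} Sa Sb ab with a Fin.≟ v | b Fin.≟ v
    ... | yes refl | yes refl = irrefl G refl ab
    ... | yes refl | no _     = off Sb ab
    ... | no _     | yes refl = off Sa (symm G ab)
    ... | no _     | no _     = ind Sa Sb ab

    ∈-insert : ∀ (S : VSet) v u → S u ≡ true → (S [ v ≔ true ]) u ≡ true
    ∈-insert S v u Su = update-elim {P = _≡ true} S v u (λ _ → refl) (λ _ → Su)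

    insert-∈ : ∀ {S : VSet} {v u} → (S [ v ≔ true ]) u ≡ true → u ≡ v ⊎ S u ≡ true
    insert-∈ {S} {v} {u} = update-elim {P = λ b → b ≡ true → u ≡ v ⊎ S u ≡ true} S v u
      (λ u≡v _ → inj₁ u≡v) (λ _ → inj₂)

    private
      extend-over : ∀ us S → Ind S → ∃[ T ] Ind T × (∀ v → S v ≡ true → T v ≡ true)
        × (∀ v → v ∈ us → T v ≡ true ⊎ ∃[ u ] T u ≡ true × Adj G v u)
      extend-over []       S ind = S , ind , (λ _ Sv → Sv) , λ _ ()
      extend-over (u ∷ us) S ind with Fin.any? (λ w → (S w Bool.≟ true) ×-dec adj? G u w)
      ... | yes (w , Sw , uw) with extend-over us S ind
      ...   | T , indT , S⊆T , dom = T , indT , S⊆T , λ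
        { v (here refl) → inj₂ (w , S⊆T w Sw , uw) ; v (there v∈) → dom v v∈ }
      extend-over (u ∷ us) S ind | no none
        with extend-over us (S [ u ≔ true ]) (insert-ind u ind (λ Sw uw → none (_ , Sw , uw)))
      ...   | T , indT , S⊆T , dom = T , indT , (λ v Sv → S⊆T v (∈-insert S u v Sv)) , λ
        { v (here refl) → inj₁ (S⊆T u (update-≡ S u)) ; v (there v∈) → dom v v∈ }

    extend : ∀ S → Ind S → ∃[ T ] Maximal T × (∀ v → S v ≡ true → T v ≡ true)
    extend S ind with extend-over (allFin n) S ind
    ... | T , indT , S⊆T , dom = T , record { ind = indT ; dominated = λ v → dom v (∈-allFin v) } , S⊆T

    module _ (covered : WellCovered G) where

      same-count : ∀ {S T} → Maximal S → Maximal T → count S ≡ count T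
      same-count {S} {T} mS mT = trans (sym (card-tabulate S))
        (trans (covered (tabulate S) (tabulate T) (maximal mS) (maximal mT)) (card-tabulate T))
        where
        maximal : ∀ {S} → Maximal S → Defs.MaximalIndependent G (tabulate S)
        maximal {S} m = (λ u v u∈ v∈ → Maximal.ind m (tabulate-∈ u∈) (tabulate-∈ v∈))
          , λ T indT S⊆T {v} v∈T → ∈-tabulate (outside T indT S⊆T v∈T (Maximal.dominated m v))
          where
          outside : ∀ T → Defs.Independent G T → (∀ {u} → u ∈ₛ tabulate S → u ∈ₛ T) → ∀ {v} → v ∈ₛ T →
            S v ≡ true ⊎ ∃[ u ] S u ≡ true × Adj G v u → S v ≡ true
          outside T indT S⊆T v∈T (inj₁ Sv)           = Sv
          outside T indT S⊆T v∈T (inj₂ (u , Su , vu)) = ⊥-elim (indT _ u v∈T (S⊆T (∈-tabulate Su)) vu)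

      -- Otherwise v could be exchanged for both c and c′.
      two-leaves : ∀ {S v c c′} → Maximal S → S v ≡ true → c ≢ c′ → ¬ Adj G c c′ →
        (∀ w → S w ≡ true → Adj G c w → w ≡ v) → (∀ w → S w ≡ true → Adj G c′ w → w ≡ v) →
        S c ≡ false → S c′ ≡ false → ⊥
      two-leaves {S} {v} {c} {c′} mS Sv c≢c′ cc′ only only′ Sc Sc′ = ℕ.<⇒≱ (ℕ.n<1+n (count S))
        (subst₂ _≤_ counted (same-count (proj₁ (proj₂ extended)) mS) (count-mono (proj₂ (proj₂ extended))))
        where
        v≢c : v ≢ c
        v≢c refl with () ← trans (sym Sv) Sc
        v≢c′ : v ≢ c′
        v≢c′ refl with () ← trans (sym Sv) Sc′
        S₁ = S [ v ≔ false ]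
        S₂ = S₁ [ c ≔ true ]
        S₃ = S₂ [ c′ ≔ true ]
        ind₁ : Ind S₁
        ind₁ {a} {b} Sa Sb = Maximal.ind mS (proj₂ (remove-∈ S {v} {a} Sa)) (proj₂ (remove-∈ S {v} {b} Sb))
        ind₂ : Ind S₂
        ind₂ = insert-ind c ind₁ λ {u} Su cu → proj₁ (remove-∈ S {v} {u} Su)
          (only u (proj₂ (remove-∈ S {v} {u} Su)) cu)
        ind₃ : Ind S₃
        ind₃ = insert-ind c′ ind₂ (λ {u} → off {u})
          where
          off : ∀ {u} → S₂ u ≡ true → ¬ Adj G c′ u
          off {u} Su c′u with u Fin.≟ c
          ... | yes refl = cc′ (symm G c′u)
          ... | no _     = proj₁ (remove-∈ S {v} {u} Su) (only′ u (proj₂ (remove-∈ S {v} {u} Su)) c′u)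
        counted : count S₃ ≡ suc (count S)
        counted = trans (count-insert S₂ (trans (update-≢ S₁ (c≢c′ ∘ sym)) (trans (update-≢ S (v≢c′ ∘ sym)) Sc′)))
          (cong suc (trans (count-insert S₁ (trans (update-≢ S (v≢c ∘ sym)) Sc)) (sym (count-remove S Sv))))
        extended = extend S₃ ind₃

      -- `S₀` contains exactly one vertex of every pair. It is carried along because it shows that
      -- the common size of the maximal independent sets is the number of pairs.
      record Matching (W : VSet) : Set where
        field
          π       : Fin n → Fin n
          π-in    : ∀ {v} → W v ≡ true → W (π v) ≡ true
          π-invol : ∀ {v} → W v ≡ true → π (π v) ≡ v
          π-adj   : ∀ {v} → W v ≡ true → Adj G v (π v)
          S₀      : VSet
          S₀⊆W    : ∀ {v} → S₀ v ≡ true → W v ≡ true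
          S₀-ind  : Ind S₀
          S₀-meets : ∀ {v} → W v ≡ true → S₀ (π v) ≡ not (S₀ v)

      module _ (unicyclic : Unicyclic G) where

        -- W arises from G by deleting the closed neighbourhood of the independent set I.
        record Residue (I W : VSet) : Set where
          field
            I-ind   : Ind I
            I-off   : ∀ {i w} → I i ≡ true → W w ≡ true → ¬ Adj G i w
            I∩W     : ∀ {w} → I w ≡ true → W w ≡ true → ⊥
            outside : ∀ u → W u ≡ false → I u ≡ true ⊎ ∃[ i ] I i ≡ true × Adj G u i
            no-isolated : ∀ w → W w ≡ true → ∃[ u ] W u ≡ true × Adj G w u

        module _ {I W : VSet} (res : Residue I W) where
          open Residue res

          -- Every deleted vertex belongs to `I` or has a neighbour in `I`. So the neighbours that a
          -- vertex of `W` has in an independent set containing `I` are again in `W`, and local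
          -- arguments in `W` become valid in G.
          neighbour-in-W : ∀ {S} → Ind S → (∀ v → I v ≡ true → S v ≡ true) →
            ∀ {w u} → W w ≡ true → S u ≡ true → Adj G w u → W u ≡ true
          neighbour-in-W {S} ind I⊆S {w} {u} Ww Su wu with W u in Wu
          ... | true  = refl
          ... | false with outside u Wu
          ...   | inj₁ Iu             = ⊥-elim (I-off Iu Ww (symm G wu))
          ...   | inj₂ (i , Ii , ui) = ⊥-elim (ind Su (I⊆S i Ii) ui)

          module _ {c} (Wc : W c ≡ true) (leaf : Leafish (Adj G) W c) where
            v : Fin n
            v = proj₁ (no-isolated c Wc)
            Wv : W v ≡ true
            Wv = proj₁ (proj₂ (no-isolated c Wc))
            cv : Adj G c v
            cv = proj₂ (proj₂ (no-isolated c Wc))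
            only-v : ∀ {w} → W w ≡ true → Adj G c w → w ≡ v
            only-v Ww cw = trans (proj₂ leaf _ Ww cw) (sym (proj₂ leaf v Wv cv))
            v≢c : v ≢ c
            v≢c eq = irrefl G (sym eq) cv

            I′ W′ : VSet
            I′ = I [ c ≔ true ]
            W′ = W [ c ≔ false ] [ v ≔ false ]

            W′⇒ : ∀ {w} → W′ w ≡ true → w ≢ v × w ≢ c × W w ≡ true
            W′⇒ {w} eq with remove-∈ (W [ c ≔ false ]) {v} {w} eq
            ... | w≢v , eq′ = w≢v , remove-∈ W {c} {w} eq′

            ⇒W′ : ∀ {w} → w ≢ v → w ≢ c → W w ≡ true → W′ w ≡ true
            ⇒W′ w≢v w≢c Ww = ∈-remove (W [ c ≔ false ]) w≢v (∈-remove W w≢c Ww)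

            residue′ : Residue I′ W′
            residue′ = record
              { I-ind = insert-ind c I-ind (λ Iu cu → I-off Iu Wc (symm G cu))
              ; I-off = λ {i} {w} → off {i} {w}
              ; I∩W = λ {w} → disjoint {w}
              ; outside = out
              ; no-isolated = no-iso
              }
              where
              off : ∀ {i w} → I′ i ≡ true → W′ w ≡ true → ¬ Adj G i w
              off {i} {w} Ii W′w iw with insert-∈ {I} {c} {i} Ii
              ... | inj₁ refl = proj₁ (W′⇒ {w} W′w) (only-v (proj₂ (proj₂ (W′⇒ {w} W′w))) iw)
              ... | inj₂ Ii′  = I-off Ii′ (proj₂ (proj₂ (W′⇒ {w} W′w))) iw
              disjoint : ∀ {w} → I′ w ≡ true → W′ w ≡ true → ⊥
              disjoint {w} Iw W′w with insert-∈ {I} {c} {w} Iw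
              ... | inj₁ refl = proj₁ (proj₂ (W′⇒ {w} W′w)) refl
              ... | inj₂ Iw′  = I∩W Iw′ (proj₂ (proj₂ (W′⇒ {w} W′w)))
              out : ∀ u → W′ u ≡ false → I′ u ≡ true ⊎ ∃[ i ] I′ i ≡ true × Adj G u i
              out u W′u = go (u Fin.≟ v) (u Fin.≟ c) (W u) refl
                where
                go : Dec (u ≡ v) → Dec (u ≡ c) → ∀ b → W u ≡ b → I′ u ≡ true ⊎ ∃[ i ] I′ i ≡ true × Adj G u i
                go (yes refl) _ _ _ = inj₂ (c , update-≡ I c , symm G cv)
                go (no _) (yes refl) _ _ = inj₁ (update-≡ I c)
                go (no u≢v) (no u≢c) true Wu with () ← trans (sym (⇒W′ u≢v u≢c Wu)) W′u
                go (no u≢v) (no u≢c) false Wu with outside u Wu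
                ... | inj₁ Iu            = inj₁ (∈-insert I c u Iu)
                ... | inj₂ (i , Ii , ui) = inj₂ (i , ∈-insert I c i Ii , ui)
              -- A vertex isolated by the deletion would be a second leaf at `v` beside `c`, which
              -- `two-leaves` excludes.
              no-iso : ∀ w → W′ w ≡ true → ∃[ u ] W′ u ≡ true × Adj G w u
              no-iso w W′w with Fin.any? (λ u → (W′ u Bool.≟ true) ×-dec adj? G w u)
              ... | yes found = found
              ... | no  none  = ⊥-elim (two-leaves mS Sv (w≢c ∘ sym)
                  (λ cw → w≢v (only-v Ww cw))
                  (λ x Sx cx → only-v (neighbour-in-W ind I⊆S Wc Sx cx) cx)
                  (λ x Sx wx → only-w (neighbour-in-W ind I⊆S Ww Sx wx) wx)
                  (excluded cv) (excluded wv))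
                where
                w≢v = proj₁ (W′⇒ {w} W′w)
                w≢c = proj₁ (proj₂ (W′⇒ {w} W′w))
                Ww  = proj₂ (proj₂ (W′⇒ {w} W′w))
                only-w : ∀ {x} → W x ≡ true → Adj G w x → x ≡ v
                only-w {x} Wx wx with x Fin.≟ v | x Fin.≟ c
                ... | yes x≡v | _        = x≡v
                ... | no _    | yes refl = ⊥-elim (w≢v (only-v Ww (symm G wx)))
                ... | no x≢v  | no x≢c   = ⊥-elim (none (x , ⇒W′ x≢v x≢c Wx , wx))
                wv : Adj G w v
                wv with no-isolated w Ww
                ... | x , Wx , wx = subst (Adj G w) (only-w Wx wx) wx
                extended = extend (I [ v ≔ true ]) (insert-ind v I-ind (λ Iu vu → I-off Iu Wv (symm G vu)))
                S  = proj₁ extended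
                mS = proj₁ (proj₂ extended)
                ind : Ind S
                ind = Maximal.ind mS
                I⊆S : ∀ u → I u ≡ true → S u ≡ true
                I⊆S u Iu = proj₂ (proj₂ extended) u (∈-insert I v u Iu)
                Sv : S v ≡ true
                Sv = proj₂ (proj₂ extended) v (update-≡ I v)
                excluded : ∀ {x} → Adj G x v → S x ≡ false
                excluded {x} xv with S x in Sx
                ... | false = refl
                ... | true  = ⊥-elim (ind Sx Sv xv)

            add-edge : Matching W′ → Matching W
            add-edge M = record
              { π = π ; π-in = π-in ; π-invol = π-invol ; π-adj = π-adj
              ; S₀ = S₀ ; S₀⊆W = λ {v} → S₀⊆W {v} ; S₀-ind = S₀-ind ; S₀-meets = S₀-meets }
              where
              module M = Matching M
              π : Fin n → Fin n
              π = M.π [ c ≔ v ] [ v ≔ c ]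
              S₀ : VSet
              S₀ = M.S₀ [ c ≔ true ]
              πv : π v ≡ c
              πv = update-≡ (M.π [ c ≔ v ]) v
              πc : π c ≡ v
              πc = trans (update-≢ (M.π [ c ≔ v ]) (v≢c ∘ sym)) (update-≡ M.π c)
              πw : ∀ {w} → w ≢ v → w ≢ c → π w ≡ M.π w
              πw w≢v w≢c = trans (update-≢ (M.π [ c ≔ v ]) w≢v) (update-≢ M.π w≢c)
              by-cases : {P : Fin n → Set} → P v → P c →
                (∀ {w} → w ≢ v → w ≢ c → W′ w ≡ true → P w) → ∀ {w} → W w ≡ true → P w
              by-cases Pv Pc Pw {w} Ww with w Fin.≟ v | w Fin.≟ c
              ... | yes refl | _        = Pv
              ... | no _     | yes refl = Pc
              ... | no w≢v   | no w≢c   = Pw w≢v w≢c (⇒W′ w≢v w≢c Ww)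
              π-in : ∀ {w} → W w ≡ true → W (π w) ≡ true
              π-in = by-cases {λ w → W (π w) ≡ true} (subst (λ u → W u ≡ true) (sym πv) Wc) (subst (λ u → W u ≡ true) (sym πc) Wv)
                (λ {w} w≢v w≢c W′w → subst (λ u → W u ≡ true) (sym (πw w≢v w≢c)) (proj₂ (proj₂ (W′⇒ {M.π w} (M.π-in W′w)))))
              π-invol : ∀ {w} → W w ≡ true → π (π w) ≡ w
              π-invol = by-cases {λ w → π (π w) ≡ w} (trans (cong π πv) πc) (trans (cong π πc) πv)
                (λ {w} w≢v w≢c W′w → trans (cong π (πw w≢v w≢c))
                  (let (e₁ , e₂ , _) = W′⇒ {M.π w} (M.π-in W′w) in trans (πw e₁ e₂) (M.π-invol W′w)))
              π-adj : ∀ {w} → W w ≡ true → Adj G w (π w)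
              π-adj = by-cases {λ w → Adj G w (π w)} (subst (Adj G v) (sym πv) (symm G cv)) (subst (Adj G c) (sym πc) cv)
                (λ {w} w≢v w≢c W′w → subst (Adj G w) (sym (πw w≢v w≢c)) (M.π-adj W′w))
              S₀c : S₀ c ≡ true
              S₀c = update-≡ M.S₀ c
              S₀v : S₀ v ≡ false
              S₀v = trans (update-≢ M.S₀ v≢c) (old _ refl)
                where
                old : ∀ b → M.S₀ v ≡ b → M.S₀ v ≡ false
                old false eq = eq
                old true  eq = ⊥-elim (proj₁ (W′⇒ {v} (M.S₀⊆W eq)) refl)
              S₀⊆W : ∀ {w} → S₀ w ≡ true → W w ≡ true
              S₀⊆W {w} Sw with insert-∈ {M.S₀} {c} {w} Sw
              ... | inj₁ refl = Wc
              ... | inj₂ Sw′  = proj₂ (proj₂ (W′⇒ {w} (M.S₀⊆W Sw′)))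
              S₀-ind : Ind S₀
              S₀-ind = insert-ind c M.S₀-ind λ {u} Su cu →
                let (u≢v , _ , Wu) = W′⇒ {u} (M.S₀⊆W Su) in u≢v (only-v Wu cu)
              S₀-meets : ∀ {w} → W w ≡ true → S₀ (π w) ≡ not (S₀ w)
              S₀-meets = by-cases {λ w → S₀ (π w) ≡ not (S₀ w)}
                (trans (cong S₀ πv) (trans S₀c (cong not (sym S₀v))))
                (trans (cong S₀ πc) (trans S₀v (cong not (sym S₀c))))
                (λ {w} w≢v w≢c W′w → trans (cong S₀ (πw w≢v w≢c))
                  (let (_ , e₂ , _) = W′⇒ {M.π w} (M.π-in W′w) in
                    trans (update-≢ M.S₀ e₂) (trans (M.S₀-meets W′w) (cong not (sym (update-≢ M.S₀ w≢c))))))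

        empty-matching : ∀ {W} → (∀ v → ¬ W v ≡ true) → Matching W
        empty-matching empty = record
          { π = id ; π-in = id ; π-invol = λ _ → refl ; π-adj = λ {v} Wv → ⊥-elim (empty v Wv)
          ; S₀ = λ _ → false ; S₀⊆W = λ () ; S₀-ind = λ ()
          ; S₀-meets = λ {v} Wv → ⊥-elim (empty v Wv) }

        module _ {I W : VSet} (res : Residue I W) (branch : ∀ v → W v ≡ true → Branch (Adj G) W v)
                 (nonempty : ∃[ v ] W v ≡ true) where
          open Residue res
          open Closed-walk

          private
            irr : ∀ {u} → ¬ Adj G u u
            irr = irrefl G refl

            walk : Closed-walk (Adj G) W
            walk = branch⇒closed-walk (Adj G) irr branch nonempty

            open Ring unicyclic walk

            k = len walk
            c = at walk

            ring-only = only-ring W (in-W walk) (λ v Wv _ → branch v Wv)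
            members   = proj₁ ring-only
            chordless : Chordless
            chordless = proj₁ (proj₂ ring-only)

          ring-count : count W ≡ k
          ring-count = proj₂ (proj₂ ring-only)

          private
            -- An independent set leaving three consecutive ring vertices with
            -- only the middle one dominated.
            long-ring : 6 ≤ k → ∀ j → j < k → Adj G (c 5) (c j) → ¬ Adj G (c 0) (c j) → ¬ Adj G (c 3) (c j) → ⊥
            long-ring 6≤k j j<k c5~cj c0≁cj c3≁cj = two-leaves mS S3
              (λ e → absurd (inj walk (<k 2 refl) (<k 4 refl) e))
              (not-chord 2 4 refl refl (λ ()))
              only only′
              (excluded (step walk (<k 3 refl))) (excluded (symm G (step walk (<k 4 refl))))
              where
              absurd : 2 ≢ 4
              absurd ()
              <k : ∀ a → (a ℕ.<ᵇ 6) ≡ true → a < k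
              <k a eq = ℕ.≤-trans (ℕ.<ᵇ⇒< a 6 (subst Bool.T (sym eq) _)) 6≤k
              not-chord : ∀ a b → (a ℕ.<ᵇ b) ≡ true → (b ℕ.<ᵇ 5) ≡ true → b ≢ suc a → ¬ Adj G (c a) (c b)
              not-chord a b a<b b<5 b≢ ab = [ b≢ , (λ (_ , eq) →
                  ℕ.<⇒≱ (ℕ.≤-trans (s≤s (ℕ.<ᵇ⇒< b 5 (subst Bool.T (sym b<5) _))) 6≤k) (ℕ.≤-reflexive (sym eq))) ]′
                (chordless (ℕ.<ᵇ⇒< a b (subst Bool.T (sym a<b) _))
                  (ℕ.≤-trans (ℕ.m≤n⇒m≤1+n (ℕ.<ᵇ⇒< b 5 (subst Bool.T (sym b<5) _))) 6≤k) ab)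
              J₁ = I [ c 0 ≔ true ]
              J₂ = J₁ [ c 3 ≔ true ]
              J₃ = J₂ [ c j ≔ true ]
              I-off′ : ∀ {a u} → a < k → I u ≡ true → ¬ Adj G (c a) u
              I-off′ a<k Iu au = I-off Iu (in-W walk a<k) (symm G au)
              0<k = <k 0 refl
              3<k = <k 3 refl
              ind₁ : Ind J₁
              ind₁ = insert-ind (c 0) I-ind (I-off′ 0<k)
              off₂ : ∀ {u} → J₁ u ≡ true → ¬ Adj G (c 3) u
              off₂ {u} Ju with insert-∈ {I} {c 0} {u} Ju
              ... | inj₁ refl = not-chord 0 3 refl refl (λ ()) ∘ symm G
              ... | inj₂ Iu   = I-off′ 3<k Iu
              off₃ : ∀ {u} → J₂ u ≡ true → ¬ Adj G (c j) u
              off₃ {u} Ju with insert-∈ {J₁} {c 3} {u} Ju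
              ... | inj₁ refl = c3≁cj ∘ symm G
              ... | inj₂ Ju′ with insert-∈ {I} {c 0} {u} Ju′
              ...   | inj₁ refl = c0≁cj ∘ symm G
              ...   | inj₂ Iu   = I-off′ j<k Iu
              extended = extend J₃ (insert-ind (c j) (insert-ind (c 3) ind₁ (λ {u} → off₂ {u})) (λ {u} → off₃ {u}))
              S  = proj₁ extended
              mS = proj₁ (proj₂ extended)
              ind : Ind S
              ind = Maximal.ind mS
              in-S = proj₂ (proj₂ extended)
              I⊆S : ∀ u → I u ≡ true → S u ≡ true
              I⊆S u Iu = in-S u (∈-insert J₂ (c j) u (∈-insert J₁ (c 3) u (∈-insert I (c 0) u Iu)))
              S0 : S (c 0) ≡ true
              S0 = in-S (c 0) (∈-insert J₂ (c j) (c 0) (∈-insert J₁ (c 3) (c 0) (update-≡ I (c 0))))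
              S3 : S (c 3) ≡ true
              S3 = in-S (c 3) (∈-insert J₂ (c j) (c 3) (update-≡ J₁ (c 3)))
              Sj : S (c j) ≡ true
              Sj = in-S (c j) (update-≡ J₂ (c j))
              excluded : ∀ {x} → Adj G x (c 3) → S x ≡ false
              excluded xv = ¬-not λ Sx → ind Sx S3 xv
              position : ∀ a {w} → a < k → S w ≡ true → Adj G (c a) w → ∃[ b ] b < k × w ≡ c b
              position a {w} a<k Sw aw = members w (neighbour-in-W res ind I⊆S (in-W walk a<k) Sw aw)
              Chord : ℕ → ℕ → Set
              Chord a b = b ≡ suc a ⊎ (a ≡ 0 × suc b ≡ k)
              near₂ : ∀ b → b < k → S (c b) ≡ true → Adj G (c 2) (c b) → Tri (b < 2) (b ≡ 2) (2 < b) → c b ≡ c 3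
              near₂ b b<k Sb ab (tri< b<2 _ _) = ⊥-elim (go (chordless b<2 (<k 2 refl) (symm G ab)))
                where
                go : Chord b 2 → ⊥
                go (inj₁ refl)     = ind S0 Sb (step walk (<k 1 refl))
                go (inj₂ (_ , eq)) = ℕ.<⇒≱ (<k 3 refl) (ℕ.≤-reflexive (sym eq))
              near₂ b b<k Sb ab (tri≈ _ refl _) = ⊥-elim (irr ab)
              near₂ b b<k Sb ab (tri> _ _ 2<b) = go (chordless 2<b b<k ab)
                where
                go : Chord 2 b → c b ≡ c 3
                go (inj₁ eq) = cong c eq
              near₄ : ∀ b → b < k → S (c b) ≡ true → Adj G (c 4) (c b) → Tri (b < 4) (b ≡ 4) (4 < b) → c b ≡ c 3
              near₄ b b<k Sb ab (tri< b<4 _ _) = go (chordless b<4 (<k 4 refl) (symm G ab))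
                where
                go : Chord b 4 → c b ≡ c 3
                go (inj₁ eq)       = cong c (ℕ.suc-injective (sym eq))
                go (inj₂ (_ , eq)) = ⊥-elim (ℕ.<⇒≱ (<k 5 refl) (ℕ.≤-reflexive (sym eq)))
              near₄ b b<k Sb ab (tri≈ _ refl _) = ⊥-elim (irr ab)
              near₄ b b<k Sb ab (tri> _ _ 4<b) = ⊥-elim (go (chordless 4<b b<k ab))
                where
                go : Chord 4 b → ⊥
                go (inj₁ refl) = ind Sb Sj c5~cj
              only : ∀ w → S w ≡ true → Adj G (c 2) w → w ≡ c 3
              only w Sw aw = let (b , b<k , eq) = position 2 (<k 2 refl) Sw aw in
                trans eq (near₂ b b<k (subst (λ w → S w ≡ true) eq Sw) (subst (Adj G (c 2)) eq aw) (ℕ.<-cmp b 2))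
              only′ : ∀ w → S w ≡ true → Adj G (c 4) w → w ≡ c 3
              only′ w Sw aw = let (b , b<k , eq) = position 4 (<k 4 refl) Sw aw in
                trans eq (near₄ b b<k (subst (λ w → S w ≡ true) eq Sw) (subst (Adj G (c 4)) eq aw) (ℕ.<-cmp b 4))

            four-ring : k ≡ 4 → Matching W
            four-ring k≡4 = record
              { π = π
              ; π-in = by-cases (λ v → W (π v) ≡ true) (in-π (c 0) π0 (W-c 1 refl)) (in-π (c 1) π1 (W-c 0 refl)) (in-π (c 2) π2 (W-c 3 refl)) (in-π (c 3) π3 (W-c 2 refl))
              ; π-invol = by-cases (λ v → π (π v) ≡ v) (trans (cong π π0) π1) (trans (cong π π1) π0) (trans (cong π π2) π3) (trans (cong π π3) π2)
              ; π-adj = by-cases (λ v → Adj G v (π v)) (adj-π (c 0) π0 (step walk (<k 1 refl))) (adj-π (c 1) π1 (symm G (step walk (<k 1 refl))))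
                  (adj-π (c 2) π2 (step walk (<k 3 refl))) (adj-π (c 3) π3 (symm G (step walk (<k 3 refl))))
              ; S₀ = S₀
              ; S₀⊆W = λ {v} → S₀⊆W {v}
              ; S₀-ind = insert-ind (c 2) (insert-ind (c 0) (λ ()) (λ ())) (λ {u} → off {u})
              ; S₀-meets = by-cases (λ v → S₀ (π v) ≡ not (S₀ v))
                  (meets (c 0) π0 S1 S0) (meets (c 1) π1 S0 S1) (meets (c 2) π2 S3 S2) (meets (c 3) π3 S2 S3)
              }
              where
              <k : ∀ a → (a ℕ.<ᵇ 4) ≡ true → a < k
              <k a eq = ℕ.≤-trans (ℕ.<ᵇ⇒< a 4 (subst Bool.T (sym eq) _)) (ℕ.≤-reflexive (sym k≡4))
              ne : ∀ a b → (a ℕ.<ᵇ 4) ≡ true → (b ℕ.<ᵇ 4) ≡ true → a ≢ b → c a ≢ c b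
              ne a b a<4 b<4 a≢b e = a≢b (inj walk (<k a a<4) (<k b b<4) e)
              W-c : ∀ a → (a ℕ.<ᵇ 4) ≡ true → W (c a) ≡ true
              W-c a a<4 = in-W walk (<k a a<4)
              p₀ p₁ p₂ π : Fin n → Fin n
              p₀ = id [ c 0 ≔ c 1 ]
              p₁ = p₀ [ c 1 ≔ c 0 ]
              p₂ = p₁ [ c 2 ≔ c 3 ]
              π  = p₂ [ c 3 ≔ c 2 ]
              π3 : π (c 3) ≡ c 2
              π3 = update-≡ p₂ (c 3)
              π2 : π (c 2) ≡ c 3
              π2 = trans (update-≢ p₂ (ne 2 3 refl refl (λ ()))) (update-≡ p₁ (c 2))
              π1 : π (c 1) ≡ c 0
              π1 = trans (update-≢ p₂ (ne 1 3 refl refl (λ ()))) (trans (update-≢ p₁ (ne 1 2 refl refl (λ ()))) (update-≡ p₀ (c 1)))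
              π0 : π (c 0) ≡ c 1
              π0 = trans (update-≢ p₂ (ne 0 3 refl refl (λ ()))) (trans (update-≢ p₁ (ne 0 2 refl refl (λ ())))
                     (trans (update-≢ p₀ (ne 0 1 refl refl (λ ()))) (update-≡ id (c 0))))
              T S₀ : VSet
              T  = (λ _ → false) [ c 0 ≔ true ]
              S₀ = T [ c 2 ≔ true ]
              S2 : S₀ (c 2) ≡ true
              S2 = update-≡ T (c 2)
              S0 : S₀ (c 0) ≡ true
              S0 = trans (update-≢ T (ne 0 2 refl refl (λ ()))) (update-≡ (λ _ → false) (c 0))
              S1 : S₀ (c 1) ≡ false
              S1 = trans (update-≢ T (ne 1 2 refl refl (λ ()))) (update-≢ (λ _ → false) (ne 1 0 refl refl (λ ())))
              S3 : S₀ (c 3) ≡ false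
              S3 = trans (update-≢ T (ne 3 2 refl refl (λ ()))) (update-≢ (λ _ → false) (ne 3 0 refl refl (λ ())))
              in-π : ∀ v {u} → π v ≡ u → W u ≡ true → W (π v) ≡ true
              in-π v refl Wu = Wu
              adj-π : ∀ v {u} → π v ≡ u → Adj G v u → Adj G v (π v)
              adj-π v refl a = a
              meets : ∀ v {u b} → π v ≡ u → S₀ u ≡ not b → S₀ v ≡ b → S₀ (π v) ≡ not (S₀ v)
              meets v refl Su Sv = trans Su (cong not (sym Sv))
              off : ∀ {u} → T u ≡ true → ¬ Adj G (c 2) u
              off {u} Tu with insert-∈ {λ _ → false} {c 0} {u} Tu
              ... | inj₁ refl = λ a → chord (chordless (s≤s z≤n) (<k 2 refl) (symm G a))
                where
                chord : 2 ≡ 1 ⊎ (0 ≡ 0 × 3 ≡ k) → ⊥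
                chord (inj₁ ())
                chord (inj₂ (_ , eq)) with () ← trans eq k≡4
              S₀⊆W : ∀ {v} → S₀ v ≡ true → W v ≡ true
              S₀⊆W {v} Sv with insert-∈ {T} {c 2} {v} Sv
              ... | inj₁ refl = W-c 2 refl
              ... | inj₂ Tv with insert-∈ {λ _ → false} {c 0} {v} Tv
              ...   | inj₁ refl = W-c 0 refl
              by-cases : (P : Fin n → Set) → P (c 0) → P (c 1) → P (c 2) → P (c 3) → ∀ {v} → W v ≡ true → P v
              by-cases P P0 P1 P2 P3 {v} Wv with members v Wv
              ... | 0 , _ , refl = P0
              ... | 1 , _ , refl = P1
              ... | 2 , _ , refl = P2
              ... | 3 , _ , refl = P3
              ... | suc (suc (suc (suc b))) , lt , refl = ⊥-elim (ℕ.<⇒≱ lt (subst (_≤ 4 + b) (sym k≡4) (ℕ.m≤m+n 4 b)))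

          -- The even order matters, as cycles of length 3, 5 and 7 are well-covered. The vertex
          -- that excludes `c 5` is `c 0` if the length is 6, and `c 6` if it is at least 8.
          ring-matching : ∀ m → count W ≡ m + m → Matching W
          ring-matching m eq = go m (trans (sym ring-count) eq)
            where
            go : ∀ m → k ≡ m + m → Matching W
            go 0 eq = ⊥-elim (ℕ.<⇒≱ (s≤s z≤n) (subst (3 ≤_) eq (3≤len walk)))
            go 1 eq = ⊥-elim (ℕ.<⇒≱ (s≤s (s≤s (s≤s z≤n))) (subst (3 ≤_) eq (3≤len walk)))
            go 2 eq = four-ring eq
            go 3 eq = ⊥-elim (long-ring (ℕ.≤-reflexive (sym eq)) 0 (ℕ.≤-trans (s≤s z≤n) (3≤len walk))
              (close walk (sym eq)) irr (λ a → chord (chordless (s≤s z≤n) (subst (3 <_) (sym eq) (s≤s (s≤s (s≤s (s≤s z≤n))))) (symm G a))))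
              where
              chord : 3 ≡ 1 ⊎ (0 ≡ 0 × 4 ≡ k) → ⊥
              chord (inj₁ ())
              chord (inj₂ (_ , e)) with () ← trans e eq
            go (suc (suc (suc (suc m)))) eq = ⊥-elim (long-ring (ℕ.≤-trans (ℕ.m≤m+n 6 2) 8≤k) 6 6<k (step walk 6<k)
              (λ a → chord₀ (chordless (s≤s z≤n) 6<k a)) (λ a → chord₃ (chordless (s≤s (s≤s (s≤s (s≤s z≤n)))) 6<k a)))
              where
              8≤k : 8 ≤ k
              8≤k = subst (8 ≤_) (sym eq) (ℕ.+-mono-≤ (ℕ.m≤m+n 4 m) (ℕ.m≤m+n 4 m))
              6<k : 6 < k
              6<k = ℕ.≤-trans (ℕ.m≤m+n 7 1) 8≤k
              chord₀ : 6 ≡ 1 ⊎ (0 ≡ 0 × 7 ≡ k) → ⊥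
              chord₀ (inj₁ ())
              chord₀ (inj₂ (_ , e)) = ℕ.<⇒≱ 8≤k (ℕ.≤-reflexive (sym e))
              chord₃ : 6 ≡ 4 ⊎ (3 ≡ 0 × 7 ≡ k) → ⊥
              chord₃ (inj₁ ())

        -- Each deletion takes away two vertices, so the parity on which the case of the ring
        -- depends is preserved.
        matching : ∀ m {I W} → Residue I W → count W ≡ m + m → Matching W
        matching m {I} {W} res eq with Fin.any? leafish?
          where
          leafish? : Decidable (λ v → W v ≡ true × Leafish (Adj G) W v)
          leafish? v with W v Bool.≟ true | leafish-or-branch (Adj G) (adj? G) W v
          ... | no  ¬Wv | _       = no (¬Wv ∘ proj₁)
          ... | yes Wv  | inj₁ l  = yes (Wv , l)
          ... | yes _   | inj₂ br = no λ (_ , l) → Leafish⇒¬Branch (Adj G) {W} {v} l br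
        ... | yes (c , Wc , leaf) = add-edge res Wc leaf (recurse m eq)
          where
          two-less : count W ≡ suc (suc (count (W′ res Wc leaf)))
          two-less = trans (count-remove W Wc)
            (cong suc (count-remove (W [ c ≔ false ]) (∈-remove W (v≢c res Wc leaf) (Wv res Wc leaf))))
          recurse : ∀ m → count W ≡ m + m → Matching (W′ res Wc leaf)
          recurse zero    eq with () ← trans (sym two-less) eq
          recurse (suc m) eq = matching m (residue′ res Wc leaf)
            (ℕ.suc-injective (trans (ℕ.suc-injective (trans (sym two-less) eq)) (ℕ.+-suc m m)))
        ... | no ¬leaf with Fin.any? (λ v → W v Bool.≟ true)
        ...   | no  none     = empty-matching (λ v Wv → none (v , Wv))
        ...   | yes nonempty = ring-matching res branch nonempty m eq
          where
          branch : ∀ v → W v ≡ true → Branch (Adj G) W v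
          branch v Wv with leafish-or-branch (Adj G) (adj? G) W v
          ... | inj₁ l  = ⊥-elim (¬leaf (v , Wv , l))
          ... | inj₂ br = br

    module _ (connected : Connected G) where

      -- Connectivity in the form that survives the deletion of leaves: in place of walks there are
      -- edges that cross a given division of the vertices.
      cut-edge : ∀ (P : VSet) {u v} → P u ≡ true → P v ≡ false →
        ∃[ a ] ∃[ b ] P a ≡ true × P b ≡ false × Adj G a b
      cut-edge P {u} {v} = along (connected u v)
        where
        along : ∀ {u v} → Star (Adj G) u v → P u ≡ true → P v ≡ false →
          ∃[ a ] ∃[ b ] P a ≡ true × P b ≡ false × Adj G a b
        along ε Pu Pv with () ← trans (sym Pu) Pv
        along {u} (_◅_ {j = w} uw rest) Pu Pv = go (P w) refl
          where
          go : ∀ b → P w ≡ b → ∃[ a ] ∃[ b ] P a ≡ true × P b ≡ false × Adj G a b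
          go true  Pw = along rest Pw Pv
          go false Pw = u , w , Pu , Pw , uw

      module _ (covered : WellCovered G) (unicyclic : Unicyclic G) (2≤n : 2 ≤ n) where

        private
          other : ∀ {n} → 2 ≤ n → (w : Fin n) → ∃[ u ] u ≢ w
          other (s≤s (s≤s _)) zero    = suc zero , λ ()
          other (s≤s _)       (suc w) = zero , λ ()

          whole : Residue covered unicyclic (λ _ → false) (λ _ → true)
          whole = record
            { I-ind = λ () ; I-off = λ () ; I∩W = λ () ; outside = λ _ ()
            ; no-isolated = λ w _ → no-iso w (other 2≤n w) }
            where
            no-iso : ∀ w → ∃[ u ] u ≢ w → ∃[ u ] true ≡ true × Adj G w u
            no-iso w (u , u≢w) with connected w u
            ... | ε                  = ⊥-elim (u≢w refl)
            ... | _◅_ {j = x} wx _ = x , refl , wx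

        module _ m (n≡m+m : n ≡ m + m) where

          abstract
            M : Matching covered (λ _ → true)
            M = matching covered unicyclic m whole (trans (count-full n) n≡m+m)

          open Matching M using (S₀)

          partner : Fin n → Fin n
          partner = Matching.π M

          partner-invol : ∀ v → partner (partner v) ≡ v
          partner-invol v = Matching.π-invol M {v} refl

          partner-adj : ∀ v → Adj G v (partner v)
          partner-adj v = Matching.π-adj M {v} refl

          private
            S₀-maximal : Maximal S₀
            S₀-maximal = record { ind = Matching.S₀-ind M ; dominated = λ v → go v (S₀ v) refl }
              where
              go : ∀ v b → S₀ v ≡ b → S₀ v ≡ true ⊎ ∃[ u ] S₀ u ≡ true × Adj G v u
              go v true  eq = inj₁ eq
              go v false eq = inj₂ (partner v , trans (Matching.S₀-meets M {v} refl) (cong not eq) , partner-adj v)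

            hits : VSet → Fin n → ℕ
            hits S v = indicator (S v) + indicator (S (partner v))

            sum-hits : ∀ S → sum (hits S) ≡ count S + count S
            sum-hits S = trans (∑-distrib-+ (indicator ∘ S) (indicator ∘ S ∘ partner))
              (cong (count S +_) (sum-involution partner partner-invol (indicator ∘ S)))

            hits≤1 : ∀ {S} → Ind S → ∀ v → hits S v ≤ 1
            hits≤1 {S} ind v = go (S v) (S (partner v)) refl refl
              where
              go : ∀ a b → S v ≡ a → S (partner v) ≡ b → indicator a + indicator b ≤ 1
              go true  true  p q = ⊥-elim (ind p q (partner-adj v))
              go true  false _ _ = s≤s z≤n
              go false true  _ _ = s≤s z≤n
              go false false _ _ = z≤n

            hits₀ : ∀ v → hits S₀ v ≡ 1
            hits₀ v = trans (cong (λ b → indicator (S₀ v) + indicator b) (Matching.S₀-meets M {v} refl)) (go (S₀ v))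
              where
              go : ∀ b → indicator b + indicator (not b) ≡ 1
              go true  = refl
              go false = refl

          -- All maximal independent sets have as many elements as S₀, so none of
          -- them misses a matching edge.
          meets-every-pair : ∀ {S} → Maximal S → ∀ v → S v ≡ true ⊎ S (partner v) ≡ true
          meets-every-pair {S} mS v = go (S v) (S (partner v)) refl refl
            where
            missed : hits S v ≡ 0 → ⊥
            missed eq = ℕ.<-irrefl
              (trans (sum-hits S) (trans (cong (λ k → k + k) (same-count covered mS S₀-maximal)) (sym (sum-hits S₀))))
              (sum-strict (λ u → subst (hits S u ≤_) (sym (hits₀ u)) (hits≤1 (Maximal.ind mS) u)) v
                (subst₂ _<_ (sym eq) (sym (hits₀ v)) (s≤s z≤n)))
            go : ∀ a b → S v ≡ a → S (partner v) ≡ b → S v ≡ true ⊎ S (partner v) ≡ true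
            go true  _     p _ = inj₁ p
            go false true  _ q = inj₂ q
            go false false p q = ⊥-elim (missed (cong₂ (λ a b → indicator a + indicator b) p q))

          -- Otherwise `a` and `b` lie in a maximal independent set that contains neither `v` nor
          -- its partner. The case a = b says that matching edges lie in no triangle.
          neighbours-adjacent : ∀ {v a b} → Adj G v a → Adj G (partner v) b → Adj G a b
          neighbours-adjacent {v} {a} {b} va pb with adj? G a b
          ... | yes ab = ab
          ... | no ¬ab = ⊥-elim ([ (λ Sv → ind Sv Sa va) , (λ Sp → ind Sp Sb pb) ]′ (meets-every-pair mS v))
            where
            J₀ : VSet
            J₀ = (λ _ → false) [ a ≔ true ] [ b ≔ true ]
            extended = extend J₀ (insert-ind b (insert-ind a (λ ()) (λ ()))
              λ {u} Ju bu → ¬ab (subst (λ u → Adj G u b) ([ id , (λ ()) ]′ (insert-∈ {λ _ → false} {a} {u} Ju)) (symm G bu)))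
            S  = proj₁ extended
            mS = proj₁ (proj₂ extended)
            ind : Ind S
            ind = Maximal.ind mS
            Sa : S a ≡ true
            Sa = proj₂ (proj₂ extended) a (∈-insert ((λ _ → false) [ a ≔ true ]) b a (update-≡ (λ _ → false) a))
            Sb : S b ≡ true
            Sb = proj₂ (proj₂ extended) b (update-≡ ((λ _ → false) [ a ≔ true ]) b)

-- Merging leaves until a ring of trees remains

module Strip where

  open import Data.Nat.Properties using (+-0-commutativeMonoid)
  open import Algebra.Properties.CommutativeMonoid.Sum +-0-commutativeMonoid using (sum; ∑-distrib-+)
    renaming (sum-cong-≗ to sum-cong)
  open import Data.Bool as Bool using (Bool; true; false; if_then_else_; _∧_)
  open import Data.Empty using (⊥; ⊥-elim)
  open import Data.Fin as Fin using (Fin; zero; suc)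
  import Data.Fin.Properties as Fin
  open import Data.List as List using (List; []; _∷_; map; allFin)
  import Data.List.Properties as List
  open import Data.List.Membership.Propositional using (_∈_; _∉_)
  open import Data.List.Membership.Propositional.Properties using (∈-allFin)
  import Data.List.Membership.DecPropositional as DecMembership
  open import Data.List.Relation.Unary.Any using (here; there)
  open import Data.List.Relation.Unary.All as All using (All; []; _∷_)
  open import Data.Nat as ℕ using (ℕ; zero; suc; z≤n; s≤s)
  open import Data.Nat.ListAction using () renaming (sum to listSum)
  import Data.Nat.Properties as ℕ
  open import Data.Product using (∃-syntax; _×_; _,_; proj₁; proj₂)
  open import Data.Rational hiding (_≟_)
  import Data.Rational.Properties as ℚ
  open import Data.Rational.Solver using (module +-*-Solver)
  import Data.Nat.Solver
  module NatSolver = Data.Nat.Solver.+-*-Solver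
  open import Data.Sum using (_⊎_; inj₁; inj₂; [_,_]′)
  open import Data.Unit using (⊤; tt)
  open import Function using (_∘_)
  open import Relation.Nullary using (Dec; yes; no; ¬_; does)
  open import Relation.Nullary.Decidable using (dec-true; dec-false)
  open import Relation.Unary using (Decidable)
  open import Relation.Binary.PropositionalEquality
  open Defs using (Graph; Adj; adj?; symm; irrefl; Unicyclic)
  open +-*-Solver using (solve; con; _:+_; _:*_; _:-_; :-_; _:=_)
  open Order
  open Trees
  open Weighted
  open PolyLink using (matrix; matrix-symm; Adj⇒matrix; matrix⇒Adj; ¬Adj⇒matrix; _^_)
  open Cycles
  open Covered using (sum-involution)
  open Closed-walk

  ^-+ : ∀ c j k → c ^ (j ℕ.+ k) ≡ c ^ j * c ^ k
  ^-+ c zero    k = sym (ℚ.*-identityˡ (c ^ k))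
  ^-+ c (suc j) k = trans (cong (c *_) (^-+ c j k)) (sym (ℚ.*-assoc c (c ^ j) (c ^ k)))

  ^>0 : ∀ {c} → 0ℚ < c → ∀ k → 0ℚ < c ^ k
  ^>0 0<c zero    = 0<1
  ^>0 0<c (suc k) = *>0 0<c (^>0 0<c k)

  -- In the graph star G* every vertex of G comes with its leaf, which gives it the
  -- factors 1 + x and x; all but the power of 1 + x is a function of - z = x / (1 + x).
  module Star-weights (x : ℚ) (0<c : 0ℚ < 1ℚ + x) (x≤0 : x ≤ 0ℚ) where

    c : ℚ
    c = 1ℚ + x

    private instance
      c-pos = positive 0<c
      c-nz  = ℚ.pos⇒nonZero c

    z : ℚ
    z = 1/ c * (- x)

    0≤z : 0ℚ ≤ z
    0≤z = *≥0 (ℚ.<⇒≤ (ℚ.positive⁻¹ (1/ c) {{ℚ.1/pos⇒pos c}})) (ℚ.neg-antimono-≤ x≤0)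

    x≡ : x ≡ - (z * c)
    x≡ = sym (trans (identity x c (1/ c)) (trans (cong (_* x) (ℚ.*-inverseʳ c)) (ℚ.*-identityˡ x)))
      where identity = solve 3 (λ x c d → :- (d :* (:- x) :* c) := (c :* d) :* x) refl

    open At z 0≤z public

    -- The weight of the root after the whole tree, in which every vertex has its own leaf, has been
    -- merged into it.
    ev : Tree → Weight
    ev single     = c , x
    ev (join s t) = join-weight (ev s) (ev t)

    ev-B : ∀ t → ev t ≡ (c ^ size t * B t , - (z * (c ^ size t * D t)))
    ev-B single     = cong₂ _,_ (i₁ c) (trans x≡ (i₂ z c))
      where
      i₁ = solve 1 (λ c → c := c :* con 1ℚ :* con 1ℚ) refl
      i₂ = solve 2 (λ z c → :- (z :* c) := :- (z :* (c :* con 1ℚ :* con 1ℚ))) refl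
    ev-B (join s t) = trans (cong₂ join-weight (ev-B s) (ev-B t)) (cong₂ _,_
      (trans (i₁ z (c ^ size s) (c ^ size t) (B s) (B t) (D t)) (cong (_* B (join s t)) (sym (^-+ c (size t) (size s)))))
      (trans (i₂ z (c ^ size s) (c ^ size t) (D s) (B t)) (cong (λ p → - (z * (p * D (join s t)))) (sym (^-+ c (size t) (size s))))))
      where
      i₁ = solve 6 (λ z p q b b′ d′ → p :* b :* (q :* b′ :+ (:- (z :* (q :* d′))))
        := q :* p :* (b :* (b′ :- z :* d′))) refl
      i₂ = solve 5 (λ z p q d b′ → (:- (z :* (p :* d))) :* (q :* b′) := :- (z :* (q :* p :* (d :* b′)))) refl

    ev>0⇒A>0 : ∀ t → 0ℚ < proj₁ (ev t) + proj₂ (ev t) → 0ℚ < A t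
    ev>0⇒A>0 t p = *-cancel>0 (^>0 0<c (size t))
      (subst (0ℚ <_) (trans (cong (λ w → proj₁ w + proj₂ w) (ev-B t)) (i z (c ^ size t) (B t) (D t))) p)
      where i = solve 4 (λ z p b d → p :* b :+ (:- (z :* (p :* d))) := p :* (b :- z :* d)) refl

    -- A state here distinguishes variants at the near end, whereas a `Pair` distinguishes variants
    -- at the far end; the four numbers are the same, transposed, up to a power of `c`.
    transfers-1 : ∀ ts → transfers (map ev ts) (1ℚ , 1ℚ)
      ≡ (c ^ sizes ts * proj₂ (colB ts) , c ^ sizes ts * arc ts)
    transfers-0 : ∀ ts → transfers (map ev ts) (0ℚ , 1ℚ)
      ≡ (c ^ sizes ts * proj₁ (colB ts) , c ^ sizes ts * proj₁ (colA ts))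
    private
      scaled : ∀ t ts b a → transfer (ev t) (c ^ sizes ts * b , c ^ sizes ts * a)
        ≡ (c ^ sizes (t ∷ ts) * (B t * a + 0ℚ * 0ℚ) , c ^ sizes (t ∷ ts) * (B t * a + (- (z * D t)) * b))
      scaled t ts b a = trans (cong (λ w → transfer w (q * b , q * a)) (ev-B t)) (cong₂ _,_
        (trans (i₁ p q (B t) a) (cong (_* (B t * a + 0ℚ * 0ℚ)) (sym (^-+ c (size t) (sizes ts)))))
        (trans (i₂ z p q (B t) (D t) a b) (cong (_* (B t * a + (- (z * D t)) * b)) (sym (^-+ c (size t) (sizes ts))))))
        where
        p = c ^ size t
        q = c ^ sizes ts
        i₁ = solve 4 (λ p q B a → p :* B :* (q :* a) := p :* q :* (B :* a :+ con 0ℚ :* con 0ℚ)) refl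
        i₂ = solve 7 (λ z p q B D a b → p :* B :* (q :* a) :+ (:- (z :* (p :* D))) :* (q :* b)
          := p :* q :* (B :* a :+ (:- (z :* D)) :* b)) refl

    transfers-1 []       = refl
    transfers-1 (t ∷ ts) = trans (cong (transfer (ev t)) (transfers-1 ts))
      (scaled t ts (proj₂ (colB ts)) (arc ts))
    transfers-0 []       = refl
    transfers-0 (t ∷ ts) = trans (cong (transfer (ev t)) (transfers-0 ts))
      (scaled t ts (proj₁ (colB ts)) (proj₁ (colA ts)))

    ring-weight≡ : ∀ t ts → ring-weight (map ev (t ∷ ts)) ≡ c ^ sizes (t ∷ ts) * ring (t ∷ ts)
    ring-weight≡ t ts = trans
      (cong₂ (λ w p → proj₁ w * proj₂ p + proj₂ w * proj₁ (transfers (map ev ts) (0ℚ , 1ℚ))) (ev-B t) (transfers-1 ts))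
      (trans (cong (λ p → c ^ size t * B t * (q * arc ts) + (- (z * (c ^ size t * D t))) * proj₁ p) (transfers-0 ts))
        (trans (i z (c ^ size t) q (B t) (D t) (arc ts) (proj₁ (colB ts)))
          (cong (_* ring (t ∷ ts)) (sym (^-+ c (size t) (sizes ts))))))
      where
      q = c ^ sizes ts
      i = solve 7 (λ z p q B D a b → p :* B :* (q :* a) :+ (:- (z :* (p :* D))) :* (q :* b)
        := p :* q :* (a :* B :- z :* (b :* D))) refl

    arc>0 : ∀ ts → 0ℚ < proj₂ (transfers (map ev ts) (1ℚ , 1ℚ)) → 0ℚ < arc ts
    arc>0 ts p = *-cancel>0 (^>0 0<c (sizes ts)) (subst (0ℚ <_) (cong proj₂ (transfers-1 ts)) p)

    -- Contracting the edge between two ring vertices without leaves gives the ring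
    -- with a single vertex of weight (1 + x , x) instead.
    ring-weight-contract : ∀ s t → ring-weight ((1ℚ , x) ∷ ev s ∷ ev t ∷ (1ℚ , x) ∷ [])
      ≡ ring-weight (map ev (single ∷ s ∷ t ∷ []))
    ring-weight-contract s t = i x (proj₁ (ev s)) (proj₂ (ev s)) (proj₁ (ev t)) (proj₂ (ev t))
      where
      i = solve 5 (λ x o i o′ i′ →
        let I = con 1ℚ
            O = con 0ℚ
        in I :* (o :* (o′ :* (I :* I :+ x :* I) :+ i′ :* (I :* I)) :+ i :* (o′ :* (I :* I :+ x :* I)))
           :+ x :* (o :* (o′ :* (I :* I :+ x :* O) :+ i′ :* (I :* I)))
           := (I :+ x) :* (o :* (o′ :* I :+ i′ :* I) :+ i :* (o′ :* I)) :+ x :* (o :* (o′ :* I :+ i′ :* O))) refl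

  seg : {A : Set} → (ℕ → A) → ℕ → ℕ → List A
  seg f a zero    = []
  seg f a (suc m) = f a ∷ seg f (suc a) m

  ∈-seg : ∀ {A : Set} (f : ℕ → A) a m {v} → v ∈ seg f a m → ∃[ b ] a ℕ.≤ b × b ℕ.< a ℕ.+ m × v ≡ f b
  ∈-seg f a (suc m) (here refl) = a , ℕ.≤-refl , ℕ.m<m+n a (s≤s z≤n) , refl
  ∈-seg f a (suc m) (there v∈) with ∈-seg f (suc a) m v∈
  ... | b , a<b , b< , eq = b , ℕ.<⇒≤ a<b , subst (b ℕ.<_) (sym (ℕ.+-suc a m)) b< , eq

  seg-∈ : ∀ {A : Set} (f : ℕ → A) a m {b} → a ℕ.≤ b → b ℕ.< a ℕ.+ m → f b ∈ seg f a m
  seg-∈ f a zero    {b} a≤b b< = ⊥-elim (ℕ.<⇒≱ b< (subst (ℕ._≤ b) (sym (ℕ.+-identityʳ a)) a≤b))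
  seg-∈ f a (suc m) {b} a≤b b< with ℕ.m≤n⇒m<n∨m≡n a≤b
  ... | inj₂ refl = here refl
  ... | inj₁ a<b  = there (seg-∈ f (suc a) m a<b (subst (b ℕ.<_) (ℕ.+-suc a m) b<))

  map-seg : ∀ {A B : Set} (g : A → B) (f : ℕ → A) a m → map g (seg f a m) ≡ seg (g ∘ f) a m
  map-seg g f a zero    = refl
  map-seg g f a (suc m) = cong (g (f a) ∷_) (map-seg g f (suc a) m)

  module _ {n} (G : Graph n) {W} (walk : Closed-walk (Adj G) W)
           (chordless : ∀ {a b} → a ℕ.< b → b ℕ.< len walk → Adj G (at walk a) (at walk b) →
             b ≡ suc a ⊎ (a ≡ 0 × suc b ≡ len walk)) where

    private
      k  = len walk
      at′ = at walk
      sy = matrix-symm G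

      at-∉ : ∀ a m → a ℕ.+ suc m ℕ.≤ k → at′ a ∉ seg at′ (suc a) m
      at-∉ a m le a∈ with ∈-seg at′ (suc a) m a∈
      ... | b , a<b , b< , eq = ℕ.<⇒≢ a<b (inj walk (ℕ.<-trans a<b b<k) b<k eq)
        where b<k = ℕ.<-≤-trans b< (subst (ℕ._≤ k) (ℕ.+-suc a m) le)

    induced-path : ∀ a m → a ≢ 0 → a ℕ.+ m ℕ.≤ k → InducedPath (matrix G) sy (seg at′ a m)
    induced-path a zero    _   _  = tt
    induced-path a (suc m) a≢0 le = at-∉ a m le , first m le
      , induced-path (suc a) m (λ ()) (subst (ℕ._≤ k) (ℕ.+-suc a m) le)
      where
      first : ∀ m → a ℕ.+ suc m ℕ.≤ k → FirstOnly (matrix G) sy (at′ a) (seg at′ (suc a) m)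
      first zero    _  = tt
      first (suc m) le = Adj⇒matrix G (step walk (ℕ.<-≤-trans (subst (suc a ℕ.<_) (sym (ℕ.+-suc a (suc m))) (s≤s (ℕ.m<m+n a (s≤s z≤n)))) le))
        , All.tabulate λ {v} v∈ → let (b , a+1<b , b< , eq) = ∈-seg at′ (suc (suc a)) m v∈ in
            ¬Adj⇒matrix G λ adj → [ (λ b≡ → ℕ.<⇒≢ a+1<b (sym b≡)) , (λ (a≡0 , _) → a≢0 a≡0) ]′
              (chordless (ℕ.<⇒≤ a+1<b) (ℕ.<-≤-trans b< (subst (ℕ._≤ k) (trans (ℕ.+-suc a (suc m)) (cong suc (ℕ.+-suc a m))) le))
                (subst (Adj G (at′ a)) eq adj))

    induced-ring : ∀ j → k ≡ suc (suc (suc j)) → InducedRing (matrix G) sy (seg at′ 0 (suc (suc (suc j))))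
    induced-ring j k≡ = at-∉ 0 (suc (suc j)) (ℕ.≤-reflexive (sym k≡))
      , Adj⇒matrix G (step walk (subst (1 ℕ.<_) (sym k≡) (s≤s (s≤s z≤n))))
      , last 2 j (s≤s (s≤s z≤n)) (sym k≡)
      , induced-path 1 (suc (suc j)) (λ ()) (ℕ.≤-reflexive (sym k≡))
      where
      last : ∀ a m → 2 ℕ.≤ a → a ℕ.+ suc m ≡ k → LastOnly (matrix G) sy (at′ 0) (seg at′ a (suc m))
      last a zero    _   eq = trans (matrix-symm G (at′ 0) (at′ a)) (Adj⇒matrix G (close walk (trans (ℕ.+-comm 1 a) eq)))
      last a (suc m) 2≤a eq = ¬Adj⇒matrix G (λ adj → [ (λ a≡1 → ℕ.<⇒≢ 2≤a (sym a≡1))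
          , (λ (_ , a+1≡k) → ℕ.<⇒≢ a+1<k a+1≡k) ]′
          (chordless (ℕ.≤-trans (s≤s z≤n) 2≤a) (ℕ.<⇒≤ a+1<k) adj))
        , last (suc a) m (ℕ.m≤n⇒m≤1+n 2≤a) (trans (sym (ℕ.+-suc a (suc m))) eq)
        where
        a+1<k : suc a ℕ.< k
        a+1<k = subst (suc a ℕ.<_) (trans (sym (ℕ.+-suc a (suc m))) eq) (s≤s (ℕ.m<m+n a (s≤s z≤n)))

  double-injective : ∀ a b → a ℕ.+ a ≡ b ℕ.+ b → a ≡ b
  double-injective zero    zero    _  = refl
  double-injective (suc a) (suc b) eq = cong suc (double-injective a b
    (ℕ.suc-injective (trans (sym (ℕ.+-suc a a)) (trans (ℕ.suc-injective eq) (ℕ.+-suc b b)))))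

  -- A `raw` vertex has its original weight; `tree t` is a vertex that has absorbed a whole tree
  -- together with its leaves; `gone` means merged into another vertex.
  data State : Set where
    gone raw : State
    tree     : Tree → State

  alive : State → Bool
  alive gone     = false
  alive raw      = true
  alive (tree _) = true

  -- The number of vertices of the graph that a state accounts for.
  extent : State → ℕ
  extent gone     = 0
  extent raw      = 1
  extent (tree t) = size t ℕ.+ size t

  module Stripping {n} (G : Graph n) (x : ℚ) (0<c : 0ℚ < 1ℚ + x) (x≤0 : x ≤ 0ℚ) where
    open Star-weights x 0<c x≤0 public

    private
      M  = matrix G
      sy = matrix-symm G

    weight : State → Weight
    weight gone     = absent
    weight raw      = 1ℚ , x
    weight (tree t) = ev t

    record Reduct (w : Fin n → Weight) : Set where
      field
        Z≡      : Z M (unit (λ _ → x)) ≡ Z M w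
        shearer : Shearer M sy (unit (λ _ → x)) → Shearer M sy w

    open Reduct public

    Reduct-cong : ∀ {w w′} → (∀ v → w v ≡ w′ v) → Reduct w → Reduct w′
    Reduct-cong eq r = record
      { Z≡ = trans (Z≡ r) (Z-cong M eq) ; shearer = λ sh → Shearer-cong M sy eq (shearer r sh) }

    Reduct-merge : ∀ {w c v} → c ≢ v → M c v ≡ true →
      (∀ u → M c u ≡ true → u ≢ v → proj₂ (w u) ≡ 0ℚ) → Reduct w → Reduct (merge M sy w c v)
    Reduct-merge c≢v cv other r = record
      { Z≡ = trans (Z≡ r) (Z-merge M sy c≢v cv other)
      ; shearer = λ sh → Shearer-merge M sy c≢v cv other (shearer r sh) }

    weight-merge : ∀ (s : Fin n → State) {c v p} → c ≢ v → weight p ≡ join-weight (weight (s v)) (weight (s c)) →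
      ∀ u → merge M sy (weight ∘ s) c v u ≡ weight ((s [ c ≔ gone ] [ v ≔ p ]) u)
    weight-merge s {c} {v} {p} c≢v eq u with u Fin.≟ v
    ... | yes refl = sym eq
    ... | no _ with u Fin.≟ c
    ...   | yes _ = refl
    ...   | no _  = refl

    vertex>0 : ∀ {w : Fin n → Weight} → Shearer M sy w → ∀ v → 0ℚ < proj₁ (w v) + proj₂ (w v)
    vertex>0 {w} sh v = subst (0ℚ <_) (Z-vertex M sy w v) (sh (λ u → does (u Fin.≟ v)))

    -- Each tree vertex accounts for a matched pair of vertices of G, also after a contraction;
    -- hence the doubled size in `order`.
    record Ring-of-trees : Set where
      field
        t₁ t₂ t₃ : Tree
        ts       : List Tree
        value    : Z M (unit (λ _ → x)) ≡ ring-weight (map ev (t₁ ∷ t₂ ∷ t₃ ∷ ts))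
        pos₁     : Pos t₁
        good     : Good (t₂ ∷ t₃ ∷ ts)
        order    : sizes (t₁ ∷ t₂ ∷ t₃ ∷ ts) ℕ.+ sizes (t₁ ∷ t₂ ∷ t₃ ∷ ts) ≡ n

    module Pendants (L : Fin n → Bool) (π : Fin n → Fin n) (π-invol : ∀ v → π (π v) ≡ v)
                    (L-adj : ∀ {v} → L v ≡ true → M v (π v) ≡ true)
                    (L-only : ∀ {v u} → L v ≡ true → M v u ≡ true → u ≡ π v)
                    (L-π : ∀ {v} → L v ≡ true → L (π v) ≡ false) where

      private
        choose : Bool → Bool → State
        choose a b = if a then gone else (if b then tree single else raw)

        partial : (Fin n → Bool) → Fin n → State
        partial D v = choose (L v ∧ D v) (L (π v) ∧ D (π v))

        ∧-false : ∀ b → b ∧ false ≡ false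
        ∧-false true  = refl
        ∧-false false = refl

        ∧-true : ∀ b → b ∧ true ≡ b
        ∧-true true  = refl
        ∧-true false = refl

        processed-step : ∀ D u → Reduct (weight ∘ partial D) → Reduct (weight ∘ partial (D [ u ≔ true ]))
        processed-step D u r = cases (L u) (D u) refl refl
          where
          D′ = D [ u ≔ true ]
          same-∧ : ∀ w → (w ≡ u → L u ≡ false ⊎ D u ≡ true) → L w ∧ D w ≡ L w ∧ D′ w
          same-∧ w h = update-elim {P = λ b → L w ∧ D w ≡ L w ∧ b} D u w
            (λ { refl → [ (λ Lu → trans (cong (_∧ D u) Lu) (cong (_∧ true) (sym Lu))) , cong (L u ∧_) ]′ (h refl) })
            (λ _ → refl)
          same : ∀ v → (L u ≡ false ⊎ D u ≡ true) → partial D v ≡ partial D′ v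
          same v h = cong₂ choose (same-∧ v (λ _ → h)) (same-∧ (π v) (λ _ → h))
          cases : ∀ a b → L u ≡ a → D u ≡ b → Reduct (weight ∘ partial D′)
          cases false _    Lu _  = Reduct-cong (λ v → cong weight (same v (inj₁ Lu))) r
          cases true true  _  Du = Reduct-cong (λ v → cong weight (same v (inj₂ Du))) r
          cases true false Lu Du = Reduct-cong
            (λ v → trans (weight-merge (partial D) {u} {π u} u≢πu single≡ v) (cong weight (after v)))
            (Reduct-merge u≢πu (L-adj Lu) (λ w uw w≢ → ⊥-elim (w≢ (L-only Lu uw))) r)
            where
            u≢πu : u ≢ π u
            u≢πu eq with () ← trans (sym Lu) (trans (cong L eq) (L-π Lu))
            at-u : partial D u ≡ raw
            at-u = cong₂ choose (trans (cong (L u ∧_) Du) (∧-false (L u))) (cong (_∧ D (π u)) (L-π Lu))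
            at-πu : partial D (π u) ≡ raw
            at-πu = cong₂ choose (cong (_∧ D (π u)) (L-π Lu))
              (trans (cong (λ v → L v ∧ D v) (π-invol u)) (trans (cong (L u ∧_) Du) (∧-false (L u))))
            single≡ : weight (tree single) ≡ join-weight (weight (partial D (π u))) (weight (partial D u))
            single≡ = sym (trans (cong₂ (λ p q → join-weight (weight p) (weight q)) at-πu at-u)
              (cong₂ _,_ (ℚ.*-identityˡ c) (ℚ.*-identityʳ x)))
            after : ∀ v → (partial D [ u ≔ gone ] [ π u ≔ tree single ]) v ≡ partial D′ v
            after v = update-elim {P = _≡ partial D′ v} (partial D [ u ≔ gone ]) (π u) v
              (λ { refl → sym (cong₂ choose (cong (_∧ D′ (π u)) (L-π Lu))
                     (trans (cong (λ v → L v ∧ D′ v) (π-invol u)) (cong₂ _∧_ Lu (update-≡ D u)))) })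
              (λ v≢πu → update-elim {P = _≡ partial D′ v} (partial D) u v
                (λ { refl → sym (cong (λ b → choose b (L (π u) ∧ D′ (π u))) (cong₂ _∧_ Lu (update-≡ D u))) })
                (λ v≢u → cong₂ choose (same-∧ v (λ v≡u → ⊥-elim (v≢u v≡u)))
                  (same-∧ (π v) (λ πv≡u → ⊥-elim (v≢πu (trans (sym (π-invol v)) (cong π πv≡u)))))))

      pruned : Fin n → State
      pruned v = choose (L v) (L (π v))

      pruned-reduct : Reduct (weight ∘ pruned)
      pruned-reduct = Reduct-cong (λ v → cong weight (all-done v)) (process (allFin n))
        where
        done : List (Fin n) → Fin n → Bool
        done []       = λ _ → false
        done (u ∷ us) = done us [ u ≔ true ]
        done-∈ : ∀ us {v} → v ∈ us → done us v ≡ true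
        done-∈ (u ∷ us) {v} v∈ = update-elim {P = _≡ true} (done us) u v (λ _ → refl)
          (λ v≢u → done-∈ us (tail v≢u v∈))
          where
          tail : v ≢ u → v ∈ u ∷ us → v ∈ us
          tail v≢u (here v≡u) = ⊥-elim (v≢u v≡u)
          tail _   (there v∈) = v∈
        all-done : ∀ v → partial (done (allFin n)) v ≡ pruned v
        all-done v = cong₂ choose
          (trans (cong (L v ∧_) (done-∈ (allFin n) (∈-allFin v))) (∧-true (L v)))
          (trans (cong (L (π v) ∧_) (done-∈ (allFin n) (∈-allFin (π v)))) (∧-true (L (π v))))
        process : ∀ us → Reduct (weight ∘ partial (done us))
        process []       = Reduct-cong (λ v → sym (cong weight (cong₂ choose (∧-false (L v)) (∧-false (L (π v))))))
          (record { Z≡ = refl ; shearer = λ sh → sh })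
        process (u ∷ us) = processed-step (done us) u (process us)

      pruned-gone : ∀ {v} → L v ≡ true → pruned v ≡ gone
      pruned-gone {v} Lv = cong (λ b → choose b (L (π v))) Lv

      pruned-single : ∀ {v} → L v ≡ false → L (π v) ≡ true → pruned v ≡ tree single
      pruned-single Lv Lπv = cong₂ choose Lv Lπv

      pruned-raw : ∀ {v} → L v ≡ false → L (π v) ≡ false → pruned v ≡ raw
      pruned-raw Lv Lπv = cong₂ choose Lv Lπv

      pruned-alive : ∀ {v} → alive (pruned v) ≡ true → L v ≡ false
      pruned-alive {v} = go (L v)
        where
        go : ∀ a → alive (choose a (L (π v))) ≡ true → a ≡ false
        go false _ = refl

      pruned-tree : ∀ {v t} → pruned v ≡ tree t → t ≡ single
      pruned-tree {v} = go (L v) (L (π v))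
        where
        go : ∀ a b {t} → choose a b ≡ tree t → t ≡ single
        go false true refl = refl

      pruned-raw⁻ : ∀ {v} → pruned v ≡ raw → L v ≡ false × L (π v) ≡ false
      pruned-raw⁻ {v} = go (L v) (L (π v))
        where
        go : ∀ a b → choose a b ≡ raw → a ≡ false × b ≡ false
        go false false _ = refl , refl

      -- On each matched pair the extents are 0 and 2 or 1 and 1. Adding the sum over the partners
      -- counts every pair twice, whence the cancellation at the end.
      pruned-extent : sum (extent ∘ pruned) ≡ n
      pruned-extent = double-injective _ _ (begin
        sum (extent ∘ pruned) ℕ.+ sum (extent ∘ pruned)
          ≡⟨ cong (sum (extent ∘ pruned) ℕ.+_) (sum-involution π π-invol (extent ∘ pruned)) ⟨
        sum (extent ∘ pruned) ℕ.+ sum (extent ∘ pruned ∘ π)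
          ≡⟨ ∑-distrib-+ (extent ∘ pruned) (extent ∘ pruned ∘ π) ⟨
        sum (λ v → extent (pruned v) ℕ.+ extent (pruned (π v)))
          ≡⟨ sum-cong pair ⟩
        sum (λ (_ : Fin n) → 2)
          ≡⟨ twos n ⟩
        n ℕ.+ n ∎)
        where
        open ≡-Reasoning
        twos : ∀ n → sum (λ (_ : Fin n) → 2) ≡ n ℕ.+ n
        twos zero    = refl
        twos (suc n) = trans (cong (2 ℕ.+_) (twos n)) (cong suc (sym (ℕ.+-suc n n)))
        by-cases : ∀ a b c → (a ≡ true → b ≡ false) → (b ≡ true → c ≡ false) → c ≡ a →
          extent (choose a b) ℕ.+ extent (choose b c) ≡ 2
        by-cases true  true  _ ab _ _    with () ← ab refl
        by-cases true  false _ _  _ refl = refl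
        by-cases false true  _ _  _ refl = refl
        by-cases false false _ _  _ refl = refl
        pair : ∀ v → extent (pruned v) ℕ.+ extent (pruned (π v)) ≡ 2
        pair v = by-cases (L v) (L (π v)) (L (π (π v))) L-π L-π (cong L (π-invol v))

    module Hanging (unicyclic : Unicyclic G) {W₀} (ring : Closed-walk (Adj G) W₀)
                   (shearer₀ : Shearer M sy (unit (λ _ → x)))
                   (bad : Fin n → Bool)
                   (bad-on-ring : ∀ {v} → bad v ≡ true → ∃[ a ] a ℕ.< len ring × v ≡ at ring a)
                   (bad-neighbour : ∀ {v w} → bad v ≡ true → Adj G v w → ∃[ a ] a ℕ.< len ring × w ≡ at ring a) where

      open Ring unicyclic ring using (Chordless; only-ring)

      OnRing : Fin n → Set
      OnRing v = ∃[ a ] a ℕ.< len ring × v ≡ at ring a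

      -- `linked` is connectivity of the remaining vertices, in terms of cuts. Bad vertices and
      -- their neighbours are on the ring, so stripping leaves off the ring never touches a bad
      -- vertex, and they stay `raw`.
      record Valid (s : Fin n → State) : Set where
        field
          reduct     : Reduct (weight ∘ s)
          ring-alive : ∀ {a} → a ℕ.< len ring → alive (s (at ring a)) ≡ true
          linked     : ∀ (P : Fin n → Bool) {u v} → alive (s u) ≡ true → P u ≡ true → alive (s v) ≡ true → P v ≡ false →
            ∃[ a ] ∃[ b ] alive (s a) ≡ true × P a ≡ true × alive (s b) ≡ true × P b ≡ false × Adj G a b
          raw⇒bad    : ∀ {v} → s v ≡ raw → bad v ≡ true
          bad⇒raw    : ∀ {v} → bad v ≡ true → s v ≡ raw
          pos-tree   : ∀ {v t} → s v ≡ tree t → Pos t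
          extents    : sum (extent ∘ s) ≡ n

      module Strip-leaf {s} (valid : Valid s) {ℓ} (ℓ-alive : alive (s ℓ) ≡ true) (ℓ-off : ¬ OnRing ℓ)
                        (leaf : Leafish (Adj G) (alive ∘ s) ℓ) where
        open Valid valid

        private
          is-ℓ : Fin n → Bool
          is-ℓ u = does (u Fin.≟ ℓ)

          is-ℓ-true : ∀ {u} → is-ℓ u ≡ true → u ≡ ℓ
          is-ℓ-true {u} eq with u Fin.≟ ℓ
          ... | yes u≡ℓ = u≡ℓ

          0<k : 0 ℕ.< len ring
          0<k = ℕ.≤-trans (s≤s z≤n) (3≤len ring)

          cut = linked is-ℓ {ℓ} {at ring 0} ℓ-alive (dec-true (ℓ Fin.≟ ℓ) refl) (ring-alive 0<k)
            (dec-false (at ring 0 Fin.≟ ℓ) (λ eq → ℓ-off (0 , 0<k , sym eq)))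

        b : Fin n
        b = proj₁ (proj₂ cut)

        private
          b-alive : alive (s b) ≡ true
          b-alive = proj₁ (proj₂ (proj₂ (proj₂ (proj₂ cut))))

          ℓ≢b : ℓ ≢ b
          ℓ≢b eq with () ← trans (sym (proj₁ (proj₂ (proj₂ (proj₂ (proj₂ (proj₂ cut)))))))
                             (dec-true (b Fin.≟ ℓ) (sym eq))

          ℓb : Adj G ℓ b
          ℓb = subst (λ a → Adj G a b) (is-ℓ-true (proj₁ (proj₂ (proj₂ (proj₂ cut)))))
            (proj₂ (proj₂ (proj₂ (proj₂ (proj₂ (proj₂ cut))))))

          only-b : ∀ {w} → alive (s w) ≡ true → Adj G ℓ w → w ≡ b
          only-b w-alive ℓw = trans (proj₂ leaf _ w-alive ℓw) (sym (proj₂ leaf b b-alive ℓb))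

          is-tree : ∀ {v} → alive (s v) ≡ true → bad v ≢ true → ∃[ t ] s v ≡ tree t
          is-tree {v} v-alive ¬bad = go (s v) refl v-alive
            where
            go : ∀ p → s v ≡ p → alive p ≡ true → ∃[ t ] s v ≡ tree t
            go raw      eq _ = ⊥-elim (¬bad (raw⇒bad eq))
            go (tree t) eq _ = t , eq

          ℓ-tree = is-tree ℓ-alive (λ bad-ℓ → ℓ-off (bad-on-ring bad-ℓ))
          b-tree = is-tree b-alive (λ bad-b → ℓ-off (bad-neighbour bad-b (symm G ℓb)))
          tℓ = proj₁ ℓ-tree
          tb = proj₁ b-tree

        s′ : Fin n → State
        s′ = s [ ℓ ≔ gone ] [ b ≔ tree (join tb tℓ) ]

        private
          s′b : s′ b ≡ tree (join tb tℓ)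
          s′b = update-≡ (s [ ℓ ≔ gone ]) b

          s′-other : ∀ {w} → w ≢ b → w ≢ ℓ → s′ w ≡ s w
          s′-other w≢b w≢ℓ = trans (update-≢ (s [ ℓ ≔ gone ]) w≢b) (update-≢ s w≢ℓ)

          s′ℓ : s′ ℓ ≡ gone
          s′ℓ = trans (update-≢ (s [ ℓ ≔ gone ]) ℓ≢b) (update-≡ s ℓ)

          s′-elim : (Q : Fin n → State → Set) → Q ℓ gone → Q b (tree (join tb tℓ)) →
            (∀ {w} → w ≢ b → w ≢ ℓ → Q w (s w)) → ∀ w → Q w (s′ w)
          s′-elim Q qℓ qb qw w = go (w Fin.≟ b) (w Fin.≟ ℓ)
            where
            go : Dec (w ≡ b) → Dec (w ≡ ℓ) → Q w (s′ w)
            go (yes refl) _          = subst (Q b) (sym s′b) qb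
            go (no _)     (yes refl) = subst (Q ℓ) (sym s′ℓ) qℓ
            go (no w≢b)   (no w≢ℓ)   = subst (Q w) (sym (s′-other w≢b w≢ℓ)) (qw w≢b w≢ℓ)

        alive′ : ∀ w → alive (s′ w) ≡ ((alive ∘ s) [ ℓ ≔ false ]) w
        alive′ = s′-elim (λ w p → alive p ≡ ((alive ∘ s) [ ℓ ≔ false ]) w)
          (sym (update-≡ (alive ∘ s) ℓ))
          (sym (trans (update-≢ (alive ∘ s) (ℓ≢b ∘ sym)) b-alive))
          (λ _ w≢ℓ → sym (update-≢ (alive ∘ s) w≢ℓ))

        fewer : count (alive ∘ s) ≡ suc (count (alive ∘ s′))
        fewer = trans (count-remove (alive ∘ s) ℓ-alive) (cong suc (sum-cong λ w → cong indicator (sym (alive′ w))))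

        private
          alive⇒ : ∀ {w} → alive (s′ w) ≡ true → w ≢ ℓ × alive (s w) ≡ true
          alive⇒ {w} eq = remove-∈ (alive ∘ s) {ℓ} {w} (trans (sym (alive′ w)) eq)

          ⇒alive : ∀ {w} → w ≢ ℓ → alive (s w) ≡ true → alive (s′ w) ≡ true
          ⇒alive {w} w≢ℓ eq = trans (alive′ w) (∈-remove (alive ∘ s) w≢ℓ eq)

          reduct′ : Reduct (weight ∘ s′)
          reduct′ = Reduct-cong (weight-merge s ℓ≢b
              (sym (cong₂ (λ p q → join-weight (weight p) (weight q)) (proj₂ b-tree) (proj₂ ℓ-tree))))
            (Reduct-merge ℓ≢b (Adj⇒matrix G ℓb) other reduct)
            where
            other : ∀ u → M ℓ u ≡ true → u ≢ b → proj₂ (weight (s u)) ≡ 0ℚ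
            other u ℓu u≢b = go (s u) refl
              where
              go : ∀ p → s u ≡ p → proj₂ (weight (s u)) ≡ 0ℚ
              go gone     eq = cong (proj₂ ∘ weight) eq
              go raw      eq = ⊥-elim (u≢b (only-b (cong alive eq) (matrix⇒Adj G ℓu)))
              go (tree _) eq = ⊥-elim (u≢b (only-b (cong alive eq) (matrix⇒Adj G ℓu)))

          linked′ : ∀ (P : Fin n → Bool) {u v} → alive (s′ u) ≡ true → P u ≡ true → alive (s′ v) ≡ true → P v ≡ false →
            ∃[ a ] ∃[ b ] alive (s′ a) ≡ true × P a ≡ true × alive (s′ b) ≡ true × P b ≡ false × Adj G a b
          linked′ P {u} {v} u-alive Pu v-alive Pv =
            go (linked P′ (proj₂ (alive⇒ u-alive)) (trans (P′≡ (proj₁ (alive⇒ u-alive))) Pu)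
                          (proj₂ (alive⇒ v-alive)) (trans (P′≡ (proj₁ (alive⇒ v-alive))) Pv))
            where
            -- The leaf is put on the side of its neighbour, so that no crossing edge ends in it.
            P′ : Fin n → Bool
            P′ = P [ ℓ ≔ P b ]
            P′≡ : ∀ {w} → w ≢ ℓ → P′ w ≡ P w
            P′≡ = update-≢ P
            P′ℓ : P′ ℓ ≡ P′ b
            P′ℓ = trans (update-≡ P ℓ) (sym (P′≡ (ℓ≢b ∘ sym)))
            go : ∃[ a ] ∃[ b ] alive (s a) ≡ true × P′ a ≡ true × alive (s b) ≡ true × P′ b ≡ false × Adj G a b →
              ∃[ a ] ∃[ b ] alive (s′ a) ≡ true × P a ≡ true × alive (s′ b) ≡ true × P b ≡ false × Adj G a b
            go (a , d , a-alive , Pa , d-alive , Pd , ad) = cases (a Fin.≟ ℓ) (d Fin.≟ ℓ)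
              where
              contra : P′ a ≡ P′ d → ⊥
              contra eq with () ← trans (sym Pa) (trans eq Pd)
              cases : Dec (a ≡ ℓ) → Dec (d ≡ ℓ) → _
              cases (yes refl) _ = ⊥-elim (contra (trans P′ℓ (cong P′ (sym (only-b d-alive ad)))))
              cases (no _) (yes refl) = ⊥-elim (contra (trans (cong P′ (only-b a-alive (symm G ad))) (sym P′ℓ)))
              cases (no a≢ℓ) (no d≢ℓ) = a , d , ⇒alive a≢ℓ a-alive , trans (sym (P′≡ a≢ℓ)) Pa
                , ⇒alive d≢ℓ d-alive , trans (sym (P′≡ d≢ℓ)) Pd , ad

          -- The sum of the two factors of `b` is its value as an induced subgraph of the reduced
          -- graph, and up to a positive power of 1 + x this is `A` of the joined tree.
          pos-tree′ : ∀ w {t} → s′ w ≡ tree t → Pos t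
          pos-tree′ = s′-elim (λ w p → ∀ {t} → p ≡ tree t → Pos t) (λ ())
            (λ { refl → join (pos-tree (proj₂ b-tree)) (pos-tree (proj₂ ℓ-tree))
                   (ev>0⇒A>0 (join tb tℓ) (subst (λ p → 0ℚ < proj₁ (weight p) + proj₂ (weight p)) s′b
                     (vertex>0 (shearer reduct′ shearer₀) b))) })
            (λ _ _ → pos-tree)

          extents′ : sum (extent ∘ s′) ≡ n
          extents′ = trans (sum-cong extent≡) (ℕ.+-cancelʳ-≡ (eb ℕ.+ eℓ) _ _ (begin
            sum f₂ ℕ.+ (eb ℕ.+ eℓ)
              ≡⟨ ℕ.+-assoc (sum f₂) eb eℓ ⟨
            sum f₂ ℕ.+ eb ℕ.+ eℓ
              ≡⟨ cong (λ k → sum f₂ ℕ.+ k ℕ.+ eℓ) (trans (sym (cong extent (proj₂ b-tree))) (sym (update-≢ (extent ∘ s) (ℓ≢b ∘ sym)))) ⟩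
            sum f₂ ℕ.+ f₁ b ℕ.+ eℓ
              ≡⟨ cong (ℕ._+ eℓ) (sum-update f₁ b) ⟩
            sum f₁ ℕ.+ (extent (tree (join tb tℓ))) ℕ.+ eℓ
              ≡⟨ cong (λ k → sum f₁ ℕ.+ k ℕ.+ eℓ) (shuffle (size tℓ) (size tb)) ⟩
            sum f₁ ℕ.+ (eb ℕ.+ eℓ) ℕ.+ eℓ
              ≡⟨ trans (ℕ.+-assoc (sum f₁) (eb ℕ.+ eℓ) eℓ) (trans (cong (sum f₁ ℕ.+_) (ℕ.+-comm (eb ℕ.+ eℓ) eℓ)) (sym (ℕ.+-assoc (sum f₁) eℓ (eb ℕ.+ eℓ)))) ⟩
            sum f₁ ℕ.+ eℓ ℕ.+ (eb ℕ.+ eℓ)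
              ≡⟨ cong (ℕ._+ (eb ℕ.+ eℓ)) (trans (cong (sum f₁ ℕ.+_) (sym (cong extent (proj₂ ℓ-tree)))) (sum-update (extent ∘ s) ℓ)) ⟩
            sum (extent ∘ s) ℕ.+ 0 ℕ.+ (eb ℕ.+ eℓ)
              ≡⟨ cong (ℕ._+ (eb ℕ.+ eℓ)) (trans (ℕ.+-identityʳ _) extents) ⟩
            n ℕ.+ (eb ℕ.+ eℓ) ∎))
            where
            open ≡-Reasoning
            eb = size tb ℕ.+ size tb
            eℓ = size tℓ ℕ.+ size tℓ
            f₁ f₂ : Fin n → ℕ
            f₁ = (extent ∘ s) [ ℓ ≔ 0 ]
            f₂ = f₁ [ b ≔ extent (tree (join tb tℓ)) ]
            extent≡ : ∀ w → extent (s′ w) ≡ f₂ w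
            extent≡ = s′-elim (λ w p → extent p ≡ f₂ w)
              (sym (trans (update-≢ f₁ ℓ≢b) (update-≡ (extent ∘ s) ℓ)))
              (sym (update-≡ f₁ b))
              (λ w≢b w≢ℓ → sym (trans (update-≢ f₁ w≢b) (update-≢ (extent ∘ s) w≢ℓ)))
            shuffle : ∀ a b → (a ℕ.+ b) ℕ.+ (a ℕ.+ b) ≡ (b ℕ.+ b) ℕ.+ (a ℕ.+ a)
            shuffle = NatSolver.solve 2 (λ a b → (a NatSolver.:+ b) NatSolver.:+ (a NatSolver.:+ b)
              NatSolver.:= (b NatSolver.:+ b) NatSolver.:+ (a NatSolver.:+ a)) refl

        valid′ : Valid s′
        valid′ = record
          { reduct = reduct′
          ; ring-alive = λ {a} a<k → ⇒alive (λ eq → ℓ-off (a , a<k , sym eq)) (ring-alive a<k)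
          ; linked = linked′
          ; raw⇒bad = λ {v} → s′-elim (λ w p → p ≡ raw → bad w ≡ true) (λ ()) (λ ()) (λ _ _ → raw⇒bad) v
          ; bad⇒raw = λ {v} → s′-elim (λ w p → bad w ≡ true → p ≡ raw)
              (λ bad-ℓ → ⊥-elim (ℓ-off (bad-on-ring bad-ℓ)))
              (λ bad-b → ⊥-elim (ℓ-off (bad-neighbour bad-b (symm G ℓb))))
              (λ _ _ → bad⇒raw) v
          ; pos-tree = λ {v} → pos-tree′ v
          ; extents = extents′
          }

      -- When no leaf off the ring remains, every remaining vertex off the ring has two remaining
      -- neighbours, and `only-ring` finishes.
      strip-all : ∀ m s → Valid s → count (alive ∘ s) ℕ.≤ m →
        ∃[ s′ ] Valid s′ × (∀ v → alive (s′ v) ≡ true → OnRing v) × Chordless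
      strip-all m s valid le with Fin.any? strippable?
        where
        strippable? : Decidable (λ v → alive (s v) ≡ true × ¬ OnRing v × Leafish (Adj G) (alive ∘ s) v)
        strippable? v with alive (s v) Bool.≟ true | ℕ.anyUpTo? (λ a → v Fin.≟ at ring a) (len ring)
                         | leafish-or-branch (Adj G) (adj? G) (alive ∘ s) v
        ... | no dead | _      | _       = no (dead ∘ proj₁)
        ... | yes _   | yes on | _       = no λ (_ , off , _) → off on
        ... | yes al  | no off | inj₁ l  = yes (al , off , l)
        ... | yes _   | no _   | inj₂ br = no λ (_ , _ , l) → Leafish⇒¬Branch (Adj G) {alive ∘ s} {v} l br
      ... | yes (ℓ , ℓ-alive , ℓ-off , leaf) = recurse m le
        where
        open Strip-leaf valid ℓ-alive ℓ-off leaf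
        recurse : ∀ m → count (alive ∘ s) ℕ.≤ m → ∃[ s′ ] Valid s′ × (∀ v → alive (s′ v) ≡ true → OnRing v) × Chordless
        recurse zero    le = ⊥-elim (ℕ.<⇒≱ (s≤s z≤n) (ℕ.≤-trans (ℕ.≤-reflexive (sym fewer)) le))
        recurse (suc m) le = strip-all m s′ valid′ (ℕ.≤-pred (ℕ.≤-trans (ℕ.≤-reflexive (sym fewer)) le))
      ... | no none = s , valid , proj₁ result , proj₁ (proj₂ result)
        where
        branch : ∀ v → alive (s v) ≡ true → (∀ a → a ℕ.< len ring → v ≢ at ring a) → Branch (Adj G) (alive ∘ s) v
        branch v v-alive off with leafish-or-branch (Adj G) (adj? G) (alive ∘ s) v
        ... | inj₁ l  = ⊥-elim (none (v , v-alive , (λ (a , a<k , eq) → off a a<k eq) , l))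
        ... | inj₂ br = br
        result = only-ring (alive ∘ s) (Valid.ring-alive valid) branch

      module Result {s} (valid : Valid s) (members : ∀ v → alive (s v) ≡ true → OnRing v) (chordless : Chordless) where
        open Valid valid

        private
          k = len ring
          c′ = at ring
          w : Fin n → Weight
          w = weight ∘ s

          3+ : ∃[ j ] k ≡ suc (suc (suc j))
          3+ = go k (3≤len ring)
            where
            go : ∀ k → 3 ℕ.≤ k → ∃[ j ] k ≡ suc (suc (suc j))
            go (suc (suc (suc j))) _ = j , refl
            go 1 (s≤s ())
            go 2 (s≤s (s≤s ()))

          j = proj₁ 3+
          k≡ : k ≡ suc (suc (suc j))
          k≡ = proj₂ 3+
          us : List (Fin n)
          us = seg c′ 0 (suc (suc (suc j)))

          dead : ∀ v → v ∉ us → s v ≡ gone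
          dead v v∉ = go (s v) refl
            where
            off : ∀ {p} → s v ≡ p → alive p ≡ true → ⊥
            off eq al with members v (trans (cong alive eq) al)
            ... | a , a<k , refl = v∉ (seg-∈ c′ 0 (suc (suc (suc j))) z≤n (subst (a ℕ.<_) k≡ a<k))
            go : ∀ p → s v ≡ p → s v ≡ gone
            go gone     eq = eq
            go raw      eq = ⊥-elim (off eq refl)
            go (tree _) eq = ⊥-elim (off eq refl)

          induced = induced-ring G ring chordless j k≡

        ring-value : Z M (unit (λ _ → x)) ≡ ring-weight (map w (seg c′ 0 (suc (suc (suc j)))))
        ring-value = trans (Z≡ reduct) (Z-ring M sy _ _ _ _ w induced (λ v v∉ → cong weight (dead v v∉)))

        path>0 : ∀ a m → a ≢ 0 → a ℕ.+ m ℕ.≤ k → 0ℚ < proj₂ (transfers (map w (seg c′ a m)) (1ℚ , 1ℚ))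
        path>0 a m a≢0 le = subst (0ℚ <_) (trans
          (Z-path M sy vs (_∣_ M sy w χ) (induced-path G ring chordless a m a≢0 le)
            (λ v v∉ → cong (λ b → if b then w v else absent) (dec-false (v ∈? vs) v∉)))
          (cong (λ ps → proj₂ (transfers ps (1ℚ , 1ℚ))) (List.map-cong-local (All.tabulate λ {v} v∈ →
            cong (λ b → if b then w v else absent) (dec-true (v ∈? vs) v∈)))))
          (shearer reduct shearer₀ χ)
          where
          open DecMembership (Fin._≟_ {n}) using (_∈?_)
          vs = seg c′ a m
          χ : Fin n → Bool
          χ v = does (v ∈? vs)

        private
          Distinct : List (Fin n) → Set
          Distinct []       = ⊤
          Distinct (v ∷ vs) = v ∉ vs × Distinct vs

          path-distinct : ∀ vs → InducedPath M sy vs → Distinct vs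
          path-distinct []       _             = tt
          path-distinct (v ∷ vs) (v∉ , _ , p) = v∉ , path-distinct vs p

          sum-list : ∀ vs (f : Fin n → ℕ) → Distinct vs → (∀ v → v ∉ vs → f v ≡ 0) → sum f ≡ listSum (map f vs)
          sum-list []       f _        zero-off = sum-0 (λ v → zero-off v λ ())
          sum-list (v ∷ vs) f (v∉ , d) zero-off = begin
            sum f                            ≡⟨ ℕ.+-identityʳ (sum f) ⟨
            sum f ℕ.+ 0                      ≡⟨ sum-update f v ⟨
            sum (f [ v ≔ 0 ]) ℕ.+ f v        ≡⟨ ℕ.+-comm _ (f v) ⟩
            f v ℕ.+ sum (f [ v ≔ 0 ])        ≡⟨ cong (f v ℕ.+_) (sum-list vs (f [ v ≔ 0 ]) d (λ u u∉ →
                  update-elim {P = _≡ 0} f v u (λ _ → refl) (λ u≢v → zero-off u λ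
                    { (here u≡v) → u≢v u≡v ; (there u∈) → u∉ u∈ }))) ⟩
            f v ℕ.+ listSum (map (f [ v ≔ 0 ]) vs)
              ≡⟨ cong (λ l → f v ℕ.+ listSum l) (map-update f vs v∉) ⟩
            f v ℕ.+ listSum (map f vs)      ∎
            where open ≡-Reasoning

        ring-extent : listSum (map (extent ∘ s) (seg c′ 0 (suc (suc (suc j))))) ≡ n
        ring-extent = trans (sym (sum-list us (extent ∘ s)
          (proj₁ induced , path-distinct (seg c′ 1 (suc (suc j))) (proj₂ (proj₂ (proj₂ induced))))
          (λ v v∉ → cong extent (dead v v∉)))) extents

        private
          tree-of : State → Tree
          tree-of (tree t) = t
          tree-of _        = single

          τ : ℕ → Tree
          τ a = tree-of (s (c′ a))

        module All-trees (no-bad : ∀ {a} → a ℕ.< k → bad (c′ a) ≢ true) where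

          private
            is-τ : ∀ {a} → a ℕ.< k → s (c′ a) ≡ tree (τ a)
            is-τ {a} a<k = go (s (c′ a)) refl (ring-alive a<k)
              where
              go : ∀ p → s (c′ a) ≡ p → alive p ≡ true → s (c′ a) ≡ tree (τ a)
              go raw      eq _ = ⊥-elim (no-bad a<k (raw⇒bad eq))
              go (tree t) eq _ = trans eq (cong tree (sym (cong tree-of eq)))

            along : ∀ {A : Set} (f : State → A) (g : Tree → A) → (∀ t → f (tree t) ≡ g t) →
              ∀ a m → a ℕ.+ m ℕ.≤ k → map (f ∘ s) (seg c′ a m) ≡ map g (seg τ a m)
            along f g eq a zero    _  = refl
            along f g eq a (suc m) le = cong₂ _∷_
              (trans (cong f (is-τ (ℕ.<-≤-trans (ℕ.m<m+n a (s≤s z≤n)) le))) (eq (τ a)))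
              (along f g eq (suc a) m (subst (ℕ._≤ k) (ℕ.+-suc a m) le))

            goods : ∀ a m → a ≢ 0 → a ℕ.+ m ℕ.≤ k → Good (seg τ a m)
            goods a zero    _   _  = []
            goods a (suc m) a≢0 le =
              (pos-tree (is-τ (ℕ.<-≤-trans (ℕ.m<m+n a (s≤s z≤n)) le))
              , arc>0 (seg τ a (suc m)) (subst (λ ps → 0ℚ < proj₂ (transfers ps (1ℚ , 1ℚ)))
                  (along weight ev (λ _ → refl) a (suc m) le) (path>0 a (suc m) a≢0 le)))
              ∷ goods (suc a) m (λ ()) (subst (ℕ._≤ k) (ℕ.+-suc a m) le)

            double : ∀ ts → listSum (map (λ t → size t ℕ.+ size t) ts) ≡ sizes ts ℕ.+ sizes ts
            double []       = refl
            double (t ∷ ts) = trans (cong ((size t ℕ.+ size t) ℕ.+_) (double ts)) (shuffle (size t) (sizes ts))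
              where
              shuffle : ∀ a b → (a ℕ.+ a) ℕ.+ (b ℕ.+ b) ≡ (a ℕ.+ b) ℕ.+ (a ℕ.+ b)
              shuffle = NatSolver.solve 2 (λ a b → (a NatSolver.:+ a) NatSolver.:+ (b NatSolver.:+ b)
                NatSolver.:= (a NatSolver.:+ b) NatSolver.:+ (a NatSolver.:+ b)) refl

            full : 0 ℕ.+ suc (suc (suc j)) ℕ.≤ k
            full = ℕ.≤-reflexive (sym k≡)

          ring-of-trees : Ring-of-trees
          ring-of-trees = record
            { t₁ = τ 0 ; t₂ = τ 1 ; t₃ = τ 2 ; ts = seg τ 3 j
            ; value = trans ring-value (cong ring-weight (along weight ev (λ _ → refl) 0 (suc (suc (suc j))) full))
            ; pos₁ = pos-tree (is-τ (ℕ.≤-trans (s≤s z≤n) full))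
            ; good = goods 1 (suc (suc j)) (λ ()) full
            ; order = trans (sym (double (seg τ 0 (suc (suc (suc j))))))
                (trans (cong listSum (sym (along extent (λ t → size t ℕ.+ size t) (λ _ → refl) 0 (suc (suc (suc j))) full))) ring-extent)
            }

        -- The ring is a 4-cycle with two adjacent vertices that have no leaves.
        module Four-ring (k≡4 : k ≡ 4) (raw₀ : s (c′ 0) ≡ raw) (raw₃ : s (c′ 3) ≡ raw) {t t′}
                         (tree₁ : s (c′ 1) ≡ tree t) (tree₂ : s (c′ 2) ≡ tree t′) where

          private
            states : ∀ {A : Set} (f : State → A) → map (f ∘ s) us ≡ f raw ∷ f (tree t) ∷ f (tree t′) ∷ f raw ∷ []
            states f = trans (cong (λ m → map (f ∘ s) (seg c′ 0 m)) (trans (sym k≡) k≡4))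
              (cong₂ _∷_ (cong f raw₀) (cong₂ _∷_ (cong f tree₁) (cong₂ _∷_ (cong f tree₂) (cong (λ p → f p ∷ []) raw₃))))

            u₀ u₁ : Fin n
            u₀ = c′ 0
            u₁ = c′ 1

            u₀u₁ : Adj G u₀ u₁
            u₀u₁ = Closed-walk.step ring (subst (1 ℕ.<_) (sym k≡) (s≤s (s≤s z≤n)))

            u₀∉ : u₀ ∉ u₁ ∷ []
            u₀∉ (here eq) = irrefl G eq u₀u₁

            -- The edge between the two ring vertices has the value 1 + 2 x, which is (1 + x) (1 -
            -- z).
            pos-single : Pos single
            pos-single = single (ev>0⇒A>0 single (subst (0ℚ <_) (trans
              (Z-path M sy (u₀ ∷ u₁ ∷ []) (_∣_ M sy (unit (λ _ → x)) χ) (u₀∉ , (Adj⇒matrix G u₀u₁ , []) , (λ ()) , tt , tt)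
                (λ v v∉ → cong (λ b → if b then (1ℚ , x) else absent) (dec-false (v ∈? (u₀ ∷ u₁ ∷ [])) v∉)))
              (trans (cong₂ (λ p q → proj₂ (transfers (p ∷ q ∷ []) (1ℚ , 1ℚ))) (present (here refl)) (present (there (here refl))))
                (i x))) (shearer₀ χ)))
              where
              open DecMembership (Fin._≟_ {n}) using (_∈?_)
              χ : Fin n → Bool
              χ v = does (v ∈? (u₀ ∷ u₁ ∷ []))
              present : ∀ {v} → v ∈ u₀ ∷ u₁ ∷ [] → _∣_ M sy (unit (λ _ → x)) χ v ≡ (1ℚ , x)
              present {v} v∈ = cong (λ b → if b then (1ℚ , x) else absent) (dec-true (v ∈? (u₀ ∷ u₁ ∷ [])) v∈)
              i : ∀ x → 1ℚ * (1ℚ * 1ℚ + x * 1ℚ) + x * (1ℚ * 1ℚ) ≡ 1ℚ + x + x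
              i = solve 1 (λ x → con 1ℚ :* (con 1ℚ :* con 1ℚ :+ x :* con 1ℚ) :+ x :* (con 1ℚ :* con 1ℚ) := con 1ℚ :+ x :+ x) refl

            arc₂>0 : 0ℚ < arc (t ∷ t′ ∷ [])
            arc₂>0 = arc>0 (t ∷ t′ ∷ []) (subst (λ ps → 0ℚ < proj₂ (transfers ps (1ℚ , 1ℚ)))
              (cong₂ (λ p q → weight p ∷ weight q ∷ []) tree₁ tree₂)
              (path>0 1 2 (λ ()) (subst (3 ℕ.≤_) (sym k≡4) (s≤s (s≤s (s≤s z≤n))))))

            arc₁>0 : 0ℚ < arc (t′ ∷ [])
            arc₁>0 = arc>0 (t′ ∷ []) (subst (λ ps → 0ℚ < proj₂ (transfers ps (1ℚ , 1ℚ)))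
              (cong (λ p → weight p ∷ []) tree₂)
              (path>0 2 1 (λ ()) (subst (3 ℕ.≤_) (sym k≡4) (s≤s (s≤s (s≤s z≤n))))))

            double : ∀ a b → suc (a ℕ.+ (b ℕ.+ 0)) ℕ.+ suc (a ℕ.+ (b ℕ.+ 0)) ≡ 1 ℕ.+ ((a ℕ.+ a) ℕ.+ ((b ℕ.+ b) ℕ.+ (1 ℕ.+ 0)))
            double = NatSolver.solve 2 (λ a b →
              let _⊕_ = NatSolver._:+_
                  I   = NatSolver.con 1
                  O   = NatSolver.con 0
              in (I ⊕ (a ⊕ (b ⊕ O))) ⊕ (I ⊕ (a ⊕ (b ⊕ O))) NatSolver.:= I ⊕ ((a ⊕ a) ⊕ ((b ⊕ b) ⊕ (I ⊕ O)))) refl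

          ring-of-trees : Ring-of-trees
          ring-of-trees = record
            { t₁ = single ; t₂ = t ; t₃ = t′ ; ts = []
            ; value = trans ring-value (trans (cong ring-weight (states weight)) (ring-weight-contract t t′))
            ; pos₁ = pos-single
            ; good = (pos-tree tree₁ , arc₂>0) ∷ (pos-tree tree₂ , arc₁>0) ∷ []
            ; order = trans (double (size t) (size t′)) (trans (cong listSum (sym (states extent))) ring-extent)
            }

-- Leafless matching edges and the 4-cycle

module Structure where

  open import Data.Bool as Bool using (Bool; true; false; not; if_then_else_; _∧_)
  open import Data.Bool.Properties using (¬-not)
  open import Data.Empty using (⊥; ⊥-elim)
  open import Data.Fin as Fin using (Fin; zero; suc)
  import Data.Fin.Properties as Fin
  open import Data.Nat as ℕ using (ℕ; zero; suc; z≤n; s≤s)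
  import Data.Nat.Properties as ℕ
  open import Data.Product using (∃-syntax; _×_; _,_; proj₁; proj₂)
  open import Data.Rational using (ℚ; 0ℚ; 1ℚ) renaming (_<_ to _<ℚ_; _≤_ to _≤ℚ_; _+_ to _+ℚ_)
  open import Data.Sum using (_⊎_; inj₁; inj₂; [_,_]′)
  open import Function using (_∘_; id)
  open import Relation.Nullary using (Dec; yes; no; ¬_; does)
  open import Relation.Nullary.Decidable using (_×-dec_; _→-dec_; ¬?; dec-true; dec-false)
  open import Relation.Unary using (Decidable)
  open import Relation.Binary.PropositionalEquality
  open Defs using (Graph; Adj; adj?; symm; irrefl; Unicyclic; Connected; WellCovered)
  open Trees
  open Weighted using (unit; Shearer)
  open PolyLink using (matrix; matrix-symm; Adj⇒matrix; matrix⇒Adj)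
  open Cycles
  open Covered
  open Strip
  open Closed-walk

  third : ∀ {n} → 3 ℕ.≤ n → (a b : Fin n) → ∃[ u ] u ≢ a × u ≢ b
  third {n} 3≤n a b with Fin.any? (λ u → ¬? (u Fin.≟ a) ×-dec ¬? (u Fin.≟ b))
  ... | yes found = found
  ... | no none   = ⊥-elim (ℕ.<⇒≱ 3≤n (Fin.injective⇒≤ {f = λ u → side (u Fin.≟ a)} (λ {u} {v} → same (u Fin.≟ a) (v Fin.≟ a))))
    where
    side : ∀ {u} → Dec (u ≡ a) → Fin 2
    side (yes _) = zero
    side (no _)  = suc zero
    is-b : ∀ {u} → u ≢ a → u ≡ b
    is-b {u} u≢a with u Fin.≟ b
    ... | yes u≡b = u≡b
    ... | no u≢b  = ⊥-elim (none (u , u≢a , u≢b))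
    same : ∀ {u v} (p : Dec (u ≡ a)) (q : Dec (v ≡ a)) → side p ≡ side q → u ≡ v
    same (yes u≡a) (yes v≡a) _ = trans u≡a (sym v≡a)
    same (no u≢a)  (no v≢a)  _ = trans (is-b u≢a) (sym (is-b v≢a))

  private
    true-inv : ∀ {A : Set} (d : Dec A) → does d ≡ true → A
    true-inv (yes a) _ = a

    false-inv : ∀ {A : Set} (d : Dec A) → does d ≡ false → ¬ A
    false-inv (no ¬a) _ = ¬a

  module _ {n} (G : Graph n) (connected : Connected G) (covered : WellCovered G) (unicyclic : Unicyclic G)
           (m : ℕ) (n≡m+m : n ≡ m ℕ.+ m) (3≤m : 3 ℕ.≤ m) where

    private
      6≤n : 6 ℕ.≤ n
      6≤n = subst (6 ℕ.≤_) (sym n≡m+m) (ℕ.+-mono-≤ 3≤m 3≤m)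
      3≤n = ℕ.≤-trans (ℕ.m≤m+n 3 3) 6≤n
      2≤n = ℕ.≤-trans (ℕ.m≤m+n 2 4) 6≤n

      π = partner G connected covered unicyclic 2≤n m n≡m+m
      π-invol = partner-invol G connected covered unicyclic 2≤n m n≡m+m
      π-adj = partner-adj G connected covered unicyclic 2≤n m n≡m+m
      across = λ {v} {a} {b} → neighbours-adjacent G connected covered unicyclic 2≤n m n≡m+m {v} {a} {b}

      leaf? : Decidable (λ v → ∀ w → Adj G v w → w ≡ π v)
      leaf? v = Fin.all? λ w → adj? G v w →-dec (w Fin.≟ π v)

      -- `L` marks the leaves, `bad` the vertices on matching edges without a leaf. If no vertex is
      -- bad, every matching edge is a vertex with its leaf and G is a graph star.
      L bad : Fin n → Bool
      L v   = does (leaf? v)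
      bad v = not (L v) ∧ not (L (π v))

      L-only : ∀ {v} → L v ≡ true → ∀ {w} → Adj G v w → w ≡ π v
      L-only {v} Lv {w} vw = true-inv (leaf? v) Lv w vw

      another : ∀ {v} → L v ≡ false → ∃[ w ] Adj G v w × w ≢ π v
      another {v} Lv with Fin.¬∀⟶∃¬ n _ (λ w → adj? G v w →-dec (w Fin.≟ π v)) (false-inv (leaf? v) Lv)
      ... | w , ¬h with adj? G v w
      ...   | yes vw = w , vw , λ eq → ¬h (λ _ → eq)
      ...   | no ¬vw = ⊥-elim (¬h (⊥-elim ∘ ¬vw))

      -- A matching edge between two leaves would be a component of G.
      L-π : ∀ {v} → L v ≡ true → L (π v) ≡ false
      L-π {v} Lv = ¬-not λ Lπv → contra Lπv (third 3≤n v (π v))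
        where
        module _ (Lπv : L (π v) ≡ true) where
          P : Fin n → Bool
          P u = does (u Fin.≟ v) Bool.∨ does (u Fin.≟ π v)
          P-pair : ∀ {u} → P u ≡ true → u ≡ v ⊎ u ≡ π v
          P-pair {u} Pu with u Fin.≟ v | u Fin.≟ π v
          ... | yes u≡v | _         = inj₁ u≡v
          ... | no _    | yes u≡πv = inj₂ u≡πv
          P-v : P v ≡ true
          P-v rewrite dec-true (v Fin.≟ v) refl = refl
          P-πv : P (π v) ≡ true
          P-πv rewrite dec-true (π v Fin.≟ π v) refl = ∨-true (does (π v Fin.≟ v))
            where
            ∨-true : ∀ b → b Bool.∨ true ≡ true
            ∨-true true  = refl
            ∨-true false = refl
          contra : ∃[ u ] u ≢ v × u ≢ π v → ⊥
          contra (u , u≢v , u≢πv) with cut-edge G connected P {v} {u} P-v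
            (cong₂ Bool._∨_ (dec-false (u Fin.≟ v) u≢v) (dec-false (u Fin.≟ π v) u≢πv))
          ... | a , b , Pa , Pb , ab with P-pair {a} Pa
          ...   | inj₁ refl with () ← trans (sym Pb) (trans (cong P (L-only Lv ab)) P-πv)
          ...   | inj₂ refl with () ← trans (sym Pb) (trans (cong P (trans (L-only Lπv ab) (π-invol v))) P-v)

      bad-L : ∀ {v} → bad v ≡ true → L v ≡ false × L (π v) ≡ false
      bad-L {v} = go (L v) (L (π v))
        where
        go : ∀ a b → not a ∧ not b ≡ true → a ≡ false × b ≡ false
        go false false _ = refl , refl

      L-bad : ∀ {v} → L v ≡ false → L (π v) ≡ false → bad v ≡ true
      L-bad Lv Lπv = cong₂ (λ a b → not a ∧ not b) Lv Lπv

      bad-π : ∀ {v} → bad v ≡ true → bad (π v) ≡ true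
      bad-π {v} bv = let (Lv , Lπv) = bad-L {v} bv in L-bad Lπv (trans (cong L (π-invol v)) Lv)

      -- Ring vertices thus are never leaves, and pruning leaves the ring intact. The first and the
      -- last position need the closing edge.
      two-neighbours : ∀ {W} (ring : Closed-walk (Adj G) W) {a} → a ℕ.< len ring →
        ∃[ u ] ∃[ w ] u ≢ w × Adj G (at ring a) u × Adj G (at ring a) w
      two-neighbours ring {zero} 0<k = at ring 1 , at ring last
        , (λ eq → ℕ.<⇒≢ 1<last (inj ring 1<k (ℕ.≤-reflexive suc-last) eq))
        , step ring 1<k , symm G (close ring suc-last)
        where
        last = ℕ.pred (len ring)
        suc-last : suc last ≡ len ring
        suc-last = ℕ.suc-pred (len ring) {{ℕ.>-nonZero 0<k}}
        1<k = ℕ.≤-trans (ℕ.m≤m+n 2 1) (3≤len ring)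
        1<last : 1 ℕ.< last
        1<last = ℕ.≤-pred (subst (3 ℕ.≤_) (sym suc-last) (3≤len ring))
      two-neighbours ring {suc a} a+1<k with suc (suc a) ℕ.≟ len ring
      ... | yes eq = at ring a , at ring 0
        , (λ e → ℕ.<⇒≢ 0<a (sym (inj ring a<k 0<k e)))
        , symm G (step ring a+1<k) , close ring eq
        where
        a<k = ℕ.<-trans (ℕ.n<1+n a) a+1<k
        0<k = ℕ.≤-trans (s≤s z≤n) a+1<k
        0<a : 0 ℕ.< a
        0<a = ℕ.≤-pred (ℕ.≤-pred (subst (3 ℕ.≤_) (sym eq) (3≤len ring)))
      ... | no neq = at ring a , at ring (suc (suc a))
        , (λ e → ℕ.<⇒≢ (ℕ.m≤n⇒m≤1+n (ℕ.n<1+n a)) (inj ring a<k a+2<k e))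
        , symm G (step ring a+1<k) , step ring a+2<k
        where
        a<k = ℕ.<-trans (ℕ.n<1+n a) a+1<k
        a+2<k = ℕ.≤∧≢⇒< a+1<k neq

    module _ (x : ℚ) (0<c : 0ℚ <ℚ 1ℚ +ℚ x) (x≤0 : x ≤ℚ 0ℚ)
             (shearer₀ : Shearer (matrix G) (matrix-symm G) (unit (λ _ → x))) where
      open Stripping G x 0<c x≤0
      private
        module P = Pendants L π π-invol (λ {v} _ → Adj⇒matrix G (π-adj v))
          (λ Lv vu → L-only Lv (matrix⇒Adj G vu)) L-π

        module Reduced {W₀} (ring : Closed-walk (Adj G) W₀)
                       (bad-on-ring : ∀ {v} → bad v ≡ true → ∃[ a ] a ℕ.< len ring × v ≡ at ring a)
                       (bad-neighbour : ∀ {v w} → bad v ≡ true → Adj G v w → ∃[ a ] a ℕ.< len ring × w ≡ at ring a) where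
          open Hanging unicyclic ring shearer₀ bad bad-on-ring bad-neighbour public

          pruned-alive⁺ : ∀ {v} → L v ≡ false → alive (P.pruned v) ≡ true
          pruned-alive⁺ {v} Lv = go (L (π v)) refl
            where
            go : ∀ b → L (π v) ≡ b → alive (P.pruned v) ≡ true
            go true  Lπv = cong alive (P.pruned-single Lv Lπv)
            go false Lπv = cong alive (P.pruned-raw Lv Lπv)

          initial : Valid P.pruned
          initial = record
            { reduct = P.pruned-reduct
            ; ring-alive = λ {a} a<k → pruned-alive⁺ (¬-not λ La →
                let (u , w , u≢w , au , aw) = two-neighbours ring a<k in
                u≢w (trans (L-only La au) (sym (L-only La aw))))
            ; linked = linked
            ; raw⇒bad = λ {v} eq → let (Lv , Lπv) = P.pruned-raw⁻ {v} eq in L-bad Lv Lπv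
            ; bad⇒raw = λ {v} bv → let (Lv , Lπv) = bad-L {v} bv in P.pruned-raw Lv Lπv
            ; pos-tree = λ {v} eq → subst Pos (sym (P.pruned-tree {v} eq)) (single (ev>0⇒A>0 single
                (subst (λ p → 0ℚ <ℚ proj₁ (weight p) +ℚ proj₂ (weight p)) (trans eq (cong tree (P.pruned-tree {v} eq)))
                  (vertex>0 (shearer P.pruned-reduct shearer₀) v))))
            ; extents = P.pruned-extent
            }
            where
            linked : ∀ (Q : Fin n → Bool) {u v} → alive (P.pruned u) ≡ true → Q u ≡ true →
              alive (P.pruned v) ≡ true → Q v ≡ false →
              ∃[ a ] ∃[ b ] alive (P.pruned a) ≡ true × Q a ≡ true × alive (P.pruned b) ≡ true × Q b ≡ false × Adj G a b
            linked Q {u} {v} u-alive Qu v-alive Qv =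
              go (cut-edge G connected Q′ (trans (Q′≡ (P.pruned-alive {u} u-alive)) Qu) (trans (Q′≡ (P.pruned-alive {v} v-alive)) Qv))
              where
              -- Leaves take the side of their partners, so that a crossing edge joins two vertices
              -- that both survive the pruning.
              Q′ : Fin n → Bool
              Q′ w = if L w then Q (π w) else Q w
              Q′≡ : ∀ {w} → L w ≡ false → Q′ w ≡ Q w
              Q′≡ {w} eq = cong (λ b → if b then Q (π w) else Q w) eq
              Q′π : ∀ {w} → L w ≡ true → Q′ w ≡ Q′ (π w)
              Q′π {w} eq = trans (cong (λ b → if b then Q (π w) else Q w) eq) (sym (Q′≡ (L-π eq)))
              go : ∃[ a ] ∃[ b ] Q′ a ≡ true × Q′ b ≡ false × Adj G a b → _
              go (a , b , Qa , Qb , ab) = cases (L a) (L b) refl refl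
                where
                contra : Q′ a ≡ Q′ b → ⊥
                contra eq with () ← trans (sym Qa) (trans eq Qb)
                cases : ∀ p q → L a ≡ p → L b ≡ q → _
                cases true _ La _ = ⊥-elim (contra (trans (Q′π La) (cong Q′ (sym (L-only La ab)))))
                cases false true _ Lb = ⊥-elim (contra (trans (cong Q′ (L-only Lb (symm G ab))) (sym (Q′π Lb))))
                cases false false La Lb = a , b , pruned-alive⁺ La , trans (sym (Q′≡ La)) Qa
                  , pruned-alive⁺ Lb , trans (sym (Q′≡ Lb)) Qb , ab

          abstract
            stripped : ∃[ s ] Valid s × (∀ v → alive (s v) ≡ true → OnRing v) × Ring.Chordless unicyclic ring
            stripped = strip-all (count (alive ∘ P.pruned)) P.pruned initial ℕ.≤-refl

          final    = proj₁ stripped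
          valid    = proj₁ (proj₂ stripped)
          open Result valid (proj₁ (proj₂ (proj₂ stripped))) (proj₂ (proj₂ (proj₂ stripped))) public

        without-bad : (∀ v → bad v ≢ true) → Ring-of-trees
        without-bad none = All-trees.ring-of-trees (λ {a} _ → none _)
          where open Reduced (fromCycle G (proj₁ unicyclic)) (λ {v} b → ⊥-elim (none v b)) (λ {v} b → ⊥-elim (none v b))

        module With-bad {v} (bad-v : bad v ≡ true) where

          -- Further neighbours of the two ends of a matching edge are adjacent to each other, which
          -- closes a 4-cycle through any matching edge without a leaf.
          four-walk : ∀ {v a b} → Adj G v a → a ≢ π v → Adj G (π v) b → b ≢ v → Closed-walk (Adj G) (λ _ → true)
          four-walk {v} {a} {b} va a≢w wb b≢v = record
            { len = 4 ; 3≤len = s≤s (s≤s (s≤s z≤n)) ; at = position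
            ; inj = λ {i} {j} → position-inj i j
            ; step = λ {i} → position-step i
            ; close = λ { refl → symm G (π-adj v) }
            ; in-W = λ _ → refl
            }
            where
            position : ℕ → Fin n
            position 0 = v
            position 1 = a
            position 2 = b
            position (suc (suc (suc _))) = π v
            ≢-adj : ∀ {u w} → Adj G u w → u ≢ w
            ≢-adj uw refl = irrefl G refl uw
            ab = across va wb
            position-step : ∀ i → suc i ℕ.< 4 → Adj G (position i) (position (suc i))
            position-step 0 _ = va
            position-step 1 _ = ab
            position-step 2 _ = symm G wb
            position-step (suc (suc (suc i))) (s≤s (s≤s (s≤s (s≤s ()))))
            position-inj : ∀ i j → i ℕ.< 4 → j ℕ.< 4 → position i ≡ position j → i ≡ j
            position-inj 0 0 _ _ _ = refl
            position-inj 0 1 _ _ e = ⊥-elim (≢-adj va e)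
            position-inj 0 2 _ _ e = ⊥-elim (b≢v (sym e))
            position-inj 0 3 _ _ e = ⊥-elim (≢-adj (π-adj v) e)
            position-inj 1 0 _ _ e = ⊥-elim (≢-adj va (sym e))
            position-inj 1 1 _ _ _ = refl
            position-inj 1 2 _ _ e = ⊥-elim (≢-adj ab e)
            position-inj 1 3 _ _ e = ⊥-elim (a≢w e)
            position-inj 2 0 _ _ e = ⊥-elim (b≢v e)
            position-inj 2 1 _ _ e = ⊥-elim (≢-adj ab (sym e))
            position-inj 2 2 _ _ _ = refl
            position-inj 2 3 _ _ e = ⊥-elim (≢-adj wb (sym e))
            position-inj 3 0 _ _ e = ⊥-elim (≢-adj (π-adj v) (sym e))
            position-inj 3 1 _ _ e = ⊥-elim (a≢w (sym e))
            position-inj 3 2 _ _ e = ⊥-elim (≢-adj wb e)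
            position-inj 3 3 _ _ _ = refl
            position-inj (suc (suc (suc (suc i)))) _ (s≤s (s≤s (s≤s (s≤s ())))) _ _
            position-inj _ (suc (suc (suc (suc j)))) _ (s≤s (s≤s (s≤s (s≤s ())))) _

          far-neighbour : ∀ {v} → bad v ≡ true → ∃[ b ] Adj G (π v) b × b ≢ v
          far-neighbour {v} bv with another (proj₂ (bad-L {v} bv))
          ... | b , wb , b≢ = b , wb , λ eq → b≢ (trans eq (sym (π-invol v)))

          near = another (proj₁ (bad-L {v} bad-v))
          far  = far-neighbour bad-v
          a₀ = proj₁ near
          b₀ = proj₁ far

          ring₀ = four-walk (proj₁ (proj₂ near)) (proj₂ (proj₂ near)) (proj₁ (proj₂ far)) (proj₂ (proj₂ far))

          OnRing′ : Fin n → Set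
          OnRing′ u = ∃[ a ] a ℕ.< 4 × u ≡ at ring₀ a

          -- As G has only one cycle, the 4-cycle obtained from `u` has the edges of `ring₀`, and
          -- therefore its vertices.
          on-ring : ∀ {u a b} → (ua : Adj G u a) → (a≢ : a ≢ π u) → (ub : Adj G (π u) b) → (b≢ : b ≢ u) →
            OnRing′ u × OnRing′ a × OnRing′ (π u)
          on-ring {u} {a} ua a≢ ub b≢ = toCycle-vertex G id (symm G) ring₀ first , toCycle-vertexʳ G id (symm G) ring₀ first
            , toCycle-vertex G id (symm G) ring₀ closing
            where
            walk = four-walk ua a≢ ub b≢
            same = same-edges unicyclic (toCycle G id (symm G) walk) (toCycle G id (symm G) ring₀)
            first = same (toCycle-step G id (symm G) walk {0} (s≤s (s≤s z≤n)))
            closing = same (toCycle-close G id (symm G) walk {3} refl)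

          bad-on-ring : ∀ {u} → bad u ≡ true → OnRing′ u
          bad-on-ring {u} bu = let (a , ua , a≢) = another (proj₁ (bad-L {u} bu)) ; (b , ub , b≢) = far-neighbour bu in
            proj₁ (on-ring ua a≢ ub b≢)

          bad-neighbour : ∀ {u w} → bad u ≡ true → Adj G u w → OnRing′ w
          bad-neighbour {u} {w} bu uw = go (w Fin.≟ π u)
            where
            go : Dec (w ≡ π u) → OnRing′ w
            go (no w≢)    = let (b , ub , b≢) = far-neighbour bu in proj₁ (proj₂ (on-ring uw w≢ ub b≢))
            go (yes refl) = bad-on-ring (bad-π bu)

          open Reduced ring₀ bad-on-ring bad-neighbour
          open Valid valid

          raw-v : final v ≡ raw
          raw-v = bad⇒raw bad-v
          raw-πv : final (π v) ≡ raw
          raw-πv = bad⇒raw (bad-π bad-v)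

          -- The partner of a bad vertex is on the ring too; `v` and its partner are taken by each
          -- other, and only `b₀` is left.
          πa₀ : bad a₀ ≡ true → π a₀ ≡ b₀
          πa₀ ba = go (bad-neighbour ba (π-adj a₀))
            where
            go : OnRing′ (π a₀) → π a₀ ≡ b₀
            go (0 , _ , e) = ⊥-elim (proj₂ (proj₂ near) (trans (sym (π-invol a₀)) (cong π e)))
            go (1 , _ , e) = ⊥-elim (irrefl G (sym e) (π-adj a₀))
            go (2 , _ , e) = e
            go (3 , _ , e) = ⊥-elim (irrefl G (sym (trans (sym (π-invol a₀)) (trans (cong π e) (π-invol v)))) (proj₁ (proj₂ near)))
            go (suc (suc (suc (suc _))) , s≤s (s≤s (s≤s (s≤s ()))) , _)

          πb₀ : bad b₀ ≡ true → π b₀ ≡ a₀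
          πb₀ bb = go (bad-neighbour bb (π-adj b₀))
            where
            go : OnRing′ (π b₀) → π b₀ ≡ a₀
            go (0 , _ , e) = ⊥-elim (irrefl G (sym (trans (sym (π-invol b₀)) (cong π e))) (proj₁ (proj₂ far)))
            go (1 , _ , e) = e
            go (2 , _ , e) = ⊥-elim (irrefl G (sym e) (π-adj b₀))
            go (3 , _ , e) = ⊥-elim (proj₂ (proj₂ far) (trans (sym (π-invol b₀)) (trans (cong π e) (π-invol v))))
            go (suc (suc (suc (suc _))) , s≤s (s≤s (s≤s (s≤s ()))) , _)

          -- Otherwise the ring would consist of four vertices that have absorbed nothing, and G
          -- would have order 4 instead of at least 6.
          not-both : bad a₀ ≡ true → bad b₀ ≡ true → ⊥
          not-both ba bb = ℕ.<⇒≱ (s≤s (ℕ.m≤n+m 4 1)) (subst (6 ℕ.≤_) (trans (sym ring-extent) four) 6≤n)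
            where
            four : _ ≡ 4
            four = cong₂ ℕ._+_ (cong extent raw-v) (cong₂ ℕ._+_ (cong extent (bad⇒raw ba))
              (cong₂ ℕ._+_ (cong extent (bad⇒raw bb)) (cong (λ p → extent p ℕ.+ 0) raw-πv)))

          is-tree : ∀ {u} → alive (final u) ≡ true → bad u ≢ true → ∃[ t ] final u ≡ tree t
          is-tree {u} u-alive ¬bad = go (final u) refl u-alive
            where
            go : ∀ p → final u ≡ p → alive p ≡ true → ∃[ t ] final u ≡ tree t
            go raw      eq _ = ⊥-elim (¬bad (raw⇒bad eq))
            go (tree t) eq _ = t , eq

          with-bad : Ring-of-trees
          with-bad = Four-ring.ring-of-trees refl raw-v raw-πv
            (proj₂ (is-tree (ring-alive {1} (s≤s (s≤s z≤n))) (λ ba → not-both ba (subst (λ u → bad u ≡ true) (πa₀ ba) (bad-π ba)))))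
            (proj₂ (is-tree (ring-alive {2} (s≤s (s≤s (s≤s z≤n)))) (λ bb → not-both (subst (λ u → bad u ≡ true) (πb₀ bb) (bad-π bb)) bb)))

      abstract
        ring-of-trees : Ring-of-trees
        ring-of-trees with Fin.any? (λ v → bad v Bool.≟ true)
        ... | yes (v , bad-v) = With-bad.with-bad bad-v
        ... | no none         = without-bad (λ v bad-v → none (v , bad-v))

-- Values of the two extremal graph stars

module Explicit where

  open import Data.Bool using (Bool; true; false; if_then_else_)
  open import Data.Bool.Properties using (T-≡)
  open import Data.Empty using (⊥-elim)
  open import Data.Fin as Fin using (Fin; zero; suc; toℕ; fromℕ<; splitAt; _↑ˡ_) renaming (join to joinFin)
  import Data.Fin.Properties as Fin
  open import Data.List using (List; []; _∷_; map; replicate)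
  open import Data.List.Membership.Propositional using (_∈_; _∉_)
  open import Data.List.Relation.Unary.Any using (here; there)
  open import Data.List.Relation.Unary.All using ([])
  open import Data.Nat as ℕ using (ℕ; zero; suc; z≤n; s≤s)
  import Data.Nat.Properties as ℕ
  open import Data.Product using (∃-syntax; _×_; _,_; proj₁; proj₂)
  open import Data.Rational using (ℚ; 0ℚ; 1ℚ) renaming (_<_ to _<ℚ_; _≤_ to _≤ℚ_; _+_ to _+ℚ_; _*_ to _*ℚ_)
  open import Data.Sum using (_⊎_; inj₁; inj₂; [_,_]′; swap)
  open import Data.Unit using (tt)
  open import Function using (_∘_; Equivalence)
  open import Relation.Nullary using (Dec; yes; no)
  open import Relation.Binary.PropositionalEquality
  open Defs using (Graph; Adj; StarAdj; _*; C; U)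
  open Trees
  open Weighted
  open PolyLink using (matrix; matrix-symm; Adj⇒matrix; matrix⇒Adj; _^_)
  open Cycles
  open Strip

  module Star {n} (H : Graph n) (x : ℚ) (0<c : 0ℚ <ℚ 1ℚ +ℚ x) (x≤0 : x ≤ℚ 0ℚ) where
    open Stripping (H *) x 0<c x≤0 public

    is-leaf : Fin n ⊎ Fin n → Bool
    is-leaf (inj₁ _) = false
    is-leaf (inj₂ _) = true

    private
      π : Fin (n ℕ.+ n) → Fin (n ℕ.+ n)
      π v = joinFin n n (swap (splitAt n v))

      split-π : ∀ v → splitAt n (π v) ≡ swap (splitAt n v)
      split-π v = Fin.splitAt-join n n (swap (splitAt n v))

      swap-swap : ∀ (s : Fin n ⊎ Fin n) → swap (swap s) ≡ s
      swap-swap (inj₁ _) = refl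
      swap-swap (inj₂ _) = refl

      adjacent : ∀ s → is-leaf s ≡ true → StarAdj H s (swap s)
      adjacent (inj₂ u) _ = refl

      only : ∀ s t → is-leaf s ≡ true → StarAdj H s t → t ≡ swap s
      only (inj₂ u) (inj₁ .u) _ refl = refl

      swapped : ∀ s → is-leaf s ≡ true → is-leaf (swap s) ≡ false
      swapped (inj₂ u) _ = refl

    module P = Pendants (is-leaf ∘ splitAt n) π
      (λ v → trans (cong (joinFin n n) (trans (cong swap (split-π v)) (swap-swap (splitAt n v)))) (Fin.join-splitAt n n v))
      (λ {v} Lv → Adj⇒matrix (H *) {v} {π v} (subst (StarAdj H (splitAt n v)) (sym (split-π v)) (adjacent (splitAt n v) Lv)))
      (λ {v} {u} Lv vu → trans (sym (Fin.join-splitAt n n u))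
        (cong (joinFin n n) (only (splitAt n v) (splitAt n u) Lv (matrix⇒Adj (H *) {v} {u} vu))))
      (λ {v} Lv → trans (cong is-leaf (split-π v)) (swapped (splitAt n v) Lv))

    core-state : (Fin n → State) → Fin n ⊎ Fin n → State
    core-state f (inj₁ u) = f u
    core-state f (inj₂ _) = gone

    on-core : (Fin n → State) → Fin (n ℕ.+ n) → State
    on-core f v = core-state f (splitAt n v)

    pruned≡ : ∀ v → P.pruned v ≡ on-core (λ _ → tree single) v
    pruned≡ v = go (splitAt n v) refl
      where
      go : ∀ s → splitAt n v ≡ s → P.pruned v ≡ core-state (λ _ → tree single) s
      go (inj₁ u) eq = P.pruned-single (cong is-leaf eq) (trans (cong is-leaf (split-π v)) (cong (is-leaf ∘ swap) eq))
      go (inj₂ u) eq = P.pruned-gone (cong is-leaf eq)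

    core-reduct : Reduct (weight ∘ on-core (λ _ → tree single))
    core-reduct = Reduct-cong (λ v → cong weight (pruned≡ v)) P.pruned-reduct

    core : Fin n → Fin (n ℕ.+ n)
    core u = u ↑ˡ n

    split-core : ∀ u → splitAt n (core u) ≡ inj₁ u
    split-core u = Fin.splitAt-↑ˡ n u n

    on-core≡ : ∀ f u → on-core f (core u) ≡ f u
    on-core≡ f u = cong (core-state f) (split-core u)

    core-adj : ∀ {u v} → Adj H u v → Adj (H *) (core u) (core v)
    core-adj {u} {v} = subst₂ (StarAdj H) (sym (split-core u)) (sym (split-core v))

    core-adj⁻ : ∀ {u v} → Adj (H *) (core u) (core v) → Adj H u v
    core-adj⁻ {u} {v} = subst₂ (StarAdj H) (split-core u) (split-core v)

    core-inj : ∀ {u v} → core u ≡ core v → u ≡ v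
    core-inj {u} {v} = Fin.↑ˡ-injective n u v

    gone-off-core : ∀ f {v} → (∀ u → v ≡ core u → f u ≡ gone) → on-core f v ≡ gone
    gone-off-core f {v} h = go (splitAt n v) refl
      where
      go : ∀ s → splitAt n v ≡ s → core-state f s ≡ gone
      go (inj₁ u) eq = h u (trans (sym (Fin.join-splitAt n n v)) (cong (joinFin n n) eq))
      go (inj₂ _) _  = refl

  module _ (j : ℕ) (x : ℚ) (0<c : 0ℚ <ℚ 1ℚ +ℚ x) (x≤0 : x ≤ℚ 0ℚ) where
    private
      n : ℕ
      n = suc (suc (suc j))

    module Cycle-star where
      open Star (C n) x 0<c x≤0

      private
        vertex : ℕ → Fin n
        vertex a = place (a ℕ.<? n)
          where
          place : ∀ {a} → Dec (a ℕ.< n) → Fin n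
          place (yes a<n) = fromℕ< a<n
          place (no _)    = zero

        toℕ-vertex : ∀ {a} → a ℕ.< n → toℕ (vertex a) ≡ a
        toℕ-vertex {a} a<n with a ℕ.<? n
        ... | yes p = Fin.toℕ-fromℕ< p
        ... | no ¬p = ⊥-elim (¬p a<n)

        vertex-toℕ : ∀ u → vertex (toℕ u) ≡ u
        vertex-toℕ u = Fin.toℕ-injective (toℕ-vertex (Fin.toℕ<n u))

        consecutive : ∀ {a b} → a ℕ.< n → b ℕ.< n → a ≢ b → suc a ≡ b ⊎ (suc a ≡ n × b ≡ 0) →
          Adj (C n) (vertex a) (vertex b)
        consecutive a<n b<n a≢b r =
          (λ eq → a≢b (trans (sym (toℕ-vertex a<n)) (trans (cong toℕ eq) (toℕ-vertex b<n))))
          , inj₁ (subst₂ (λ a b → suc a ≡ b ⊎ (suc a ≡ n × b ≡ 0)) (sym (toℕ-vertex a<n)) (sym (toℕ-vertex b<n)) r)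

        walk : Closed-walk (Adj (C n *)) (λ _ → true)
        walk = record
          { len = n ; 3≤len = s≤s (s≤s (s≤s z≤n)) ; at = core ∘ vertex
          ; inj = λ {a} {b} a<n b<n eq → trans (sym (toℕ-vertex a<n)) (trans (cong toℕ (core-inj {vertex a} {vertex b} eq)) (toℕ-vertex b<n))
          ; step = λ {a} a+1<n → core-adj {vertex a} {vertex (suc a)} (consecutive (ℕ.<-trans (ℕ.n<1+n a) a+1<n) a+1<n (λ eq → ℕ.1+n≢n (sym eq)) (inj₁ refl))
          ; close = λ { {a} refl → core-adj {vertex a} {vertex 0} (consecutive (ℕ.n<1+n a) (s≤s z≤n) (λ ()) (inj₂ (refl , refl))) }
          ; in-W = λ _ → refl
          }

        chordless : ∀ {a b} → a ℕ.< b → b ℕ.< n → Adj (C n *) (core (vertex a)) (core (vertex b)) →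
          b ≡ suc a ⊎ (a ≡ 0 × suc b ≡ n)
        chordless {a} {b} a<b b<n ab = go (proj₂ (core-adj⁻ {vertex a} {vertex b} ab))
          where
          a≡ = toℕ-vertex (ℕ.<-trans a<b b<n)
          b≡ = toℕ-vertex b<n
          R : ℕ → ℕ → Set
          R a b = suc a ≡ b ⊎ (suc a ≡ n × b ≡ 0)
          check : R a b ⊎ R b a → b ≡ suc a ⊎ (a ≡ 0 × suc b ≡ n)
          check (inj₁ (inj₁ eq))        = inj₁ (sym eq)
          check (inj₁ (inj₂ (_ , b≡0))) = ⊥-elim (ℕ.<⇒≱ a<b (subst (ℕ._≤ a) (sym b≡0) z≤n))
          check (inj₂ (inj₁ eq))        = ⊥-elim (ℕ.<⇒≱ a<b (subst (b ℕ.≤_) eq (ℕ.n≤1+n b)))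
          check (inj₂ (inj₂ (eq , a≡0))) = inj₂ (a≡0 , eq)
          go : R (toℕ (vertex a)) (toℕ (vertex b)) ⊎ R (toℕ (vertex b)) (toℕ (vertex a)) → _
          go r = check (subst₂ (λ a b → R a b ⊎ R b a) a≡ b≡ r)

        singles : ∀ a m → map (weight ∘ on-core (λ _ → tree single)) (seg (core ∘ vertex) a m) ≡ map ev (replicate m single)
        singles a zero    = refl
        singles a (suc m) = cong₂ _∷_ (cong weight (on-core≡ (λ _ → tree single) (vertex a))) (singles (suc a) m)

        sizes-replicate : ∀ m → sizes (replicate m single) ≡ m
        sizes-replicate zero    = refl
        sizes-replicate (suc m) = cong suc (sizes-replicate m)

      value : Z (matrix (C n *)) (unit (λ _ → x)) ≡ c ^ n *ℚ path-ring n
      value = begin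
        Z (matrix (C n *)) (unit (λ _ → x))
          ≡⟨ Z≡ core-reduct ⟩
        Z (matrix (C n *)) (weight ∘ on-core (λ _ → tree single))
          ≡⟨ Z-ring (matrix (C n *)) (matrix-symm (C n *)) (core (vertex 0)) (core (vertex 1)) (core (vertex 2)) (seg (core ∘ vertex) 3 j) (weight ∘ on-core (λ _ → tree single))
               (induced-ring (C n *) walk chordless j refl)
               (λ v v∉ → cong weight (gone-off-core (λ _ → tree single) (λ u eq → ⊥-elim (v∉ (subst (_∈ seg (core ∘ vertex) 0 n)
                 (trans (cong core (vertex-toℕ u)) (sym eq)) (seg-∈ (core ∘ vertex) 0 n z≤n (Fin.toℕ<n u))))))) ⟩
        ring-weight (map (weight ∘ on-core (λ _ → tree single)) (seg (core ∘ vertex) 0 n))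
          ≡⟨ cong ring-weight (singles 0 n) ⟩
        ring-weight (map ev (replicate n single))
          ≡⟨ ring-weight≡ single (replicate (suc (suc j)) single) ⟩
        c ^ sizes (replicate n single) *ℚ ring (replicate n single)
          ≡⟨ cong₂ (λ k p → c ^ k *ℚ p) (sizes-replicate n) (ring-singles (suc (suc j))) ⟩
        c ^ n *ℚ path-ring n ∎
        where open ≡-Reasoning

    module Fan-star where
      open Star (U n) x 0<c x≤0

      private
        -- The state after i of the pendant vertices have been stripped into the centre.
        stage : ℕ → ℕ → State
        stage i 0 = tree (fan i)
        stage i 1 = tree single
        stage i 2 = tree single
        stage i (suc (suc (suc a))) = if a ℕ.<ᵇ i then gone else tree single

        state : ℕ → Fin (n ℕ.+ n) → State
        state i = on-core (stage i ∘ toℕ)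

        v₀ v₁ v₂ : Fin n
        v₀ = zero
        v₁ = suc zero
        v₂ = suc (suc zero)

        <ᵇ-irrefl : ∀ i → (i ℕ.<ᵇ i) ≡ false
        <ᵇ-irrefl zero    = refl
        <ᵇ-irrefl (suc i) = <ᵇ-irrefl i

        i<ᵇ1+i : ∀ i → (i ℕ.<ᵇ suc i) ≡ true
        i<ᵇ1+i zero    = refl
        i<ᵇ1+i (suc i) = i<ᵇ1+i i

        <ᵇ-suc : ∀ a i → a ≢ i → (a ℕ.<ᵇ suc i) ≡ (a ℕ.<ᵇ i)
        <ᵇ-suc zero    zero    a≢i = ⊥-elim (a≢i refl)
        <ᵇ-suc zero    (suc i) _   = refl
        <ᵇ-suc (suc a) zero    _   = refl
        <ᵇ-suc (suc a) (suc i) a≢i = <ᵇ-suc a i (λ eq → a≢i (cong suc eq))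

        stage-suc : ∀ i a → a ≢ 0 → a ≢ 3 ℕ.+ i → stage i a ≡ stage (suc i) a
        stage-suc i 0 a≢0 _ = ⊥-elim (a≢0 refl)
        stage-suc i 1 _ _ = refl
        stage-suc i 2 _ _ = refl
        stage-suc i (suc (suc (suc a))) _ a≢ = cong (λ b → if b then gone else tree single)
          (sym (<ᵇ-suc a i (λ eq → a≢ (cong (3 ℕ.+_) eq))))

        start : ∀ v → on-core (λ _ → tree single) v ≡ state 0 v
        start v = go (splitAt n v)
          where
          stage-0 : ∀ a → tree single ≡ stage 0 a
          stage-0 0 = refl
          stage-0 1 = refl
          stage-0 2 = refl
          stage-0 (suc (suc (suc a))) = refl
          go : ∀ s → core-state (λ _ → tree single) s ≡ core-state (stage 0 ∘ toℕ) s
          go (inj₁ u) = stage-0 (toℕ u)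
          go (inj₂ u) = refl

        advance : ∀ i → i ℕ.< j → Reduct (weight ∘ state i) → Reduct (weight ∘ state (suc i))
        advance i i<j r = Reduct-cong
          (λ v → trans (weight-merge (state i) ℓ≢v₀ joined v) (cong weight (after v)))
          (Reduct-merge ℓ≢v₀ (Adj⇒matrix (U n *) {core ℓ} {core v₀} (core-adj {ℓ} {v₀} ℓv₀)) other r)
          where
          3+i<n : 3 ℕ.+ i ℕ.< n
          3+i<n = s≤s (s≤s (s≤s i<j))
          ℓ : Fin n
          ℓ = fromℕ< 3+i<n
          toℕ-ℓ : toℕ ℓ ≡ 3 ℕ.+ i
          toℕ-ℓ = Fin.toℕ-fromℕ< 3+i<n
          ℓ≢v₀ : core ℓ ≢ core v₀
          ℓ≢v₀ eq with () ← trans (sym toℕ-ℓ) (cong toℕ (core-inj {ℓ} {v₀} eq))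
          ℓv₀ : Adj (U n) ℓ v₀
          ℓv₀ = (λ eq → ℓ≢v₀ (cong core eq)) , inj₂ (inj₁ refl)
          at-ℓ : state i (core ℓ) ≡ tree single
          at-ℓ = trans (on-core≡ (stage i ∘ toℕ) ℓ) (trans (cong (stage i) toℕ-ℓ)
            (cong (λ b → if b then gone else tree single) (<ᵇ-irrefl i)))
          at-v₀ : ∀ i → state i (core v₀) ≡ tree (fan i)
          at-v₀ i = on-core≡ (stage i ∘ toℕ) v₀
          joined : weight (tree (fan (suc i))) ≡ join-weight (weight (state i (core v₀))) (weight (state i (core ℓ)))
          joined = sym (cong₂ (λ p q → join-weight (weight p) (weight q)) (at-v₀ i) at-ℓ)
          after : ∀ v → (state i [ core ℓ ≔ gone ] [ core v₀ ≔ tree (fan (suc i)) ]) v ≡ state (suc i) v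
          after v = update-elim {P = _≡ state (suc i) v} (state i [ core ℓ ≔ gone ]) (core v₀) v
            (λ { refl → sym (at-v₀ (suc i)) })
            (λ v≢v₀ → update-elim {P = _≡ state (suc i) v} (state i) (core ℓ) v
              (λ { refl → sym (trans (on-core≡ (stage (suc i) ∘ toℕ) ℓ) (trans (cong (stage (suc i)) toℕ-ℓ)
                     (cong (λ b → if b then gone else tree single) (i<ᵇ1+i i)))) })
              (λ v≢ℓ → go (splitAt n v) refl v≢v₀ v≢ℓ))
            where
            go : ∀ s → splitAt n v ≡ s → v ≢ core v₀ → v ≢ core ℓ →
              core-state (stage i ∘ toℕ) s ≡ core-state (stage (suc i) ∘ toℕ) s
            go (inj₂ _) _  _ _ = refl
            go (inj₁ u) eq v≢v₀ v≢ℓ = stage-suc i (toℕ u)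
              (λ e → v≢v₀ (trans v≡ (cong core (Fin.toℕ-injective e))))
              (λ e → v≢ℓ (trans v≡ (cong core (Fin.toℕ-injective (trans e (sym toℕ-ℓ))))))
              where
              v≡ : v ≡ core u
              v≡ = trans (sym (Fin.join-splitAt n n v)) (cong (joinFin n n) eq)
          other : ∀ u → matrix (U n *) (core ℓ) u ≡ true → u ≢ core v₀ → proj₂ (weight (state i u)) ≡ 0ℚ
          other u ℓu u≢v₀ = cong (proj₂ ∘ weight) (gone-off-core (stage i ∘ toℕ) {u} λ w eq → ⊥-elim (u≢v₀
            (trans eq (cong core (centre w (core-adj⁻ {ℓ} {w} (subst (Adj (U n *) (core ℓ)) eq (matrix⇒Adj (U n *) {core ℓ} {u} ℓu))))))))
            where
            centre : ∀ w → Adj (U n) ℓ w → w ≡ v₀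
            centre w (_ , inj₁ (inj₁ e))       with () ← trans (sym toℕ-ℓ) e
            centre w (_ , inj₁ (inj₂ (e , _))) with () ← trans (sym toℕ-ℓ) e
            centre w (_ , inj₂ (inj₁ e))       = Fin.toℕ-injective e
            centre w (_ , inj₂ (inj₂ (_ , e))) with () ← trans (sym toℕ-ℓ) e

        reduced : ∀ i → i ℕ.≤ j → Reduct (weight ∘ state i)
        reduced zero    _   = Reduct-cong (λ v → cong weight (start v)) core-reduct
        reduced (suc i) i<j = advance i i<j (reduced i (ℕ.<⇒≤ i<j))

        triangle : List (Fin (n ℕ.+ n))
        triangle = core v₀ ∷ core v₁ ∷ core v₂ ∷ []

        link : ∀ {u v} → Adj (U n) u v → matrix (U n *) (core u) (core v) ≡ true
        link {u} {v} uv = Adj⇒matrix (U n *) {core u} {core v} (core-adj {u} {v} uv)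

        ≢-core : ∀ {u v} → u ≢ v → core u ≢ core v
        ≢-core {u} {v} u≢v eq = u≢v (core-inj {u} {v} eq)

        induced : InducedRing (matrix (U n *)) (matrix-symm (U n *)) triangle
        induced = (λ { (here eq) → ≢-core {v₀} {v₁} (λ ()) eq ; (there (here eq)) → ≢-core {v₀} {v₂} (λ ()) eq })
          , link {v₀} {v₁} ((λ ()) , inj₁ (inj₁ refl))
          , link {v₀} {v₂} ((λ ()) , inj₁ (inj₁ refl))
          , (λ { (here eq) → ≢-core {v₁} {v₂} (λ ()) eq })
          , (link {v₁} {v₂} ((λ ()) , inj₁ (inj₂ (refl , refl))) , [])
          , (λ ()) , tt , tt

        off-triangle : ∀ v → v ∉ triangle → state j v ≡ gone
        off-triangle v v∉ = gone-off-core (stage j ∘ toℕ) λ u eq → go u (subst (_∉ triangle) eq v∉)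
          where
          go : ∀ u → core u ∉ triangle → stage j (toℕ u) ≡ gone
          go zero u∉ = ⊥-elim (u∉ (here refl))
          go (suc zero) u∉ = ⊥-elim (u∉ (there (here refl)))
          go (suc (suc zero)) u∉ = ⊥-elim (u∉ (there (there (here refl))))
          go (suc (suc (suc u))) _ = cong (λ b → if b then gone else tree single)
            (Equivalence.to T-≡ (ℕ.<⇒<ᵇ (Fin.toℕ<n u)))

        size-fan : ∀ i → size (fan i) ≡ suc i
        size-fan zero    = refl
        size-fan (suc i) = cong suc (size-fan i)

      value : Z (matrix (U n *)) (unit (λ _ → x)) ≡ c ^ n *ℚ fan-ring j
      value = begin
        Z (matrix (U n *)) (unit (λ _ → x))
          ≡⟨ Z≡ (reduced j ℕ.≤-refl) ⟩
        Z (matrix (U n *)) (weight ∘ state j)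
          ≡⟨ Z-ring (matrix (U n *)) (matrix-symm (U n *)) (core v₀) (core v₁) (core v₂) [] (weight ∘ state j) induced
               (λ v v∉ → cong weight (off-triangle v v∉)) ⟩
        ring-weight (map (weight ∘ state j) triangle)
          ≡⟨ cong ring-weight (cong₂ _∷_ (cong weight (on-core≡ (stage j ∘ toℕ) v₀))
               (cong₂ _∷_ (cong weight (on-core≡ (stage j ∘ toℕ) v₁)) (cong (λ p → weight p ∷ []) (on-core≡ (stage j ∘ toℕ) v₂)))) ⟩
        ring-weight (map ev (fan j ∷ single ∷ single ∷ []))
          ≡⟨ ring-weight≡ (fan j) (single ∷ single ∷ []) ⟩
        c ^ (size (fan j) ℕ.+ 2) *ℚ ring (fan j ∷ single ∷ single ∷ [])
          ≡⟨ cong₂ (λ k p → c ^ k *ℚ p) (trans (cong (ℕ._+ 2) (size-fan j)) (ℕ.+-comm (suc j) 2)) (ring-fan j) ⟩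
        c ^ n *ℚ fan-ring j ∎
        where open ≡-Reasoning

-- Comparison of the largest roots

module Main where

  open import Data.Fin as Fin using (Fin; fromℕ<)
  open import Data.List using (List; _∷_)
  open import Data.Nat as ℕ using (ℕ; suc)
  import Data.Nat.Properties as ℕ
  open import Data.Product using (_×_; _,_)
  open import Data.Rational
  import Data.Rational.Properties as ℚ
  open import Data.Rational.Solver using (module +-*-Solver)
  open import Relation.Nullary using (does)
  open import Relation.Binary.PropositionalEquality
  open Defs using (Graph; Connected; WellCovered; Unicyclic; C; U; _*; ℝ; Isξ; indepPoly)
  open +-*-Solver using (solve; con; _:+_; _:*_; _:-_; :-_; _:=_)
  open Order
  open Trees
  open Weighted hiding (_∣_)
  open Analysis
  open PolyLink
  open Strip
  open Structure
  open Explicit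

  private
    module At-root {k} (H : Graph k) = Roots (matrix H) (matrix-symm H)

  open At-root

  module _ {k kC kU} (G : Graph k) (GC : Graph kC) (GU : Graph kU) where

    -- Both inequalities presuppose positivity of G. In the first comparison G is the graph whose
    -- root is the upper one, in the second the one whose root is the lower one; this is why two
    -- different root comparisons are applied.
    ξ-sandwich : Fin k → Fin kU →
      (∀ x → - 1ℚ < x → x ≤ 0ℚ → Positive-at G x → poly G x ≤ poly GC x) →
      (∀ x → - 1ℚ < x → x ≤ 0ℚ → Positive-at G x → poly GU x ≤ poly G x) →
      (ξC ξG ξU : ℝ) → Isξ GC ξC → Isξ G ξG → Isξ GU ξU → (ξC Defs.≤ ξG) × (ξG Defs.≤ ξU)
    ξ-sandwich v u G≤C U≤G ξC ξG ξU (C-root , _) (G-root , G-max) (_ , U-max) =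
      root≤-by-positivity₂ (matrix GC) (matrix-symm GC) (matrix G) (matrix-symm G)
        (indepPoly G) (indepPoly GC) {ξC} {ξG} C-root G-max (evalℚ-indepPoly G) (evalℚ-indepPoly GC)
        (at-−1 G v) G≤C
      , root≤-by-positivity₁ (matrix G) (matrix-symm G) (matrix GU) (matrix-symm GU)
        (indepPoly GU) (indepPoly G) {ξG} {ξU} G-root U-max (evalℚ-indepPoly GU) (evalℚ-indepPoly G)
        (at-−1 GU u) U≤G
      where
      -- A single vertex already has the value 1 + x, which is 0 at -1.
      at-−1 : ∀ {k} (H : Graph k) → Fin k → NonPositive-at H (- 1ℚ)
      at-−1 H v = (λ u → does (u Fin.≟ v))
        , ℚ.≤-reflexive (Z-vertex (matrix H) (matrix-symm H) (unit (λ _ → - 1ℚ)) v)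

  C*-value : ∀ n j → n ≡ suc (suc (suc j)) → ∀ x 0<c x≤0 →
    poly (C n *) x ≡ Star-weights.c x 0<c x≤0 ^ n * Star-weights.path-ring x 0<c x≤0 n
  C*-value _ j refl x 0<c x≤0 = Cycle-star.value j x 0<c x≤0

  U*-value : ∀ n j → n ≡ suc (suc (suc j)) → ∀ x 0<c x≤0 →
    poly (U n *) x ≡ Star-weights.c x 0<c x≤0 ^ n * Star-weights.fan-ring x 0<c x≤0 j
  U*-value _ j refl x 0<c x≤0 = Fan-star.value j x 0<c x≤0

  module _ (n j : ℕ) (n≡3+j : n ≡ suc (suc (suc j))) (G : Graph (2 ℕ.* n))
           (connected : Connected G) (covered : WellCovered G) (unicyclic : Unicyclic G) where

    private
      3≤n : 3 ℕ.≤ n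
      3≤n = subst (3 ℕ.≤_) (sym n≡3+j) (ℕ.m≤m+n 3 j)

      2n≡ : 2 ℕ.* n ≡ n ℕ.+ n
      2n≡ = cong (n ℕ.+_) (ℕ.+-identityʳ n)

      module Bounds (x : ℚ) (-1<x : - 1ℚ < x) (x≤0 : x ≤ 0ℚ) (pos : Positive-at G x) where

        0<c : 0ℚ < 1ℚ + x
        0<c = subst (0ℚ <_) (identity x) (sub>0 -1<x)
          where identity = solve 1 (λ x → x :- (:- con 1ℚ) := con 1ℚ :+ x) refl

        open Stripping G x 0<c x≤0
        open Ring-of-trees (ring-of-trees G connected covered unicyclic n 2n≡ 3≤n x 0<c x≤0 pos)

        trees : List Tree
        trees = t₁ ∷ t₂ ∷ t₃ ∷ ts

        order≡ : sizes trees ≡ n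
        order≡ = double-injective (sizes trees) n (trans order 2n≡)

        G≡ : poly G x ≡ c ^ n * ring trees
        G≡ = trans value (trans (ring-weight≡ t₁ (t₂ ∷ t₃ ∷ ts)) (cong (λ k → c ^ k * ring trees) order≡))

        0<cⁿ : 0ℚ < c ^ n
        0<cⁿ = ^>0 0<c n

        scale : ∀ {p q} → p ≤ q → c ^ n * p ≤ c ^ n * q
        scale {p} {q} p≤q = ≤-from (*≥0 (ℚ.<⇒≤ 0<cⁿ) (sub≥0 p≤q)) (identity (c ^ n) p q)
          where identity = solve 3 (λ c p q → c :* (q :- p) := c :* q :- c :* p) refl

        ring>0 : 0ℚ < ring trees
        ring>0 = *-cancel>0 0<cⁿ (subst (0ℚ <_) G≡ (Shearer⇒Z>0 (matrix G) (matrix-symm G) {unit (λ _ → x)} pos))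

        G≤C : poly G x ≤ poly (C n *) x
        G≤C = subst₂ _≤_ (sym G≡) (sym (C*-value n j n≡3+j x 0<c x≤0))
          (scale (subst (λ k → ring trees ≤ path-ring k) order≡ (ring≤path-ring pos₁ good ring>0)))

        κ≥0 : 0ℚ ≤ 1ℚ - z
        κ≥0 = subst (0ℚ ≤_) (identity z) (ℚ.<⇒≤ (A-single>0 pos₁))
          where
          identity = solve 1 (λ z → con 1ℚ :- z :* con 1ℚ := con 1ℚ :- z) refl
          A-single>0 : ∀ {t} → Pos t → 0ℚ < A single
          A-single>0 (single p)   = p
          A-single>0 (join p _ _) = A-single>0 p

        pendants≡ : edges t₁ ℕ.+ excess (t₂ ∷ t₃ ∷ ts) ≡ j
        pendants≡ = ℕ.+-cancelˡ-≡ 3 _ _ (trans (sym (trans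
          (cong₂ ℕ._+_ (size≡1+edges t₁) (sizes≡2+excess t₂ t₃ ts))
          (cong suc (trans (ℕ.+-suc (edges t₁) _) (cong suc (ℕ.+-suc (edges t₁) _)))))) (trans order≡ n≡3+j))

        U≤G : poly (U n *) x ≤ poly G x
        U≤G = subst₂ _≤_ (sym (U*-value n j n≡3+j x 0<c x≤0)) (sym G≡)
          (scale (subst (λ k → fan-ring k ≤ ring trees) pendants≡ (fan-ring≤ring κ≥0 pos₁ good)))

    ξ-bounds : (ξC ξG ξU : ℝ) → Isξ (C n *) ξC → Isξ G ξG → Isξ (U n *) ξU → (ξC Defs.≤ ξG) × (ξG Defs.≤ ξU)
    ξ-bounds = ξ-sandwich G (C n *) (U n *)
      (fromℕ< (ℕ.≤-trans (ℕ.≤-trans (ℕ.s≤s ℕ.z≤n) 3≤n) (ℕ.m≤m+n n (n ℕ.+ 0))))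
      (fromℕ< (ℕ.≤-trans (ℕ.≤-trans (ℕ.s≤s ℕ.z≤n) 3≤n) (ℕ.m≤m+n n n)))
      Bounds.G≤C Bounds.U≤G

open import Defs
open import Data.Nat as ℕ using (ℕ)
import Data.Nat.Properties as ℕ
open import Data.Product using (_×_)
open import Relation.Binary.PropositionalEquality using (sym)

corollary3p13 : (n : ℕ) → 3 ℕ.≤ n → (G : Graph (2 ℕ.* n)) →
    Connected G → WellCovered G → Unicyclic G →
    (ξC ξG ξU : ℝ) → Isξ (C n *) ξC → Isξ G ξG → Isξ (U n *) ξU →
    (ξC ≤ ξG) × (ξG ≤ ξU)
corollary3p13 n 3≤n = Main.ξ-bounds n (n ℕ.∸ 3) (sym (ℕ.m+[n∸m]≡n 3≤n))
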